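{- Let $d\ge 3$ and let $\mathrm{Pyr}(\beta_{d-1})$ be the pyramid over the $(d-1)$-dimensional cross-polytope $\beta_{d-1}$. Then: (i) $\mathrm{Pyr}(\beta_{d-1})$ has $(d+1)(d-1)!\,2^{d-1}$ flags, partitioned into $d+1$ orbits under its symmetry group. (ii) $\mathrm{Pyr}(\beta_{d-1})$ is $z$-uniform.
   Context: $\mathrm{Pyr}(\beta_{d-1})$ is the $d$-polytope obtained as a pyramid with base $\beta_{d-1}$ (one new vertex, the apex, joined to all vertices of the base); its symmetry group is the automorphism group of its face lattice. For a $d$-polytope $P$, a flag is a maximal chain $F_1\subset F_2\subset\dots\subset F_d$ of proper nonempty faces with $\dim F_i=i-1$. For $1\le i\le d$, $\sigma_i$ is the involution on flags replacing $F_i$ by the unique other face $F_i'\neq F_i$ with $F_{i-1}\subset F_i'\subset F_{i+1}$ (where $F_0=\emptyset$, $F_{d+1}=P$). Put $T=\sigma_d\sigma_{d-1}\cdots\sigma_1$ ($\sigma_1$ applied first). A zigzag is a circuit $Z=(f_1,\dots,f_l)$ of flags (an orbit of $T$, listed cyclically, up to cyclic shift) with $f_{j+1}=T(f_j)$, indices modulo $l$; $l$ is its length. For a flag $f=(F_1,\dots,F_d)$ there is a unique family of faces $(x_{i,j})_{1\le i\le d,1\le j\le d+1-i}$ with $x_{i,1}=F_i$, $\dim x_{i,j}=i-1$, $x_{i,j}\subset x_{i+1,j}$, $x_{i,j}\subset x_{i+1,j-1}$, and $x_{i,j}\ne x_{i,j-1}$ whenever the indices make sense; the reverse of $f$ is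 the flag $f^t=(x_{1,d},x_{2,d-1},\dots,x_{d,1})$. The reverse of $Z=(f_1,\dots,f_l)$ is the zigzag $Z^t=(f_l^t,\dots,f_1^t)$; a zigzag is identified with its reverse. The signature of $Z$ is the pair $(n_I,n_{II})$, where $2n_I$ is the number of $j$ with $\sigma_1(f_j)\in Z$ and $2n_{II}$ is the number of $j$ with $\sigma_1(f_j)\in Z^t$. $P$ is $z$-uniform if all its zigzags have the same length and the same signature. -}

module Defs where

open import Algebra.Bundles using (CommutativeRing)
open import Data.Bool.Base using (if_then_else_)
open import Data.Fin.Base using (Fin; zero; suc; toℕ; opposite; splitAt)
import Data.Fin.Base as Fin
open import Data.Fin.Properties using (_≟_)
open import Data.Fin.Subset using (Subset; _∈_; _∉_; _⊂_; ∣_∣; Nonempty; ⊤)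
open import Data.Fin.Subset.Properties using (⊆-poset)
open import Data.List.Base using (foldr; allFin)
open import Data.Nat.Base as ℕ using (ℕ; zero; suc; NonZero)
open import Data.Nat.DivMod using (_mod_)
open import Data.Product.Base using (Σ; ∃; ∃-syntax; _×_; proj₁)
open import Data.Rational.Base using (ℚ; 0ℚ; 1ℚ; -_; _*_; _<_)
open import Data.Rational.Properties using (+-*-commutativeRing)
open import Data.Sum.Base using ([_,_]′)
open import Data.Vec.Functional using (Vector; _∷_; replicate)
open import Function.Bundles using (_⇔_)
open import Function.Definitions using (Surjective)
open import Level using (0ℓ)
open import Relation.Binary.Bundles using (Poset)
open import Relation.Binary.Construct.Composition using (_;_)
import Relation.Binary.Construct.On as On
open import Relation.Binary.Core using (Rel)
open import Relation.Binary.Morphism.Structures using (IsOrderIsomorphism)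
open import Relation.Binary.PropositionalEquality.Core using (_≡_; _≢_)
open import Relation.Nullary.Decidable.Core using (does)
open import Relation.Nullary.Negation.Core using (¬_)
open import Relation.Unary using (Pred)

open import Algebra.Properties.Semiring.Sum
  (CommutativeRing.semiring +-*-commutativeRing) public using (sum)

-- The relation ~ has exactly k classes (the equivalence property of ~ is
-- implied by the second component).
HasClasses : {A : Set} → Rel A 0ℓ → ℕ → Set
HasClasses {A} _~_ k =
  Σ (A → Fin k) λ class →
    Surjective _≡_ _≡_ class × (∀ x y → class x ≡ class y ⇔ x ~ y)

-- Exactly k indices satisfy P.
HasCount : ∀ {n} → Pred (Fin n) 0ℓ → ℕ → Set
HasCount {n} P k = ∃[ S ] (∀ (j : Fin n) → j ∈ S ⇔ P j) × ∣ S ∣ ≡ k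

-- A polytope in ℚ^d, given as the convex hull of its list of vertices.
-- Convex position and full dimensionality are not recorded; both hold for
-- the cross-polytopes and for the pyramids over them built below.
record Polytope (d : ℕ) : Set where
  field
    size   : ℕ
    vertex : Fin size → Vector ℚ d

infixl 7 _·_
_·_ : ∀ {d} → Vector ℚ d → Vector ℚ d → ℚ
u · v = sum (λ i → u i * v i)

unit : ∀ {n} → Fin n → Vector ℚ n
unit i j = if does (i ≟ j) then 1ℚ else 0ℚ

-- conv {±eᵢ}: index i < n gives eᵢ, index n + i gives -eᵢ.
crossPolytope : ∀ n → Polytope n
crossPolytope n = record
  { size   = n ℕ.+ n
  ; vertex = λ v → [ unit , (λ i j → - unit i j) ]′ (splitAt n v)
  }

-- The base is placed in the hyperplane x₀ = 0, the apex at (1, 0, …, 0).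
pyramid : ∀ {n} → Polytope n → Polytope (suc n)
pyramid {n} P = record
  { size   = suc size
  ; vertex = (1ℚ ∷ replicate n 0ℚ) ∷ (λ v → 0ℚ ∷ vertex v)
  }
  where open Polytope P

module Faces {d : ℕ} (P : Polytope d) where
  open Polytope P

  -- Faces are represented by their vertex sets: those sets cut out by a valid
  -- inequality a · x ≤ b.  a = 0 yields ∅ (b = 1) and P itself (b = 0).
  -- As the vertices are rational, real inequalities give the same sets.
  IsFace : Pred (Subset size) 0ℓ
  IsFace S = ∃[ a ] ∃[ b ] ∀ v →
    (v ∈ S → a · vertex v ≡ b) × (v ∉ S → a · vertex v < b)

  Face : Set
  Face = Σ (Subset size) IsFace

  -- Inclusion of vertex sets; the choice of inequality is ignored.
  faceLattice : Poset 0ℓ 0ℓ 0ℓ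
  faceLattice = On.poset {B = Face} (⊆-poset size) proj₁

  open Poset faceLattice public using (_≈_; _≤_; _≉_)

  infix 4 _⊏_
  _⊏_ : Rel Face 0ℓ
  F ⊏ G = proj₁ F ⊂ proj₁ G

  AffinelyIndependent : ∀ {k} → (Fin k → Fin size) → Set
  AffinelyIndependent {k} p = ∀ (c : Vector ℚ k) →
    sum c ≡ 0ℚ → (∀ x → sum (λ i → c i * vertex (p i) x) ≡ 0ℚ) →
    ∀ i → c i ≡ 0ℚ

  _InAffineHullOf_ : ∀ {k} → Fin size → (Fin k → Fin size) → Set
  _InAffineHullOf_ {k} v p = Σ (Vector ℚ k) λ c →
    sum c ≡ 1ℚ × (∀ x → sum (λ i → c i * vertex (p i) x) ≡ vertex v x)

  -- Affine dimension: the vertex set has an affine basis of k + 1 points.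
  HasDim : Face → ℕ → Set
  HasDim F k = Σ (Fin (suc k) → Fin size) λ p →
    (∀ i → p i ∈ proj₁ F) ×
    AffinelyIndependent p ×
    (∀ v → v ∈ proj₁ F → v InAffineHullOf p)

  record Automorphism : Set where
    field
      ⟦_⟧                : Face → Face
      isOrderIsomorphism : IsOrderIsomorphism _≈_ _≈_ _≤_ _≤_ ⟦_⟧

-- The dimension is written suc n so that the first exchange σ zero always
-- makes sense.  Indices start at 0: face i of a flag is Fᵢ₊₁, and σ i is σᵢ₊₁.
module Flags {n : ℕ} (P : Polytope (suc n)) where
  open Polytope P
  open Faces P

  private
    d = suc n

  -- Having a face in each of the dimensions 0, …, d - 1, such a chain is maximal.
  record Flag : Set where
    field
      face     : Fin d → Face
      nonempty : ∀ i → Nonempty (proj₁ (face i))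
      proper   : ∀ i → proj₁ (face i) ≢ ⊤
      chain    : ∀ i j → i Fin.< j → face i ⊏ face j
      dim      : ∀ i → HasDim (face i) (toℕ i)

  open Flag public

  infix 4 _≈ᶠ_
  _≈ᶠ_ : Rel Flag 0ℓ
  f ≈ᶠ g = ∀ i → face f i ≈ face g i

  SameOrbit : Rel Flag 0ℓ
  SameOrbit f g = Σ Automorphism λ φ →
    ∀ i → Automorphism.⟦_⟧ φ (face f i) ≈ face g i

  -- The exchanges, T and the reversal are given by their graphs.  In σ i f g
  -- the inclusions of the new face between its neighbours hold as g is a flag.
  σ : Fin d → Rel Flag 0ℓ
  σ i f g = (face f i ≉ face g i) × (∀ j → j ≢ i → face f j ≈ face g j)

  -- _;_ is diagrammatic composition, so σ zero is applied first.
  T : Rel Flag 0ℓ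
  T = foldr (λ i R → σ i ; R) _≈ᶠ_ (allFin d)

  -- x i j is x_{i+1,j+1}; only the values with i + j < d matter.
  record ReverseFamily (f : Flag) (x : ℕ → ℕ → Face) : Set where
    field
      first : ∀ i → x (toℕ i) 0 ≈ face f i
      dim   : ∀ i j → i ℕ.+ j ℕ.< d → HasDim (x i j) i
      up    : ∀ i j → suc i ℕ.+ j ℕ.< d → x i j ⊏ x (suc i) j
      diag  : ∀ i j → i ℕ.+ suc j ℕ.< d → x i (suc j) ⊏ x (suc i) j
      new   : ∀ i j → i ℕ.+ suc j ℕ.< d → x i (suc j) ≉ x i j

  Reverse : Rel Flag 0ℓ
  Reverse f g = Σ (ℕ → ℕ → Face) λ x →
    ReverseFamily f x × (∀ i → face g i ≈ x (toℕ i) (toℕ (opposite i)))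

  record Zigzag : Set where
    field
      length      : ℕ
      .{{length≢0}} : NonZero length
      flag        : Fin length → Flag
      distinct    : ∀ j k → flag j ≈ᶠ flag k → j ≡ k
      step        : ∀ j → T (flag j) (flag (suc (toℕ j) mod length))

  open Zigzag public using (length; flag)

  _∈ᶻ_ : Flag → Zigzag → Set
  g ∈ᶻ Z = ∃[ j ] flag Z j ≈ᶠ g

  -- Membership in the reverse zigzag Zᵗ.
  _∈ᵗ_ : Flag → Zigzag → Set
  g ∈ᵗ Z = ∃[ j ] Reverse (flag Z j) g

  HasSignature : Zigzag → ℕ → ℕ → Set
  HasSignature Z nI nII =
    HasCount (λ j → ∃[ g ] σ zero (flag Z j) g × g ∈ᶻ Z) (2 ℕ.* nI) ×
    HasCount (λ j → ∃[ g ] σ zero (flag Z j) g × g ∈ᵗ Z) (2 ℕ.* nII)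

  -- Z and Zᵗ both occur as elements of Zigzag; identifying them does not
  -- affect a condition imposed on all zigzags.
  ZUniform : Set
  ZUniform = ∃[ l ] ∃[ nI ] ∃[ nII ] ∀ Z →
    length Z ≡ l × HasSignature Z nI nII

{-# OPTIONS --safe #-}

-- A flag of Pyr(β_n), n = d - 1, lists the vertices in the order in which they
-- enter its faces: a signed permutation of the n coordinates together with the
-- position k of the apex, where k = n + 1 stands for the flags whose facet is
-- the base.  This gives the number of flags.  All symmetries fix the apex, and
-- those of the base permute the signed permutations transitively, so that k is
-- the only invariant of a flag.
--
-- Arrange the 2n signed positions in a circle such that antipodal vertices of
-- the base lie opposite.  Then T lowers k by one and rotates the circle by one
-- step, except that k = 0 is reset to n + 1 without a rotation.  After z rounds
-- of n + 2 steps the circle has been rotated z (n + 1) times, so that every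
-- zigzag has length 2n (n + 2) if n is even and n (n + 2) if n is odd.
-- Reversing a flag reflects the circle, while σ₁ exchanges k = 0 and k = 1 and
-- transposes the first two positions if k ≥ 2.  That transposition is never a
-- rotation, and it is a reflection only for n = 2.  Hence the signature is
-- (4 , 4) for n = 2, (2n , 0) for even n ≥ 4 and (0 , 0) for odd n.

module Submission where

open import Defs
open import Data.Nat.Base using (ℕ; _≤_; _+_; _*_; _∸_; _^_; _!)
open import Data.Product.Base using (_×_)
open import Algebra.Bundles using (CommutativeRing)
open import Data.Bool.Base using (Bool; true; false; not; if_then_else_; _xor_)
import Data.Bool.Properties as Bool
open import Data.Empty using (⊥; ⊥-elim)
open import Data.Fin.Base as Fin using (Fin; zero; suc; toℕ; splitAt; _↑ˡ_; _↑ʳ_; fromℕ; fromℕ<; inject₁; combine; funToFin; finToFun; opposite; join)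
open import Data.Fin.Permutation as Perm using (Permutation′; _⟨$⟩ʳ_; _⟨$⟩ˡ_; inverseˡ; inverseʳ; permutation; _∘ₚ_; remove; punchIn-permute; insert; remove-insert; transpose; reverse)
open import Data.Fin.Properties as Fin using (_≟_; any?; splitAt-↑ˡ; splitAt-↑ʳ; join-splitAt; toℕ-injective; toℕ<n; toℕ≤pred[n]; toℕ-fromℕ<; toℕ-fromℕ; toℕ-inject₁; ≤fromℕ; punchOut-injective; injective⇒≤; combine-injective; combine-surjective; funToFin-finToFin; finToFun-funToFin; 2↔Bool; punchIn-injective; cast-involutive; opposite-prop; suc-injective)
open import Data.Fin.Subset using (Subset; _∈_; _∉_; _⊆_; _⊂_; Nonempty; ∣_∣) renaming (⊥ to ∅)
open import Data.Fin.Subset.Properties using (_∈?_; ⊆-antisym; ∈⊤; nonempty?; ∉⊥; ∣⊥∣≡0)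
open import Data.List.Base as List using (List; []; _∷_; foldr; allFin)
import Data.List.Membership.Propositional as List
open import Data.List.Membership.Propositional.Properties using (∈-allFin)
open import Data.List.Relation.Unary.All as All using (All; []; _∷_)
open import Data.List.Relation.Unary.AllPairs using (AllPairs; []; _∷_)
open import Data.List.Relation.Unary.AllPairs.Properties using (tabulate⁺-<)
open import Data.List.Relation.Unary.Any using (here; there)
open import Data.Nat.Base as ℕ using (zero; suc; _<_; z≤n; s≤s; NonZero)
open import Data.Nat.DivMod using (_%_; [m+kn]%n≡m%n; m<n⇒m%n≡m; _mod_; m%n<n; %-distribˡ-+; m%n%n≡m%n; [m+n]%n≡m%n)
open import Data.Nat.Divisibility using (_∣_; divides; ∣m+n∣m⇒∣n; n∣m*n; m∣m*n; *-monoˡ-∣; *-cancelˡ-∣; ∣1⇒≡1; ∣-trans; ∣-antisym; ∣-reflexive; m%n≡0⇒n∣m)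
open import Data.Nat.Properties as ℕ using (_≤?_)
open import Data.Product.Base using (Σ; ∃-syntax; _,_; proj₁; proj₂)
open import Data.Rational.Base as ℚ using (ℚ; 0ℚ; 1ℚ; -_)
import Data.Rational.Properties as ℚ
open import Data.Sum.Base using (_⊎_; inj₁; inj₂; [_,_]′)
open import Data.Vec.Base using (tabulate)
open import Data.Vec.Properties using (lookup⇒[]=; []=⇒lookup; lookup∘tabulate; tabulate-cong)
open import Function.Base using (_∘_; id; const)
open import Function.Bundles using (_⇔_; mk⇔; Equivalence; Inverse)
open import Function.Construct.Composition using (_⇔-∘_)
open import Function.Construct.Symmetry using (⇔-sym)
open import Function.Definitions using (Surjective)
open import Relation.Binary.Core using (Rel)
open import Relation.Binary.Definitions using (tri<; tri≈; tri>; Tri)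
open import Relation.Binary.Morphism.Structures using (IsOrderIsomorphism)
open import Relation.Binary.PropositionalEquality
open import Relation.Nullary.Decidable using (Dec; yes; no; does; dec-true; dec-false; _×-dec_; _⊎-dec_)
open import Relation.Nullary.Negation using (contradiction; ¬_)
open import Algebra.Properties.Group ℚ.+-0-group using () renaming (⁻¹-involutive to neg-involutive)
open import Algebra.Properties.Semiring.Sum (CommutativeRing.semiring ℚ.+-*-commutativeRing)
  using (sum-cong-≗; sum-replicate-zero; ∑-distrib-+)

-- Faces of the pyramid

-- Faces are given by inequalities, exchanges and reversals only by their graphs, and symmetries as
-- order isomorphisms that need not come from vertex maps. All of this is reduced to one criterion:
-- a vertex set is a face if and only if, once it contains two antipodal vertices of the base, it
-- contains the whole base. A flag then becomes a rank function on the vertices whose sublevel sets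
-- are its faces. The diamond property says that a face squeezed between its neighbours and
-- different from the old one is a sublevel set of the next model; one induction on this settles
-- `T`, σ₁ and the triangular family behind the reversal. For zigzags, let t steps consist of z
-- resets of the apex and a = t - z rotations; they move the apex from k to k + z (n + 2) - t. A
-- flag returns exactly if t = z (n + 2) and 2n divides a = z (n + 1). As n and n + 1 are coprime, n
-- divides z, and the parity of n decides about the factor 2. Parity also decides whether the
-- exchange between k = 0 and k = 1, which needs a = z (n + 1) - 1 or a = z (n + 1) + 1, stays
-- inside the zigzag.

data Vtx (n : ℕ) : Set where
  apex : Vtx n
  base : Fin n → Bool → Vtx n

base-injective : ∀ {n} {c c′ : Fin n} {s s′} → base c s ≡ base c′ s′ → c ≡ c′ × s ≡ s′
base-injective refl = refl , refl

_≟ᵛ_ : ∀ {n} (x y : Vtx n) → Dec (x ≡ y)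
apex ≟ᵛ apex = yes refl
apex ≟ᵛ base _ _ = no λ ()
base _ _ ≟ᵛ apex = no λ ()
base c s ≟ᵛ base c′ s′ with c ≟ c′ | s Bool.≟ s′
... | yes refl | yes refl = yes refl
... | no c≢c′  | _        = no (c≢c′ ∘ proj₁ ∘ base-injective)
... | _        | no s≢s′  = no (s≢s′ ∘ proj₂ ∘ base-injective)

idx : ∀ {n} → Vtx n → Fin (suc (n ℕ.+ n))
idx apex               = zero
idx {n} (base c false) = suc (c ↑ˡ n)
idx {n} (base c true)  = suc (n ↑ʳ c)

vtx : ∀ n → Fin (suc (n ℕ.+ n)) → Vtx n
vtx n zero    = apex
vtx n (suc v) = [ (λ c → base c false) , (λ c → base c true) ]′ (splitAt n v)

idx-vtx : ∀ n (v : Fin (suc (n ℕ.+ n))) → idx (vtx n v) ≡ v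
idx-vtx n zero = refl
idx-vtx n (suc v) with splitAt n v in eq
... | inj₁ c = cong suc (trans (cong (join n n) (sym eq)) (join-splitAt n n v))
... | inj₂ c = cong suc (trans (cong (join n n) (sym eq)) (join-splitAt n n v))

vtx-idx : ∀ {n} (x : Vtx n) → vtx n (idx x) ≡ x
vtx-idx apex = refl
vtx-idx {n} (base c false) rewrite splitAt-↑ˡ n c n = refl
vtx-idx {n} (base c true)  rewrite splitAt-↑ʳ n n c = refl

-- The only coordinate in which the vertex is nonzero; `sign` is its value there. Two vertices share
-- it exactly if they are equal or antipodal.
coord : ∀ {n} → Vtx n → Fin (suc n)
coord apex       = zero
coord (base c s) = suc c

sum-single : ∀ {m} (f : Fin m → ℚ) j → (∀ i → i ≢ j → f i ≡ 0ℚ) → sum f ≡ f j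
sum-single {suc m} f zero f≡0 = begin
  f zero ℚ.+ sum (f ∘ suc)       ≡⟨ cong (f zero ℚ.+_) (sum-cong-≗ (λ i → f≡0 (suc i) λ ())) ⟩
  f zero ℚ.+ sum {m} (λ _ → 0ℚ)  ≡⟨ cong (f zero ℚ.+_) (sum-replicate-zero m) ⟩
  f zero ℚ.+ 0ℚ                  ≡⟨ ℚ.+-identityʳ _ ⟩
  f zero                       ∎
  where open ≡-Reasoning
sum-single {suc m} f (suc j) f≡0 = begin
  f zero ℚ.+ sum (f ∘ suc)  ≡⟨ cong₂ ℚ._+_ (f≡0 zero λ ()) (sum-single (f ∘ suc) j λ i i≢j → f≡0 (suc i) (i≢j ∘ suc-injective)) ⟩
  0ℚ ℚ.+ f (suc j)          ≡⟨ ℚ.+-identityˡ _ ⟩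
  f (suc j)               ∎
  where open ≡-Reasoning

sign : ∀ {n} → Vtx n → ℚ
sign apex           = 1ℚ
sign (base _ false) = 1ℚ
sign (base _ true)  = - 1ℚ

unit-diag : ∀ {n} (i : Fin n) → unit i i ≡ 1ℚ
unit-diag i = cong (λ b → if b then 1ℚ else 0ℚ) (dec-true (i ≟ i) refl)

unit-off : ∀ {n} {i j : Fin n} → i ≢ j → unit i j ≡ 0ℚ
unit-off {i = i} {j} i≢j = cong (λ b → if b then 1ℚ else 0ℚ) (dec-false (i ≟ j) i≢j)

module Pyramid (n : ℕ) where

  open import Data.Rational.Solver using (module +-*-Solver)
  open +-*-Solver using (solve; _:+_; _:*_; :-_; _:=_)

  VSet : Set
  VSet = Subset (suc (n ℕ.+ n))

  infix 4 _∈ᵛ_ _∉ᵛ_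
  _∈ᵛ_ _∉ᵛ_ : Vtx n → VSet → Set
  x ∈ᵛ S = idx x ∈ S
  x ∉ᵛ S = ¬ (x ∈ᵛ S)

  ∈ᵛ⇒∈ : ∀ v {S : VSet} → vtx n v ∈ᵛ S → v ∈ S
  ∈ᵛ⇒∈ v {S} = subst (_∈ S) (idx-vtx n v)

  ∈⇒∈ᵛ : ∀ v {S : VSet} → v ∈ S → vtx n v ∈ᵛ S
  ∈⇒∈ᵛ v {S} = subst (_∈ S) (sym (idx-vtx n v))

  ⊆ᵛ⇒⊆ : {S S′ : VSet} → (∀ x → x ∈ᵛ S → x ∈ᵛ S′) → S ⊆ S′
  ⊆ᵛ⇒⊆ S⊆S′ {v} v∈S = ∈ᵛ⇒∈ v (S⊆S′ (vtx n v) (∈⇒∈ᵛ v v∈S))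

  subset : {P : Vtx n → Set} → (∀ x → Dec (P x)) → VSet
  subset P? = tabulate λ v → does (P? (vtx n v))

  module _ {P : Vtx n → Set} (P? : ∀ x → Dec (P x)) where

    ∈-subset⁺ : ∀ {x} → P x → x ∈ᵛ subset P?
    ∈-subset⁺ {x} p = lookup⇒[]= (idx x) (subset P?) (begin
      _                          ≡⟨ lookup∘tabulate (λ v → does (P? (vtx n v))) (idx x) ⟩
      does (P? (vtx n (idx x)))  ≡⟨ cong (does ∘ P?) (vtx-idx x) ⟩
      does (P? x)                ≡⟨ dec-true (P? x) p ⟩
      true                       ∎)
      where open ≡-Reasoning

    ∈-subset⁻ : ∀ {x} → x ∈ᵛ subset P? → P x
    ∈-subset⁻ {x} x∈ with P? x
    ... | yes p = p
    ... | no ¬p = contradiction (begin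
      true                       ≡⟨ []=⇒lookup x∈ ⟨
      _                          ≡⟨ lookup∘tabulate (λ v → does (P? (vtx n v))) (idx x) ⟩
      does (P? (vtx n (idx x)))  ≡⟨ cong (does ∘ P?) (vtx-idx x) ⟩
      does (P? x)                ≡⟨ dec-false (P? x) ¬p ⟩
      false                      ∎) λ ()
      where open ≡-Reasoning

  P : Polytope (suc n)
  P = pyramid (crossPolytope n)

  open Polytope P
  open Faces P

  vertex-coord : ∀ x → vertex (idx x) (coord x) ≡ sign x
  vertex-coord apex = refl
  vertex-coord (base c false) rewrite splitAt-↑ˡ n c n = unit-diag c
  vertex-coord (base c true)  rewrite splitAt-↑ʳ n n c = cong -_ (unit-diag c)

  vertex-off : ∀ x i → i ≢ coord x → vertex (idx x) i ≡ 0ℚ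
  vertex-off apex       zero    0≢0 = contradiction refl 0≢0
  vertex-off apex       (suc i) _ = refl
  vertex-off (base c false) zero    _ = refl
  vertex-off (base c true)  zero    _ = refl
  vertex-off (base c false) (suc i) i≢c rewrite splitAt-↑ˡ n c n = unit-off (i≢c ∘ cong suc ∘ sym)
  vertex-off (base c true)  (suc i) i≢c rewrite splitAt-↑ʳ n n c = cong -_ (unit-off (i≢c ∘ cong suc ∘ sym))

  ·-vertex : ∀ a x → a · vertex (idx x) ≡ a (coord x) ℚ.* sign x
  ·-vertex a x = begin
    a · vertex (idx x)                      ≡⟨ sum-single _ (coord x) (λ i i≢ → trans (cong (a i ℚ.*_) (vertex-off x i i≢)) (ℚ.*-zeroʳ (a i))) ⟩
    a (coord x) ℚ.* vertex (idx x) (coord x)  ≡⟨ cong (a (coord x) ℚ.*_) (vertex-coord x) ⟩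
    a (coord x) ℚ.* sign x                    ∎
    where open ≡-Reasoning

  vertex-true : ∀ c j → vertex (idx (base c true)) (suc j) ≡ - unit c j
  vertex-true c j rewrite splitAt-↑ʳ n n c = refl

  -- Combinatorial substitute for `IsFace`, equivalent to it by `face-closed` and `closed-face`. The
  -- apex is unrestricted: each face of the base, the base included, is a face with and without the
  -- apex.
  Closed : Subset size → Set
  Closed S = ∀ c → base c false ∈ᵛ S → base c true ∈ᵛ S → ∀ c′ s → base c′ s ∈ᵛ S

  abstract

    -- A valid inequality that is tight at two antipodal vertices of the base
    -- has right-hand side 0, so that it is tight on the whole base.
    face-closed : ∀ {S} → IsFace S → Closed S
    face-closed {S} (a , b , valid) c e∈S e′∈S c′ s = go (idx (base c′ s) ∈? S)
      where
      open ≡-Reasoning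

      y : Fin n → ℚ
      y i = a (suc i)

      val : ∀ i → (a · vertex (idx (base i false)) ≡ y i) × (a · vertex (idx (base i true)) ≡ - y i)
      val i = trans (·-vertex a (base i false)) (ℚ.*-identityʳ (y i))
            , trans (·-vertex a (base i true)) (begin
                y i ℚ.* - 1ℚ    ≡⟨ ℚ.neg-distribʳ-* (y i) 1ℚ ⟨
                - (y i ℚ.* 1ℚ)  ≡⟨ cong -_ (ℚ.*-identityʳ (y i)) ⟩
                - y i         ∎)

      yc≡b : y c ≡ b
      yc≡b = trans (sym (proj₁ (val c))) (proj₁ (valid _) e∈S)

      -yc≡b : - y c ≡ b
      -yc≡b = trans (sym (proj₂ (val c))) (proj₁ (valid _) e′∈S)

      y≤0⇒ : ∀ q → q ≡ - q → q ≡ 0ℚ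
      y≤0⇒ q q≡-q with ℚ.<-cmp q 0ℚ
      ... | tri< q<0 _ _ = contradiction (subst (0ℚ ℚ.<_) (sym q≡-q) (ℚ.neg-antimono-< q<0)) (ℚ.<-asym q<0)
      ... | tri≈ _ q≡0 _ = q≡0
      ... | tri> _ _ 0<q = contradiction (subst (ℚ._< 0ℚ) (sym q≡-q) (ℚ.neg-antimono-< 0<q)) (ℚ.<-asym 0<q)

      b≡0 : b ≡ 0ℚ
      b≡0 = trans (sym yc≡b) (y≤0⇒ (y c) (trans yc≡b (sym -yc≡b)))

      bound : ∀ v → ¬ (0ℚ ℚ.< a · vertex v)
      bound v 0<av with v ∈? S
      ... | yes v∈S = ℚ.<-irrefl (sym (trans (proj₁ (valid v) v∈S) b≡0)) 0<av
      ... | no  v∉S = ℚ.<-asym 0<av (subst (a · vertex v ℚ.<_) b≡0 (proj₂ (valid v) v∉S))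

      -- A value below 0 at one vertex would be a value above 0 = b at its antipode, against
      -- validity.
      ¬-< : ∀ s → ¬ (a · vertex (idx (base c′ s)) ℚ.< 0ℚ)
      ¬-< false av<0 = bound (idx (base c′ true)) (subst (0ℚ ℚ.<_) (sym (proj₂ (val c′)))
                         (ℚ.neg-antimono-< (subst (ℚ._< 0ℚ) (proj₁ (val c′)) av<0)))
      ¬-< true  av<0 = bound (idx (base c′ false)) (subst (0ℚ ℚ.<_)
                         (trans (neg-involutive (y c′)) (sym (proj₁ (val c′))))
                         (ℚ.neg-antimono-< (subst (ℚ._< 0ℚ) (proj₂ (val c′)) av<0)))

      go : Dec (base c′ s ∈ᵛ S) → base c′ s ∈ᵛ S
      go (yes x∈S) = x∈S
      go (no  x∉S) = contradiction (subst (_ ℚ.<_) b≡0 (proj₂ (valid _) x∉S)) (¬-< s)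

  cut : ∀ {S} a b → (∀ x → (x ∈ᵛ S → a (coord x) ℚ.* sign x ≡ b) × (x ∉ᵛ S → a (coord x) ℚ.* sign x ℚ.< b)) →
        IsFace S
  cut {S} a b valid = a , b , λ v → subst (λ v → (v ∈ S → a · vertex v ≡ b) × (v ∉ S → a · vertex v ℚ.< b)) (idx-vtx n v)
    ( (λ v∈S → trans (·-vertex a (vtx n v)) (proj₁ (valid (vtx n v)) v∈S))
    , (λ v∉S → subst (ℚ._< b) (sym (·-vertex a (vtx n v))) (proj₂ (valid (vtx n v)) v∉S)))

  abstract

    -- With an antipodal pair, S is everything or the base, cut out by the trivial inequality or by
    -- -x₀ ≤ 0. Without one, a functional with value 1 exactly on S works: the coefficient of a pair
    -- is the sign of its member in S, or 0 if there is none, and similarly for the apex.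
    closed-face : ∀ {S} → Closed S → IsFace S
    closed-face {S} closed with any? (λ c → (idx (base c false) ∈? S) ×-dec (idx (base c true) ∈? S))
    ... | yes (c , e∈S , e′∈S) with idx (apex {n}) ∈? S
    ...   | yes apex∈S = cut (λ _ → 0ℚ) 0ℚ λ
      { apex       → (λ _ → refl) , contradiction apex∈S
      ; (base i s) → (λ _ → ℚ.*-zeroˡ (sign (base i s))) , contradiction (closed c e∈S e′∈S i s) }
    ...   | no  apex∉S = cut (λ { zero → - 1ℚ ; (suc _) → 0ℚ }) 0ℚ λ
      { apex       → (λ apex∈S → contradiction apex∈S apex∉S) , (λ _ → ℚ.negative⁻¹ (- 1ℚ))
      ; (base i s) → (λ _ → ℚ.*-zeroˡ (sign (base i s))) , contradiction (closed c e∈S e′∈S i s) }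
    closed-face {S} closed | no ¬pair = cut a 1ℚ valid
      where
      0<1 : 0ℚ ℚ.< 1ℚ
      0<1 = ℚ.positive⁻¹ 1ℚ

      -1<1 : - 1ℚ ℚ.< 1ℚ
      -1<1 = ℚ.<-trans (ℚ.negative⁻¹ (- 1ℚ)) 0<1

      a : Fin (suc n) → ℚ
      a zero    = if does (idx (apex {n}) ∈? S) then 1ℚ else 0ℚ
      a (suc c) = if does (idx (base c false) ∈? S) then 1ℚ else if does (idx (base c true) ∈? S) then - 1ℚ else 0ℚ

      valid : ∀ x → (x ∈ᵛ S → a (coord x) ℚ.* sign x ≡ 1ℚ) × (x ∉ᵛ S → a (coord x) ℚ.* sign x ℚ.< 1ℚ)
      valid apex with idx (apex {n}) ∈? S
      ... | yes x∈S = (λ _ → refl) , contradiction x∈S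
      ... | no  x∉S = (λ x∈S → contradiction x∈S x∉S) , (λ _ → 0<1)
      valid (base c false) with idx (base c false) ∈? S | idx (base c true) ∈? S
      ... | yes e∈S | _       = (λ _ → refl) , contradiction e∈S
      ... | no  e∉S | yes _   = (λ e∈S → contradiction e∈S e∉S) , (λ _ → -1<1)
      ... | no  e∉S | no  _   = (λ e∈S → contradiction e∈S e∉S) , (λ _ → 0<1)
      valid (base c true) with idx (base c false) ∈? S | idx (base c true) ∈? S
      ... | yes e∈S | yes e′∈S = contradiction (c , e∈S , e′∈S) ¬pair
      ... | yes e∈S | no  e′∉S = (λ e′∈S → contradiction e′∈S e′∉S) , (λ _ → -1<1)
      ... | no  e∉S | yes e′∈S = (λ _ → refl) , contradiction e′∈S
      ... | no  e∉S | no  e′∉S = (λ e′∈S → contradiction e′∈S e′∉S) , (λ _ → 0<1)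

  -- Dimensions of faces

  sign-cancel : ∀ (x : Vtx n) {q} → q ℚ.* sign x ≡ 0ℚ → q ≡ 0ℚ
  sign-cancel apex           {q} eq = trans (sym (ℚ.*-identityʳ q)) eq
  sign-cancel (base _ false) {q} eq = trans (sym (ℚ.*-identityʳ q)) eq
  sign-cancel (base _ true)  {q} eq = begin
    q              ≡⟨ neg-involutive q ⟨
    - - q          ≡⟨ cong (λ r → - - r) (ℚ.*-identityʳ q) ⟨
    - - (q ℚ.* 1ℚ)   ≡⟨ cong -_ (ℚ.neg-distribʳ-* q 1ℚ) ⟩
    - (q ℚ.* - 1ℚ)   ≡⟨ cong -_ eq ⟩
    0ℚ             ∎
    where open ≡-Reasoning

  sum-pick : ∀ {k} (i : Fin k) (f : Fin k → ℚ) → sum (λ j → unit i j ℚ.* f j) ≡ f i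
  sum-pick i f = begin
    sum (λ j → unit i j ℚ.* f j)  ≡⟨ sum-single _ i (λ j j≢i → trans (cong (ℚ._* f j) (unit-off (j≢i ∘ sym))) (ℚ.*-zeroˡ (f j))) ⟩
    unit i i ℚ.* f i              ≡⟨ cong (ℚ._* f i) (unit-diag i) ⟩
    1ℚ ℚ.* f i                    ≡⟨ ℚ.*-identityˡ (f i) ⟩
    f i                         ∎
    where open ≡-Reasoning

  sum-unit : ∀ {k} (i : Fin k) → sum (unit i) ≡ 1ℚ
  sum-unit i = trans (sum-single (unit i) i (λ j j≢i → unit-off (j≢i ∘ sym))) (unit-diag i)

  abstract

    -- Different coordinates make the vertices nonzero multiples of different unit vectors, hence
    -- linearly independent. The hull is immediate because `p` lists all vertices of F.
    simplex-dim : ∀ {k} (F : Face) (p : Fin (suc k) → Vtx n) →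
                  (∀ {i j} → coord (p i) ≡ coord (p j) → i ≡ j) →
                  (∀ i → p i ∈ᵛ proj₁ F) → (∀ x → x ∈ᵛ proj₁ F → ∃[ i ] p i ≡ x) →
                  HasDim F k
    simplex-dim F p inj p∈F F⊆p = idx ∘ p , p∈F , independent , hull
      where
      open ≡-Reasoning

      independent : AffinelyIndependent (idx ∘ p)
      independent c _ eq i = sign-cancel (p i) (begin
        c i ℚ.* sign (p i)                            ≡⟨ cong (c i ℚ.*_) (vertex-coord (p i)) ⟨
        c i ℚ.* vertex (idx (p i)) (coord (p i))      ≡⟨ sum-single _ i (λ j j≢i → trans (cong (c j ℚ.*_) (vertex-off (p j) _ (j≢i ∘ sym ∘ inj))) (ℚ.*-zeroʳ (c j))) ⟨
        sum (λ j → c j ℚ.* vertex (idx (p j)) (coord (p i)))  ≡⟨ eq (coord (p i)) ⟩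
        0ℚ                                          ∎)

      hull : ∀ v → v ∈ proj₁ F → v InAffineHullOf (idx ∘ p)
      hull v v∈F with F⊆p (vtx n v) (∈⇒∈ᵛ v v∈F)
      ... | i , pi≡x = unit i , sum-unit i , λ y → trans (sum-pick i (λ j → vertex (idx (p j)) y))
                         (cong (λ w → vertex w y) (trans (cong idx pi≡x) (idx-vtx n v)))

  -- Coefficients of the affine combination "point i plus point j minus point l"; their total is 1.
  combination : ∀ {k} (i j l : Fin k) → Fin k → ℚ
  combination i j l t = unit i t ℚ.+ (unit j t ℚ.+ - unit l t)

  sum-combination : ∀ {k} (i j l : Fin k) f → sum (λ t → combination i j l t ℚ.* f t) ≡ f i ℚ.+ (f j ℚ.+ - f l)
  sum-combination i j l f = begin
    sum (λ t → combination i j l t ℚ.* f t)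
      ≡⟨ sum-cong-≗ (λ t → expand (unit i t) (unit j t) (unit l t) (f t)) ⟩
    sum (λ t → unit i t ℚ.* f t ℚ.+ (unit j t ℚ.* f t ℚ.+ unit l t ℚ.* - f t))
      ≡⟨ ∑-distrib-+ (λ t → unit i t ℚ.* f t) (λ t → unit j t ℚ.* f t ℚ.+ unit l t ℚ.* - f t) ⟩
    sum (λ t → unit i t ℚ.* f t) ℚ.+ sum (λ t → unit j t ℚ.* f t ℚ.+ unit l t ℚ.* - f t)
      ≡⟨ cong (sum (λ t → unit i t ℚ.* f t) ℚ.+_) (∑-distrib-+ (λ t → unit j t ℚ.* f t) (λ t → unit l t ℚ.* - f t)) ⟩
    sum (λ t → unit i t ℚ.* f t) ℚ.+ (sum (λ t → unit j t ℚ.* f t) ℚ.+ sum (λ t → unit l t ℚ.* - f t))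
      ≡⟨ cong₂ ℚ._+_ (sum-pick i f) (cong₂ ℚ._+_ (sum-pick j f) (sum-pick l (-_ ∘ f))) ⟩
    f i ℚ.+ (f j ℚ.+ - f l) ∎
    where
    open ≡-Reasoning
    expand : ∀ a b c q → (a ℚ.+ (b ℚ.+ - c)) ℚ.* q ≡ a ℚ.* q ℚ.+ (b ℚ.* q ℚ.+ c ℚ.* - q)
    expand = solve 4 (λ a b c q → (a :+ (b :+ (:- c))) :* q := a :* q :+ (b :* q :+ c :* (:- q))) refl

  abstract

    -- The affine basis consists of the negative vertex of the pair `o` and of all positive
    -- vertices. In a relation, coordinate j forces its j-th weight to be c₀ if j = o and 0
    -- otherwise; the weights then add up to 2 c₀, so that c₀ = 0.
    base-dim : Fin n → (F : Face) → (∀ c s → base c s ∈ᵛ proj₁ F) → apex ∉ᵛ proj₁ F → HasDim F n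
    base-dim o F base⊆F apex∉F = idx ∘ p , p∈F , independent , λ v v∈F →
      subst (λ w → w InAffineHullOf (idx ∘ p)) (idx-vtx n v) (hull (vtx n v) (∈⇒∈ᵛ v v∈F))
      where
      open ≡-Reasoning

      p : Fin (suc n) → Vtx n
      p zero    = base o true
      p (suc c) = base c false

      p∈F : ∀ i → p i ∈ᵛ proj₁ F
      p∈F zero    = base⊆F o true
      p∈F (suc c) = base⊆F c false

      independent : AffinelyIndependent (idx ∘ p)
      independent c ∑c≡0 eq = λ { zero → c₀≡0 ; (suc j) → trans (c-suc j) (trans (cong (unit o j ℚ.*_) c₀≡0) (ℚ.*-zeroʳ (unit o j))) }
        where
        c₀ : ℚ
        c₀ = c zero

        c-suc : ∀ j → c (suc j) ≡ unit o j ℚ.* c₀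
        c-suc j = begin
          c (suc j)                                      ≡⟨ isolate (c (suc j)) c₀ (unit o j) ⟩
          unit o j ℚ.* c₀ ℚ.+ (c₀ ℚ.* - unit o j ℚ.+ c (suc j))  ≡⟨ cong (unit o j ℚ.* c₀ ℚ.+_) balance ⟩
          unit o j ℚ.* c₀ ℚ.+ 0ℚ                             ≡⟨ ℚ.+-identityʳ _ ⟩
          unit o j ℚ.* c₀                                  ∎
          where
          isolate : ∀ a b u → a ≡ u ℚ.* b ℚ.+ (b ℚ.* - u ℚ.+ a)
          isolate = solve 3 (λ a b u → a := u :* b :+ (b :* (:- u) :+ a)) refl

          tail-sum : sum (λ i → c (suc i) ℚ.* vertex (idx (base i false)) (suc j)) ≡ c (suc j)
          tail-sum = begin
            sum (λ i → c (suc i) ℚ.* vertex (idx (base i false)) (suc j))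
              ≡⟨ sum-single _ j (λ i i≢j → trans (cong (c (suc i) ℚ.*_) (vertex-off (base i false) (suc j) (λ { refl → i≢j refl }))) (ℚ.*-zeroʳ (c (suc i)))) ⟩
            c (suc j) ℚ.* vertex (idx (base j false)) (suc j)
              ≡⟨ cong (c (suc j) ℚ.*_) (vertex-coord (base j false)) ⟩
            c (suc j) ℚ.* 1ℚ
              ≡⟨ ℚ.*-identityʳ _ ⟩
            c (suc j) ∎

          balance : c₀ ℚ.* - unit o j ℚ.+ c (suc j) ≡ 0ℚ
          balance = begin
            c₀ ℚ.* - unit o j ℚ.+ c (suc j)  ≡⟨ cong₂ ℚ._+_ (cong (c₀ ℚ.*_) (vertex-true o j)) tail-sum ⟨
            sum (λ i → c i ℚ.* vertex (idx (p i)) (suc j))  ≡⟨ eq (suc j) ⟩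
            0ℚ  ∎

        double : c₀ ℚ.+ c₀ ≡ 0ℚ
        double = begin
          c₀ ℚ.+ c₀                          ≡⟨ cong (c₀ ℚ.+_) (sum-pick o (λ _ → c₀)) ⟨
          c₀ ℚ.+ sum (λ j → unit o j ℚ.* c₀)   ≡⟨ cong (c₀ ℚ.+_) (sum-cong-≗ c-suc) ⟨
          sum c                            ≡⟨ ∑c≡0 ⟩
          0ℚ                               ∎

        c₀≡0 : c₀ ≡ 0ℚ
        c₀≡0 with ℚ.<-cmp c₀ 0ℚ
        ... | tri< c₀<0 _ _ = contradiction (ℚ.+-mono-< c₀<0 c₀<0) (ℚ.<-irrefl double)
        ... | tri≈ _ c₀≡0 _ = c₀≡0
        ... | tri> _ _ 0<c₀ = contradiction (ℚ.+-mono-< 0<c₀ 0<c₀) (ℚ.<-irrefl (sym double))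

      hull : ∀ x → x ∈ᵛ proj₁ F → idx x InAffineHullOf (idx ∘ p)
      hull apex           x∈F = contradiction x∈F apex∉F
      hull (base j false) _ = unit (suc j) , sum-unit (suc j) , λ y → sum-pick (suc j) (λ i → vertex (idx (p i)) y)
      -- The vertices of the pair `o` add up to 0, so the negative vertex of j is their sum minus
      -- the positive vertex of j.
      hull (base j true)  _ = combination zero (suc o) (suc j)
        , (begin
            sum (combination zero (suc o) (suc j))  ≡⟨ sum-cong-≗ (λ t → sym (ℚ.*-identityʳ (combination zero (suc o) (suc j) t))) ⟩
            sum (λ t → combination zero (suc o) (suc j) t ℚ.* 1ℚ)  ≡⟨ sum-combination zero (suc o) (suc j) (λ _ → 1ℚ) ⟩
            1ℚ ∎)
        , λ y → trans (sum-combination zero (suc o) (suc j) (λ i → vertex (idx (p i)) y)) (antipodal y)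
        where
        antipode : ∀ (c : Fin n) y → vertex (idx (base c true)) y ≡ - vertex (idx (base c false)) y
        antipode c zero = refl
        antipode c (suc y) rewrite splitAt-↑ˡ n c n | splitAt-↑ʳ n n c = refl

        antipodal : ∀ y → vertex (idx (base o true)) y ℚ.+ (vertex (idx (base o false)) y ℚ.+ - vertex (idx (base j false)) y)
                    ≡ vertex (idx (base j true)) y
        antipodal y rewrite antipode o y | antipode j y = cancel (vertex (idx (base o false)) y) (vertex (idx (base j false)) y)
          where
          cancel : ∀ a b → - a ℚ.+ (a ℚ.+ - b) ≡ - b
          cancel = solve 2 (λ a b → (:- a) :+ (a :+ (:- b)) := :- b) refl

-- Flags as orders of the vertices

-- punchIn for natural numbers.
pin : ℕ → ℕ → ℕ
pin zero    y       = suc y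
pin (suc k) zero    = zero
pin (suc k) (suc y) = suc (pin k y)

pin-injective : ∀ k {x y} → pin k x ≡ pin k y → x ≡ y
pin-injective zero    eq = ℕ.suc-injective eq
pin-injective (suc k) {zero}  {zero}  eq = refl
pin-injective (suc k) {suc x} {suc y} eq = cong suc (pin-injective k (ℕ.suc-injective eq))

pin-mono-< : ∀ k {x y} → x < y → pin k x < pin k y
pin-mono-< zero    x<y = s≤s x<y
pin-mono-< (suc k) {zero}  {suc y} _ = s≤s z≤n
pin-mono-< (suc k) {suc x} {suc y} (s≤s x<y) = s≤s (pin-mono-< k x<y)

pin-mono-≤ : ∀ k {x y} → x ≤ y → pin k x ≤ pin k y
pin-mono-≤ k x≤y with ℕ.m≤n⇒m<n∨m≡n x≤y
... | inj₁ x<y  = ℕ.<⇒≤ (pin-mono-< k x<y)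
... | inj₂ refl = ℕ.≤-refl

pin≢ : ∀ k y → pin k y ≢ k
pin≢ (suc k) (suc y) eq = pin≢ k y (ℕ.suc-injective eq)

pin-< : ∀ {k y} → y < k → pin k y ≡ y
pin-< {suc k} {zero}  _         = refl
pin-< {suc k} {suc y} (s≤s y<k) = cong suc (pin-< y<k)

pin-≥ : ∀ {k y} → k ≤ y → pin k y ≡ suc y
pin-≥ {zero}          _         = refl
pin-≥ {suc k} {suc y} (s≤s k≤y) = cong suc (pin-≥ k≤y)

pin-≤ : ∀ k y → pin k y ≤ suc y
pin-≤ zero    y       = ℕ.≤-refl
pin-≤ (suc k) zero    = z≤n
pin-≤ (suc k) (suc y) = s≤s (pin-≤ k y)

≤-pin : ∀ k y → y ≤ pin k y
≤-pin zero    y       = ℕ.n≤1+n y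
≤-pin (suc k) zero    = z≤n
≤-pin (suc k) (suc y) = s≤s (≤-pin k y)

pin-surjective : ∀ k j → j ≢ k → ∃[ y ] pin k y ≡ j
pin-surjective zero    zero    j≢k = contradiction refl j≢k
pin-surjective zero    (suc j) _   = j , refl
pin-surjective (suc k) zero    _   = zero , refl
pin-surjective (suc k) (suc j) j≢k with y , eq ← pin-surjective k j (j≢k ∘ cong suc) = suc y , cong suc eq

punchIn-pin : ∀ {m} (k : Fin (suc m)) (y : Fin m) → toℕ (Fin.punchIn k y) ≡ pin (toℕ k) (toℕ y)
punchIn-pin zero    y       = refl
punchIn-pin (suc k) zero    = refl
punchIn-pin (suc k) (suc y) = cong suc (punchIn-pin k y)

-- A flag is encoded by the order in which its faces pick up the vertices.  Its
-- simplices below the facet pick up one vertex of each antipodal pair {±c} and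
-- the apex.  The apex has position k among them, where k = n + 1 if it is not
-- picked up at all (so that the facet is the base); π c is the position of the
-- pair c among the pairs, and the vertex picked up from it is base c (ε c).
record Model (n : ℕ) : Set where
  constructor model
  field
    k : Fin (2 + n)
    π : Permutation′ n
    ε : Fin n → Bool

-- A position among the pairs together with the information whether the vertex
-- is opposite to the one that is picked up.
Place : ℕ → Set
Place n = Fin n × Bool

xor-cancel : ∀ a b → a xor (a xor b) ≡ b
xor-cancel false b = refl
xor-cancel true  b = Bool.not-involutive b

-- The flag does not separate the vertices opposite to the chosen ones: they all enter in a single
-- step, after the n chosen ones.
height : ∀ {n} → Place n → ℕ
height     (y , false) = toℕ y
height {n} (y , true)  = n

height≤n : ∀ {n} (p : Place n) → height p ≤ n
height≤n (y , false) = ℕ.<⇒≤ (toℕ<n y)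
height≤n (y , true)  = ℕ.≤-refl

module _ {n : ℕ} where

  open Pyramid n
  open Faces P renaming (_≤_ to _≤ᶠ_; _≈_ to _≈ᶠᶜ_)
  open Flags P

  position : Model n → Fin n → Place n
  position m c = Model.π m ⟨$⟩ʳ c , Model.ε m c

  -- `position` records the place of `base c false`; flipping it by s gives the place of `base c s`.
  flip : Bool → Place n → Place n
  flip s (y , t) = y , t xor s

  apexRank : Model n → ℕ
  apexRank m = toℕ (Model.k m)

  -- The index of the first face containing the vertex, where n + 1 stands for the whole polytope.
  -- `pin` leaves the slot k to the apex. The vertices that are not chosen have rank `pin k n`: this
  -- is n + 1 if k ≤ n, so that they lie in no proper face of the flag, and n if k = n + 1, where
  -- they complete the base.
  rank : Model n → Vtx n → ℕ
  rank m apex       = apexRank m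
  rank m (base c s) = pin (apexRank m) (height (flip s (position m c)))

  apexRank≤ : ∀ m → apexRank m ≤ suc n
  apexRank≤ m = toℕ≤pred[n] (Model.k m)

  rank≤ : ∀ m x → rank m x ≤ suc n
  rank≤ m apex       = apexRank≤ m
  rank≤ m (base c s) = ℕ.≤-trans (pin-≤ (apexRank m) _) (s≤s (height≤n (flip s (position m c))))

  level : Model n → ℕ → VSet
  level m j = subset (λ x → rank m x ℕ.<? j)

  ∈-level⁺ : ∀ {m j x} → rank m x < j → x ∈ᵛ level m j
  ∈-level⁺ {m} {j} = ∈-subset⁺ (λ x → rank m x ℕ.<? j)

  ∈-level⁻ : ∀ {m j} x → x ∈ᵛ level m j → rank m x < j
  ∈-level⁻ {m} {j} x = ∈-subset⁻ (λ x → rank m x ℕ.<? j) {x}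

  flip-absent : ∀ s (p : Place n) → flip s p ≡ (proj₁ p , true) ⊎ flip (not s) p ≡ (proj₁ p , true)
  flip-absent false (y , false) = inj₂ refl
  flip-absent false (y , true)  = inj₁ refl
  flip-absent true  (y , false) = inj₁ refl
  flip-absent true  (y , true)  = inj₂ refl

  rank-antipodal : ∀ m c s → rank m (base c s) ≡ pin (apexRank m) n ⊎ rank m (base c (not s)) ≡ pin (apexRank m) n
  rank-antipodal m c s with flip-absent s (position m c)
  ... | inj₁ eq = inj₁ (cong (pin (apexRank m) ∘ height) eq)
  ... | inj₂ eq = inj₂ (cong (pin (apexRank m) ∘ height) eq)

  rank-base≤ : ∀ m c s → rank m (base c s) ≤ pin (apexRank m) n
  rank-base≤ m c s = pin-mono-≤ (apexRank m) (height≤n (flip s (position m c)))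

  -- One of two antipodal vertices always has the largest rank occurring in the base, so a level
  -- containing both contains the base.
  level-closed : ∀ m j → Closed (level m j)
  level-closed m j c e∈ e′∈ c′ s = ∈-level⁺ (ℕ.≤-<-trans (rank-base≤ m c′ s) top<j)
    where
    top<j : pin (apexRank m) n < j
    top<j with rank-antipodal m c false
    ... | inj₁ eq = subst (_< j) eq (∈-level⁻ (base c false) e∈)
    ... | inj₂ eq = subst (_< j) eq (∈-level⁻ (base c true) e′∈)

  levelFace : Model n → ℕ → Face
  levelFace m j = level m j , closed-face (level-closed m j)

  level-mono : ∀ m {i j} → i ≤ j → level m i ⊆ level m j
  level-mono m i≤j = ⊆ᵛ⇒⊆ λ x x∈ → ∈-level⁺ (ℕ.<-≤-trans (∈-level⁻ x x∈) i≤j)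

  rank-place : ∀ m y s → ∃[ x ] ∃[ t ] rank m (base x t) ≡ pin (apexRank m) (height (y , s)) × flip t (position m x) ≡ (y , s)
  rank-place m y s = Model.π m ⟨$⟩ˡ y , Model.ε m x xor s ,
    cong (pin (apexRank m) ∘ height) eq , eq
    where
    x = Model.π m ⟨$⟩ˡ y
    eq : flip (Model.ε m x xor s) (position m x) ≡ (y , s)
    eq = cong₂ _,_ (inverseʳ (Model.π m)) (xor-cancel (Model.ε m x) s)

  -- The pair `o` provides a vertex that is not chosen, needed for the rank `pin k n`.
  rank-surjective : (o : Fin n) → ∀ m {j} → j ≤ suc n → ∃[ x ] rank m x ≡ j
  rank-surjective o m {j} j≤ with j ℕ.≟ apexRank m
  ... | yes refl = apex , refl
  ... | no  j≢k with pin-surjective (apexRank m) j j≢k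
  ...   | y , refl = go (y ℕ.<? n)
    where
    go : Dec (y < n) → ∃[ x ] rank m x ≡ pin (apexRank m) y
    go (yes y<n) with c , t , eq , _ ← rank-place m (fromℕ< y<n) false =
      base c t , trans eq (cong (pin (apexRank m)) (toℕ-fromℕ< y<n))
    go (no y≮n) with rank-place m o true
    ... | c , t , eq , _ = base c t , trans eq (cong (pin (apexRank m)) (ℕ.≤-antisym (ℕ.≮⇒≥ y≮n) (ℕ.≮⇒≥ n≮y)))
      where
      n≮y : ¬ (n < y)
      n≮y n<y = ℕ.<-irrefl refl (ℕ.≤-trans (ℕ.≤-trans (s≤s n<y)
        (ℕ.≤-reflexive (sym (pin-≥ (ℕ.≤-trans (apexRank≤ m) n<y))))) j≤)

  level-mono-< : Fin n → ∀ m {i j} → i < j → j ≤ 2 + n → level m i ⊂ level m j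
  level-mono-< o m {i} {j} i<j j≤ with rank-surjective o m (ℕ.≤-pred (ℕ.≤-trans i<j j≤))
  ... | x , refl = level-mono m (ℕ.<⇒≤ i<j) , idx x , ∈-level⁺ i<j , λ x∈ → ℕ.<-irrefl refl (∈-level⁻ x x∈)

  -- The ranks below pin k n are those of the vertices that are picked up one at
  -- a time; the remaining n vertices of the base share the rank pin k n.
  rank-injective : ∀ m {x y} → rank m x < pin (apexRank m) n → rank m x ≡ rank m y → x ≡ y
  rank-injective m {apex}     {apex}     _ _  = refl
  rank-injective m {apex}     {base c s} _ eq = contradiction (sym eq) (pin≢ (apexRank m) _)
  rank-injective m {base c s} {apex}     _ eq = contradiction eq (pin≢ (apexRank m) _)
  rank-injective m {base c s} {base c′ s′} r< eq = place-injective (below-present (flip s (position m c)) refl h<n)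
      (below-present (flip s′ (position m c′)) (sym h≡h′) h<n)
    where
    h≡h′ : height (flip s (position m c)) ≡ height (flip s′ (position m c′))
    h≡h′ = pin-injective (apexRank m) eq

    h<n : height (flip s (position m c)) < n
    h<n with ℕ.m≤n⇒m<n∨m≡n (height≤n (flip s (position m c)))
    ... | inj₁ h<n = h<n
    ... | inj₂ h≡n = contradiction (cong (pin (apexRank m)) h≡n) (ℕ.<⇒≢ r<)

    below-present : ∀ p {h} → height p ≡ h → h < n → ∃[ y ] (p ≡ (y , false)) × toℕ y ≡ h
    below-present (y , false) eq _ = y , refl , eq
    below-present (y , true)  refl n<n = contradiction n<n (ℕ.<-irrefl refl)

    xor-false : ∀ a {b c} → a xor b ≡ false → a xor c ≡ false → b ≡ c
    xor-false false refl refl = refl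
    xor-false true  {true}  {true}  _ _ = refl

    place-injective : ∃[ y ] (flip s (position m c) ≡ (y , false)) × toℕ y ≡ height (flip s (position m c)) →
                      ∃[ y ] (flip s′ (position m c′) ≡ (y , false)) × toℕ y ≡ height (flip s (position m c)) →
                      base c s ≡ base c′ s′
    place-injective (y , p , q) (y′ , p′ , q′) with refl ← toℕ-injective (trans q (sym q′))
      with refl ← trans (sym (inverseˡ (Model.π m))) (trans (cong (Model.π m ⟨$⟩ˡ_) (trans (cong proj₁ p) (sym (cong proj₁ p′)))) (inverseˡ (Model.π m)))
      = cong (base c) (xor-false (Model.ε m c) (cong proj₂ p) (cong proj₂ p′))

  coord-injective : ∀ m {x y} → rank m x < pin (apexRank m) n → rank m y < pin (apexRank m) n → coord x ≡ coord y → x ≡ y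
  coord-injective m {apex} {apex} _ _ _ = refl
  coord-injective m {base c false} {base c false} _ _ refl = refl
  coord-injective m {base c true}  {base c true}  _ _ refl = refl
  coord-injective m {base c false} {base c true}  r< r′< refl with rank-antipodal m c false
  ... | inj₁ eq = contradiction eq (ℕ.<⇒≢ r<)
  ... | inj₂ eq = contradiction eq (ℕ.<⇒≢ r′<)
  coord-injective m {base c true}  {base c false} r< r′< refl with rank-antipodal m c false
  ... | inj₁ eq = contradiction eq (ℕ.<⇒≢ r′<)
  ... | inj₂ eq = contradiction eq (ℕ.<⇒≢ r<)

  -- As long as the common rank `pin k n` is not included, the level is a simplex with one vertex of
  -- each rank. It is included only for i = n and k = n + 1, when the level is the base.
  level-dim : Fin n → ∀ m i → i ≤ n → HasDim (levelFace m (suc i)) i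
  level-dim o m i i≤n with suc i ℕ.≤? pin (apexRank m) n
  ... | yes i< = simplex-dim (levelFace m (suc i)) p p-inj
                   (λ a → ∈-level⁺ (subst (_< suc i) (sym (rank-p a)) (toℕ<n a)))
                   (λ x x∈ → fromℕ< (∈-level⁻ x x∈) ,
                     sym (rank-injective m (ℕ.<-≤-trans (∈-level⁻ x x∈) i<)
                       (sym (trans (rank-p _) (toℕ-fromℕ< (∈-level⁻ x x∈))))))
    where
    pre : (a : Fin (suc i)) → ∃[ x ] rank m x ≡ toℕ a
    pre a = rank-surjective o m (ℕ.≤-trans (toℕ≤pred[n] a) (ℕ.≤-trans i≤n (ℕ.n≤1+n n)))
    p : Fin (suc i) → Vtx n
    p = proj₁ ∘ pre
    rank-p : ∀ a → rank m (p a) ≡ toℕ a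
    rank-p = proj₂ ∘ pre
    rank-p< : ∀ a → rank m (p a) < pin (apexRank m) n
    rank-p< a = ℕ.<-≤-trans (subst (_< suc i) (sym (rank-p a)) (toℕ<n a)) i<
    p-inj : ∀ {a b} → coord (p a) ≡ coord (p b) → a ≡ b
    p-inj {a} {b} eq = toℕ-injective (trans (sym (rank-p a)) (trans (cong (rank m) (coord-injective m (rank-p< a) (rank-p< b) eq)) (rank-p b)))
  ... | no i≮ = subst (HasDim (levelFace m (suc i))) (sym i≡n)
                  (base-dim o (levelFace m (suc i))
                    (λ c s → ∈-level⁺ (ℕ.≤-<-trans (rank-base≤ m c s) top<i))
                    (λ apex∈ → contradiction (∈-level⁻ apex apex∈) (ℕ.≤⇒≯ (subst (_≤ apexRank m) (cong suc (sym i≡n)) n<k))))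
    where
    top<i : pin (apexRank m) n < suc i
    top<i = ℕ.≰⇒> i≮
    n≤i : n ≤ i
    n≤i = ℕ.≤-trans (≤-pin (apexRank m) n) (ℕ.≤-pred top<i)
    i≡n : i ≡ n
    i≡n = ℕ.≤-antisym i≤n n≤i
    n<k : n < apexRank m
    n<k with n ℕ.<? apexRank m
    ... | yes n<k = n<k
    ... | no  n≮k = contradiction (ℕ.≤-trans (subst (λ q → suc q ≤ suc i) (pin-≥ (ℕ.≮⇒≥ n≮k)) top<i) (s≤s i≤n)) (ℕ.<-irrefl refl)

  flag-of : Fin n → Model n → Flag
  flag-of o m = record
    { face     = λ i → levelFace m (suc (toℕ i))
    ; nonempty = λ i → let x , eq = rank-surjective o m z≤n in idx x , ∈-level⁺ (subst (_< suc (toℕ i)) (sym eq) (s≤s z≤n))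
    ; proper   = λ i eq → let x , rk = rank-surjective o m ℕ.≤-refl in
                   ℕ.<-irrefl refl (ℕ.≤-trans (subst (_< suc (toℕ i)) rk (∈-level⁻ x (subst (idx x ∈_) (sym eq) ∈⊤))) (toℕ<n i))
    ; chain    = λ i j i<j → level-mono-< o m (s≤s i<j) (s≤s (ℕ.<⇒≤ (toℕ<n j)))
    ; dim      = λ i → level-dim o m (toℕ i) (toℕ≤pred[n] i)
    }

  infix 4 _~_
  -- Permutations and signs are compared pointwise; without function extensionality, propositional
  -- equality of models would be too fine.
  _~_ : Model n → Model n → Set
  m ~ m′ = Model.k m ≡ Model.k m′ × (∀ c → position m c ≡ position m′ c)

  rank-cong : ∀ {m m′} → m ~ m′ → ∀ x → rank m x ≡ rank m′ x
  rank-cong (k≡ , p≡) apex       = cong toℕ k≡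
  rank-cong (k≡ , p≡) (base c s) = cong₂ (λ k p → pin (toℕ k) (height (flip s p))) k≡ (p≡ c)

  _HasModel_ : Flag → Model n → Set
  f HasModel m = ∀ i → proj₁ (face f i) ≡ level m (suc (toℕ i))

  level-cong : ∀ {m m′} → (∀ x → rank m x ≡ rank m′ x) → ∀ j → level m j ≡ level m′ j
  level-cong eq j = ⊆-antisym (⊆ᵛ⇒⊆ λ x x∈ → ∈-level⁺ (subst (_< j) (eq x) (∈-level⁻ x x∈)))
                              (⊆ᵛ⇒⊆ λ x x∈ → ∈-level⁺ (subst (_< j) (sym (eq x)) (∈-level⁻ x x∈)))

  -- If the two ranks of x differ, the smaller one is at most n, so one of the compared levels
  -- contains x for one model only.
  rank-determined : ∀ m m′ → (∀ j → j ≤ n → level m (suc j) ≡ level m′ (suc j)) → ∀ x → rank m x ≡ rank m′ x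
  rank-determined m m′ eq x with ℕ.<-cmp (rank m x) (rank m′ x)
  ... | tri≈ _ r≡r′ _ = r≡r′
  ... | tri< r<r′ _ _ = contradiction
    (∈-level⁻ x (subst (idx x ∈_) (eq (rank m x) (ℕ.≤-pred (ℕ.≤-trans r<r′ (rank≤ m′ x)))) (∈-level⁺ ℕ.≤-refl))) (ℕ.≤⇒≯ r<r′)
  ... | tri> _ _ r′<r = contradiction
    (∈-level⁻ x (subst (idx x ∈_) (sym (eq (rank m′ x) (ℕ.≤-pred (ℕ.≤-trans r′<r (rank≤ m x))))) (∈-level⁺ ℕ.≤-refl))) (ℕ.≤⇒≯ r′<r)

  -- Exactly one of two antipodal places has height n, which reveals the sign; the other height is
  -- the position.
  height-determined : ∀ (p p′ : Place n) → (∀ s → height (flip s p) ≡ height (flip s p′)) → p ≡ p′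
  height-determined (y , false) (y′ , false) eq = cong (_, false) (toℕ-injective (eq false))
  height-determined (y , true)  (y′ , true)  eq = cong (_, true) (toℕ-injective (eq true))
  height-determined (y , false) (y′ , true)  eq = contradiction (eq false) (ℕ.<⇒≢ (toℕ<n y))
  height-determined (y , true)  (y′ , false) eq = contradiction (eq true) (ℕ.<⇒≢ (toℕ<n y))

  rank-faithful : ∀ m m′ → (∀ x → rank m x ≡ rank m′ x) → m ~ m′
  rank-faithful m m′ eq = toℕ-injective (eq apex) , λ c → height-determined (position m c) (position m′ c) λ s →
    pin-injective (apexRank m) (trans (eq (base c s)) (cong (λ k → pin k (height (flip s (position m′ c)))) (sym (eq apex))))

  hasModel-unique : ∀ {f g m m′} → f ≈ᶠ g → f HasModel m → g HasModel m′ → m ~ m′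
  hasModel-unique {f} {g} {m} {m′} f≈g fm gm′ = rank-faithful m m′ (rank-determined m m′ λ j j≤n →
    subst (λ j → level m (suc j) ≡ level m′ (suc j)) (toℕ-fromℕ< (s≤s j≤n))
      (trans (sym (fm (fromℕ< (s≤s j≤n)))) (trans (f≈g (fromℕ< (s≤s j≤n))) (gm′ (fromℕ< (s≤s j≤n))))))

  hasModel-cong : ∀ {f g m m′} → m ~ m′ → f HasModel m → g HasModel m′ → f ≈ᶠ g
  hasModel-cong m~m′ fm gm′ i = trans (fm i) (trans (level-cong (rank-cong m~m′) (suc (toℕ i))) (sym (gm′ i)))

-- From chains without antipodal pairs to models

injective⇒surjective : ∀ {m} (f : Fin m → Fin m) → (∀ {i j} → f i ≡ f j → i ≡ j) → ∀ y → ∃[ x ] f x ≡ y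
injective⇒surjective {suc m} f inj y with any? (λ x → f x ≟ y)
... | yes found = found
... | no  missed = contradiction (injective⇒≤ {f = λ x → Fin.punchOut (y≢ x)} (λ eq → inj (punchOut-injective (y≢ _) (y≢ _) eq))) ℕ.1+n≰n
  where
  y≢ : ∀ x → y ≢ f x
  y≢ x eq = missed (x , sym eq)

abstract

  inverse-permutation : ∀ {m} (f : Fin m → Fin m) → (∀ {i j} → f i ≡ f j → i ≡ j) →
    Σ (Permutation′ m) λ ρ → (∀ c → f (ρ ⟨$⟩ʳ c) ≡ c) × (∀ i → ρ ⟨$⟩ʳ f i ≡ i)
  inverse-permutation {m} f inj = permutation g f gf (proj₂ ∘ surj) , proj₂ ∘ surj , gf
    where
    surj : ∀ c → ∃[ i ] f i ≡ c
    surj = injective⇒surjective f inj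
    g : Fin m → Fin m
    g = proj₁ ∘ surj
    gf : ∀ i → g (f i) ≡ i
    gf i = inj (proj₂ (surj (f i)))

module _ {n : ℕ} where

  open Pyramid n
  open Faces P renaming (_≤_ to _≤ᶠ_; _≈_ to _≈ᶠᶜ_)
  open Flags P

  module ChainModel
    (X : Fin (suc n) → VSet)
    (strict : ∀ i j → i Fin.< j → X i ⊂ X j)
    (nonempty₀ : Nonempty (X zero))
    (separated : ∀ x y → x ∈ᵛ X (fromℕ n) → y ∈ᵛ X (fromℕ n) → coord x ≡ coord y → x ≡ y)
    where

    mono : ∀ i j → i Fin.≤ j → X i ⊆ X j
    mono i j i≤j with ℕ.m≤n⇒m<n∨m≡n i≤j
    ... | inj₁ i<j = proj₁ (strict i j i<j)
    ... | inj₂ i≡j = subst (λ j → X i ⊆ X j) (toℕ-injective i≡j) (λ x∈ → x∈)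

    newcomer : ∀ i → ∃[ x ] x ∈ᵛ X i × (∀ j → j Fin.< i → x ∉ᵛ X j)
    newcomer zero = let v , v∈ = nonempty₀ in vtx n v , ∈⇒∈ᵛ v v∈ , λ _ ()
    newcomer (suc i) with strict (inject₁ i) (suc i) (ℕ.≤-reflexive (cong suc (toℕ-inject₁ i)))
    ... | _ , v , v∈ , v∉ = vtx n v , ∈⇒∈ᵛ v v∈ , λ j j<i x∈ → v∉ (mono j (inject₁ i)
            (subst (toℕ j ≤_) (sym (toℕ-inject₁ i)) (ℕ.≤-pred j<i)) (∈ᵛ⇒∈ v x∈))

    letter : Fin (suc n) → Vtx n
    letter = proj₁ ∘ newcomer

    letter∈ : ∀ i → letter i ∈ᵛ X i
    letter∈ = proj₁ ∘ proj₂ ∘ newcomer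

    letter∉ : ∀ i j → j Fin.< i → letter i ∉ᵛ X j
    letter∉ = proj₂ ∘ proj₂ ∘ newcomer

    ∈last : ∀ i x → x ∈ᵛ X i → x ∈ᵛ X (fromℕ n)
    ∈last i x = mono i (fromℕ n) (≤fromℕ i)

    same-letter : ∀ i j → coord (letter i) ≡ coord (letter j) → letter i ≡ letter j
    same-letter i j = separated (letter i) (letter j) (∈last i _ (letter∈ i)) (∈last j _ (letter∈ j))

    -- Letters with the same coordinate coincide by `separated`, but the later one is missing from
    -- the earlier set. So the n + 1 letters use up all n + 1 coordinates, which makes `ρ` a
    -- permutation and leaves room for no second newcomer at any step.
    letter-injective : ∀ {i j} → coord (letter i) ≡ coord (letter j) → i ≡ j
    letter-injective {i} {j} eq = compare (Fin.<-cmp i j)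
      where
      compare : Tri (i Fin.< j) (i ≡ j) (j Fin.< i) → i ≡ j
      compare (tri≈ _ i≡j _) = i≡j
      compare (tri< i<j _ _) = contradiction (subst (_∈ᵛ X i) (same-letter i j eq) (letter∈ i)) (letter∉ j i i<j)
      compare (tri> _ _ j<i) = contradiction (subst (_∈ᵛ X j) (sym (same-letter i j eq)) (letter∈ j)) (letter∉ i j j<i)

    ρ : Permutation′ (suc n)
    ρ = proj₁ (inverse-permutation (coord ∘ letter) letter-injective)

    coord-ρ : ∀ c → coord (letter (ρ ⟨$⟩ʳ c)) ≡ c
    coord-ρ = proj₁ (proj₂ (inverse-permutation (coord ∘ letter) letter-injective))

    ρ-coord : ∀ i → ρ ⟨$⟩ʳ coord (letter i) ≡ i
    ρ-coord = proj₂ (proj₂ (inverse-permutation (coord ∘ letter) letter-injective))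

    negative : Vtx n → Bool
    negative apex       = false
    negative (base _ s) = s

    -- `ρ` takes coordinates to positions, coordinate zero being the apex. Removing it closes the
    -- gap in the order of the pairs that `pin` opens again in `rank`.
    chainModel : Model n
    chainModel = model (inject₁ (ρ ⟨$⟩ʳ zero)) (remove zero ρ) (λ c → negative (letter (ρ ⟨$⟩ʳ suc c)))

    apexRank≤n : apexRank chainModel ≤ n
    apexRank≤n = subst (_≤ n) (sym (toℕ-inject₁ (ρ ⟨$⟩ʳ zero))) (toℕ≤pred[n] (ρ ⟨$⟩ʳ zero))

    is-letter : ∀ x → x ∈ᵛ X (fromℕ n) → letter (ρ ⟨$⟩ʳ coord x) ≡ x
    is-letter x x∈ = separated _ x (∈last (ρ ⟨$⟩ʳ coord x) _ (letter∈ (ρ ⟨$⟩ʳ coord x))) x∈ (coord-ρ (coord x))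

    rank-letter : ∀ x → x ∈ᵛ X (fromℕ n) → rank chainModel x ≡ toℕ (ρ ⟨$⟩ʳ coord x)
    rank-letter apex       x∈ = toℕ-inject₁ (ρ ⟨$⟩ʳ zero)
    rank-letter (base c s) x∈ = begin
      pin (toℕ (inject₁ (ρ ⟨$⟩ʳ zero))) (height (π c , negative (letter (ρ ⟨$⟩ʳ suc c)) xor s))
        ≡⟨ cong₂ (λ k t → pin k (height (π c , negative t xor s))) (toℕ-inject₁ (ρ ⟨$⟩ʳ zero)) (is-letter (base c s) x∈) ⟩
      pin (toℕ (ρ ⟨$⟩ʳ zero)) (height (π c , s xor s))
        ≡⟨ cong (λ t → pin (toℕ (ρ ⟨$⟩ʳ zero)) (height (π c , t))) (Bool.xor-same s) ⟩
      pin (toℕ (ρ ⟨$⟩ʳ zero)) (toℕ (π c))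
        ≡⟨ punchIn-pin (ρ ⟨$⟩ʳ zero) (π c) ⟨
      toℕ (Fin.punchIn (ρ ⟨$⟩ʳ zero) (π c))
        ≡⟨ cong toℕ (punchIn-permute ρ zero c) ⟨
      toℕ (ρ ⟨$⟩ʳ suc c) ∎
      where
      open ≡-Reasoning
      π : Fin n → Fin n
      π c = remove zero ρ ⟨$⟩ʳ c

    ∈⇒rank≤ : ∀ i x → x ∈ᵛ X i → rank chainModel x ≤ toℕ i
    ∈⇒rank≤ i x x∈ with toℕ (ρ ⟨$⟩ʳ coord x) ℕ.≤? toℕ i
    ... | yes p≤i = subst (_≤ toℕ i) (sym (rank-letter x (∈last i x x∈))) p≤i
    ... | no  p≰i = contradiction (subst (_∈ᵛ X i) (sym (is-letter x (∈last i x x∈))) x∈) (letter∉ _ i (ℕ.≰⇒> p≰i))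

    rank≤⇒∈ : ∀ i x → rank chainModel x ≤ toℕ i → x ∈ᵛ X i
    rank≤⇒∈ i x r≤i = subst (_∈ᵛ X i) (sym x≡l) (mono p i (subst (_≤ toℕ i) (sym p≡r) r≤i) (letter∈ p))
      where
      r<n+1 : rank chainModel x < suc n
      r<n+1 = ℕ.≤-<-trans r≤i (toℕ<n i)
      p : Fin (suc n)
      p = fromℕ< r<n+1
      p≡r : toℕ p ≡ rank chainModel x
      p≡r = toℕ-fromℕ< r<n+1
      x≡l : x ≡ letter p
      x≡l = rank-injective chainModel (subst (rank chainModel x <_) (sym (pin-≥ apexRank≤n)) r<n+1)
        (trans (sym p≡r) (sym (trans (rank-letter (letter p) (∈last p _ (letter∈ p))) (cong toℕ (ρ-coord p)))))

  abstract

    chain-model : (X : Fin (suc n) → VSet) → (∀ i j → i Fin.< j → X i ⊂ X j) → Nonempty (X zero) →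
      (∀ x y → x ∈ᵛ X (fromℕ n) → y ∈ᵛ X (fromℕ n) → coord x ≡ coord y → x ≡ y) →
      ∃[ m ] apexRank m ≤ n × (∀ i x → x ∈ᵛ X i → rank m x ≤ toℕ i) × (∀ i x → rank m x ≤ toℕ i → x ∈ᵛ X i)
    chain-model X strict nonempty₀ separated = chainModel , apexRank≤n , ∈⇒rank≤ , rank≤⇒∈
      where open ChainModel X strict nonempty₀ separated

-- Every flag has a model

module _ {n′ : ℕ} where

  private
    n = suc n′

  open Pyramid n
  open Faces P renaming (_≤_ to _≤ᶠ_; _≈_ to _≈ᶠᶜ_)
  open Flags P

  module _ (f : Flag) where

    private
      X : Fin (suc n) → VSet
      X i = proj₁ (face f i)

      top below : Fin (suc n)
      top   = fromℕ n
      below = inject₁ (fromℕ n′)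

      toℕ-below : toℕ below ≡ n′
      toℕ-below = trans (toℕ-inject₁ (fromℕ n′)) (toℕ-fromℕ n′)

    face-mono : ∀ i j → i Fin.≤ j → X i ⊆ X j
    face-mono i j i≤j with ℕ.m≤n⇒m<n∨m≡n i≤j
    ... | inj₁ i<j = proj₁ (chain f i j i<j)
    ... | inj₂ i≡j = subst (λ j → X i ⊆ X j) (toℕ-injective i≡j) (λ x∈ → x∈)

    simplex-model : ¬ (∃[ c ] (base c false ∈ᵛ X top) × (base c true ∈ᵛ X top)) → ∃[ m ] f HasModel m
    simplex-model ¬pair = let m , _ , ∈⇒rank≤ , rank≤⇒∈ = chain-model X (chain f) (nonempty f zero) separated in m , λ i → ⊆-antisym
      (⊆ᵛ⇒⊆ λ x x∈ → ∈-level⁺ (s≤s (∈⇒rank≤ i x x∈)))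
      (⊆ᵛ⇒⊆ λ x x∈ → rank≤⇒∈ i x (ℕ.≤-pred (∈-level⁻ x x∈)))
      where
      separated : ∀ x y → x ∈ᵛ X top → y ∈ᵛ X top → coord x ≡ coord y → x ≡ y
      separated apex apex _ _ _ = refl
      separated (base c false) (base c false) _ _ refl = refl
      separated (base c true)  (base c true)  _ _ refl = refl
      separated (base c false) (base c true)  x∈ y∈ refl = contradiction (c , x∈ , y∈) ¬pair
      separated (base c true)  (base c false) x∈ y∈ refl = contradiction (c , y∈ , x∈) ¬pair

    module _ (c : Fin n) (e∈ : base c false ∈ᵛ X top) (e′∈ : base c true ∈ᵛ X top) where

      base⊆ : ∀ c s → base c s ∈ᵛ X top
      base⊆ = face-closed (proj₂ (face f top)) c e∈ e′∈

      apex∉ : apex ∉ᵛ X top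
      apex∉ apex∈ = proper f top (⊆-antisym (λ _ → ∈⊤) (⊆ᵛ⇒⊆ λ { apex _ → apex∈ ; (base c s) _ → base⊆ c s }))

      -- Replacing the base by the pyramid over the (n - 1)-face of the flag
      -- turns the facet of the flag into a simplex.
      In : Fin (suc n) → Vtx n → Set
      In i x = ((x ∈ᵛ X i) × (x ∈ᵛ X below)) ⊎ ((x ≡ apex) × (i ≡ top))

      In? : ∀ i x → Dec (In i x)
      In? i x = ((idx x ∈? X i) ×-dec (idx x ∈? X below)) ⊎-dec ((x ≟ᵛ apex) ×-dec (i ≟ top))

      Y : Fin (suc n) → VSet
      Y i = subset (In? i)

      top≡n : toℕ top ≡ n
      top≡n = toℕ-fromℕ n

      <top⇒≤below : ∀ (i : Fin (suc n)) → toℕ i < n → i Fin.≤ below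
      <top⇒≤below i (s≤s i≤) = subst (toℕ i ≤_) (sym toℕ-below) i≤

      <top⇒≢top : ∀ (i : Fin (suc n)) → toℕ i < n → i ≢ top
      <top⇒≢top i i<n refl = ℕ.<-irrefl top≡n i<n

      ∈Y⇒∈X : ∀ i x → toℕ i < n → x ∈ᵛ Y i → x ∈ᵛ X i
      ∈Y⇒∈X i x i<n x∈ with ∈-subset⁻ (In? i) {x} x∈
      ... | inj₁ (x∈X , _)   = x∈X
      ... | inj₂ (_ , i≡top) = contradiction i≡top (<top⇒≢top i i<n)

      ∈X⇒∈Y : ∀ i x → toℕ i < n → x ∈ᵛ X i → x ∈ᵛ Y i
      ∈X⇒∈Y i x i<n x∈ = ∈-subset⁺ (In? i) (inj₁ (x∈ , face-mono i below (<top⇒≤below i i<n) x∈))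

      apex∉Y : ∀ i → toℕ i < n → apex ∉ᵛ Y i
      apex∉Y i i<n apex∈ = apex∉ (face-mono i top (≤fromℕ i) (∈Y⇒∈X i apex i<n apex∈))

      Y-strict : ∀ i j → i Fin.< j → Y i ⊂ Y j
      Y-strict i j i<j = ⊆ᵛ⇒⊆ Yi⊆Yj , missing (toℕ j ℕ.<? n)
        where
        i<n : toℕ i < n
        i<n = ℕ.<-≤-trans i<j (toℕ≤pred[n] j)
        Yi⊆Yj : ∀ x → x ∈ᵛ Y i → x ∈ᵛ Y j
        Yi⊆Yj x x∈ = ∈-subset⁺ (In? j) (inj₁ (proj₁ (chain f i j i<j) (∈Y⇒∈X i x i<n x∈) ,
          face-mono i below (<top⇒≤below i i<n) (∈Y⇒∈X i x i<n x∈)))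
        missing : Dec (toℕ j < n) → ∃[ v ] v ∈ Y j × v ∉ Y i
        missing (yes j<n) with chain f i j i<j
        ... | _ , v , v∈ , v∉ = idx (vtx n v) , ∈X⇒∈Y j (vtx n v) j<n (∈⇒∈ᵛ v v∈) ,
                λ v∈Y → v∉ (∈ᵛ⇒∈ v (∈Y⇒∈X i (vtx n v) i<n v∈Y))
        missing (no j≮n) = idx (apex {n}) , ∈-subset⁺ (In? j) (inj₂ (refl ,
          toℕ-injective (trans (ℕ.≤-antisym (toℕ≤pred[n] j) (ℕ.≮⇒≥ j≮n)) (sym top≡n)))) , apex∉Y i i<n

      -- With an antipodal pair the face below the facet would already contain the base, and the
      -- facet, which omits the apex, could not be larger.
      ¬pair-below : ∀ c → base c false ∈ᵛ X below → base c true ∈ᵛ X below → ∀ {A : Set} → A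
      ¬pair-below c a b with chain f below top (subst₂ _<_ (sym toℕ-below) (sym top≡n) ℕ.≤-refl)
      ... | _ , v , v∈ , v∉ = contradiction (∈⇒∈ᵛ v v∈) (v∉X (vtx n v) (λ x∈ → v∉ (∈ᵛ⇒∈ v x∈)))
        where
        v∉X : ∀ x → x ∉ᵛ X below → x ∉ᵛ X top
        v∉X apex       _  = apex∉
        v∉X (base c′ s) x∉ = contradiction (face-closed (proj₂ (face f below)) c a b c′ s) x∉

      Y-separated : ∀ x y → x ∈ᵛ Y top → y ∈ᵛ Y top → coord x ≡ coord y → x ≡ y
      Y-separated apex apex _ _ _ = refl
      Y-separated (base c s) (base c s′) x∈ y∈ refl with ∈-subset⁻ (In? top) {base c s} x∈ | ∈-subset⁻ (In? top) {base c s′} y∈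
      ... | inj₁ (_ , x∈′) | inj₁ (_ , y∈′) = cong (base c) (same s s′ x∈′ y∈′)
        where
        same : ∀ s s′ → base c s ∈ᵛ X below → base c s′ ∈ᵛ X below → s ≡ s′
        same false false _ _ = refl
        same true  true  _ _ = refl
        same false true  a b = ¬pair-below c a b
        same true  false a b = ¬pair-below c b a

      abstract
        chained : ∃[ m ] apexRank m ≤ n × (∀ i x → x ∈ᵛ Y i → rank m x ≤ toℕ i) × (∀ i x → rank m x ≤ toℕ i → x ∈ᵛ Y i)
        chained = chain-model Y Y-strict
          (let v , v∈ = nonempty f zero in idx (vtx n v) , ∈X⇒∈Y zero (vtx n v) (s≤s z≤n) (∈⇒∈ᵛ v v∈))
          Y-separated

      chainModel : Model n
      chainModel = proj₁ chained

      apexRank≤n : apexRank chainModel ≤ n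
      apexRank≤n = proj₁ (proj₂ chained)

      ∈⇒rank≤ : ∀ i x → x ∈ᵛ Y i → rank chainModel x ≤ toℕ i
      ∈⇒rank≤ = proj₁ (proj₂ (proj₂ chained))

      rank≤⇒∈ : ∀ i x → rank chainModel x ≤ toℕ i → x ∈ᵛ Y i
      rank≤⇒∈ = proj₂ (proj₂ (proj₂ chained))

      -- In the auxiliary chain the apex comes last, at position n. Moving it on to n + 1 keeps all
      -- ranks below n and lets the remaining vertices of the base enter the facet in its place.
      baseModel : Model n
      baseModel = model (fromℕ (suc n)) (Model.π chainModel) (Model.ε chainModel)

      apexRank-base : apexRank baseModel ≡ suc n
      apexRank-base = toℕ-fromℕ (suc n)

      apexRank-chain : apexRank chainModel ≡ n
      apexRank-chain with ℕ.m≤n⇒m<n∨m≡n apexRank≤n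
      ... | inj₂ k≡n = k≡n
      ... | inj₁ k<n = contradiction (rank≤⇒∈ i apex (ℕ.≤-reflexive (sym i≡k))) (apex∉Y i (subst (_< n) (sym i≡k) k<n))
        where
        i = fromℕ< (ℕ.<⇒≤ (s≤s k<n))
        i≡k : toℕ i ≡ apexRank chainModel
        i≡k = toℕ-fromℕ< (ℕ.<⇒≤ (s≤s k<n))

      rank-agree : ∀ x → rank baseModel x < n ⊎ rank chainModel x < n → rank baseModel x ≡ rank chainModel x
      rank-agree apex (inj₁ r<) = contradiction (subst (_< n) apexRank-base r<) (ℕ.≤⇒≯ (ℕ.n≤1+n n))
      rank-agree apex (inj₂ r<) = contradiction (subst (_< n) apexRank-chain r<) (ℕ.<-irrefl refl)
      rank-agree (base c s) r< = begin
        pin (apexRank baseModel) h   ≡⟨ cong (λ k → pin k h) apexRank-base ⟩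
        pin (suc n) h                ≡⟨ pin-< (ℕ.≤-trans (h<n r<) (ℕ.n≤1+n n)) ⟩
        h                            ≡⟨ pin-< (h<n r<) ⟨
        pin n h                      ≡⟨ cong (λ k → pin k h) apexRank-chain ⟨
        pin (apexRank chainModel) h  ∎
        where
        open ≡-Reasoning
        h : ℕ
        h = height (flip s (position chainModel c))
        h<n : rank baseModel (base c s) < n ⊎ rank chainModel (base c s) < n → h < n
        h<n (inj₁ r<) = ℕ.≤-<-trans (≤-pin (apexRank baseModel) h) r<
        h<n (inj₂ r<) = ℕ.≤-<-trans (≤-pin (apexRank chainModel) h) r<

      base-hasModel : f HasModel baseModel
      base-hasModel i with toℕ i ℕ.<? n
      ... | yes i<n = ⊆-antisym
        (⊆ᵛ⇒⊆ λ x x∈ → let r≤ = ∈⇒rank≤ i x (∈X⇒∈Y i x i<n x∈) in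
          ∈-level⁺ (s≤s (subst (_≤ toℕ i) (sym (rank-agree x (inj₂ (ℕ.≤-<-trans r≤ i<n)))) r≤)))
        (⊆ᵛ⇒⊆ λ x x∈ → let r≤ = ℕ.≤-pred (∈-level⁻ x x∈) in
          ∈Y⇒∈X i x i<n (rank≤⇒∈ i x (subst (_≤ toℕ i) (rank-agree x (inj₁ (ℕ.≤-<-trans r≤ i<n))) r≤)))
      ... | no i≮n with refl ← toℕ-injective {i = i} {top} (trans (ℕ.≤-antisym (toℕ≤pred[n] i) (ℕ.≮⇒≥ i≮n)) (sym top≡n)) = ⊆-antisym
        (⊆ᵛ⇒⊆ λ
          { apex x∈       → contradiction x∈ apex∉
          ; (base c s) x∈ → ∈-level⁺ (s≤s (subst (rank baseModel (base c s) ≤_) (sym top≡n)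
              (ℕ.≤-trans (rank-base≤ baseModel c s) (ℕ.≤-reflexive (trans (cong (λ k → pin k n) apexRank-base) (pin-< ℕ.≤-refl)))))) })
        (⊆ᵛ⇒⊆ λ
          { apex x∈       → contradiction (∈-level⁻ apex x∈) (ℕ.<-irrefl (trans apexRank-base (cong suc (sym top≡n))))
          ; (base c s) _ → base⊆ c s })

    abstract
     modelOf : ∃[ m ] f HasModel m
     modelOf with any? (λ c → (idx (base c false) ∈? X top) ×-dec (idx (base c true) ∈? X top))
     ... | yes (c , e∈ , e′∈) = baseModel c e∈ e′∈ , base-hasModel c e∈ e′∈
     ... | no  ¬pair          = simplex-model ¬pair

-- Orbits of flags

-- The Lehmer code: the image of zero, followed by the code of the permutation that remains when
-- zero and its image are deleted.
permCode : ∀ {n} → Permutation′ n → Fin (n !)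
permCode {zero}  π = zero
permCode {suc n} π = combine (π ⟨$⟩ʳ zero) (permCode (remove zero π))

permCode-cong : ∀ {n} (π ρ : Permutation′ n) → (∀ i → π ⟨$⟩ʳ i ≡ ρ ⟨$⟩ʳ i) → permCode π ≡ permCode ρ
permCode-cong {zero}  π ρ eq = refl
permCode-cong {suc n} π ρ eq = cong₂ combine (eq zero) (permCode-cong (remove zero π) (remove zero ρ) λ i →
  punchIn-injective (π ⟨$⟩ʳ zero) _ _ (begin
    Fin.punchIn (π ⟨$⟩ʳ zero) (remove zero π ⟨$⟩ʳ i)  ≡⟨ punchIn-permute π zero i ⟨
    π ⟨$⟩ʳ suc i                                      ≡⟨ eq (suc i) ⟩
    ρ ⟨$⟩ʳ suc i                                      ≡⟨ punchIn-permute ρ zero i ⟩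
    Fin.punchIn (ρ ⟨$⟩ʳ zero) (remove zero ρ ⟨$⟩ʳ i)  ≡⟨ cong (λ j → Fin.punchIn j (remove zero ρ ⟨$⟩ʳ i)) (eq zero) ⟨
    Fin.punchIn (π ⟨$⟩ʳ zero) (remove zero ρ ⟨$⟩ʳ i)  ∎))
  where open ≡-Reasoning

permCode-injective : ∀ {n} (π ρ : Permutation′ n) → permCode π ≡ permCode ρ → ∀ i → π ⟨$⟩ʳ i ≡ ρ ⟨$⟩ʳ i
permCode-injective {suc n} π ρ eq = λ
  { zero    → proj₁ split
  ; (suc i) → begin
      π ⟨$⟩ʳ suc i                                      ≡⟨ punchIn-permute π zero i ⟩
      Fin.punchIn (π ⟨$⟩ʳ zero) (remove zero π ⟨$⟩ʳ i)  ≡⟨ cong₂ Fin.punchIn (proj₁ split) (permCode-injective (remove zero π) (remove zero ρ) (proj₂ split) i) ⟩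
      Fin.punchIn (ρ ⟨$⟩ʳ zero) (remove zero ρ ⟨$⟩ʳ i)  ≡⟨ punchIn-permute ρ zero i ⟨
      ρ ⟨$⟩ʳ suc i                                      ∎ }
  where
  open ≡-Reasoning
  split = combine-injective (π ⟨$⟩ʳ zero) (permCode (remove zero π)) (ρ ⟨$⟩ʳ zero) (permCode (remove zero ρ)) eq

permCode-surjective : ∀ {n} (j : Fin (n !)) → ∃[ π ] permCode {n} π ≡ j
permCode-surjective {zero}  zero = Perm.id , refl
permCode-surjective {suc n} j =
  let a , b , ab≡j = combine-surjective {suc n} j
      π , π≡b = permCode-surjective b
  in insert zero a π , trans (cong (combine a) (trans (permCode-cong _ π (remove-insert zero a π)) π≡b)) ab≡j

funToFin-cong : ∀ {m k} (f g : Fin m → Fin k) → (∀ i → f i ≡ g i) → funToFin f ≡ funToFin g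
funToFin-cong {zero}  f g eq = refl
funToFin-cong {suc m} f g eq = cong₂ combine (eq zero) (funToFin-cong (f ∘ suc) (g ∘ suc) (eq ∘ suc))

funToFin-injective : ∀ {m k} (f g : Fin m → Fin k) → funToFin f ≡ funToFin g → ∀ i → f i ≡ g i
funToFin-injective f g eq i = begin
  f i                       ≡⟨ finToFun-funToFin f i ⟨
  finToFun (funToFin f) i   ≡⟨ cong (λ c → finToFun c i) eq ⟩
  finToFun (funToFin g) i   ≡⟨ finToFun-funToFin g i ⟩
  g i                       ∎
  where open ≡-Reasoning

bit : Bool → Fin 2
bit = Inverse.from 2↔Bool

bit⁻¹ : Fin 2 → Bool
bit⁻¹ = Inverse.to 2↔Bool

bit⁻¹-bit : ∀ b → bit⁻¹ (bit b) ≡ b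
bit⁻¹-bit b = Inverse.inverseˡ 2↔Bool refl

bit-bit⁻¹ : ∀ b → bit (bit⁻¹ b) ≡ b
bit-bit⁻¹ b = Inverse.inverseʳ 2↔Bool refl

module _ {n : ℕ} where

  -- The number of orbits is stated as d + 1 with d = n + 1, which does not reduce to the number 2 +
  -- n of positions of the apex.
  2+n≡ : 2 + n ≡ suc n + 1
  2+n≡ = ℕ.+-comm 1 (suc n)

  typeCode : Model n → Fin (suc n + 1)
  typeCode m = Fin.cast 2+n≡ (Model.k m)

  signCode : Model n → Fin (2 ^ n)
  signCode m = funToFin (bit ∘ Model.ε m)

  modelCode : Model n → Fin ((suc n + 1) * n ! * 2 ^ n)
  modelCode m = combine (combine (typeCode m) (permCode (Model.π m))) (signCode m)

  cast-injective : ∀ {a b} (eq : a ≡ b) {i j : Fin a} → Fin.cast eq i ≡ Fin.cast eq j → i ≡ j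
  cast-injective eq {i} {j} p = begin
    i                                    ≡⟨ cast-involutive (sym eq) eq i ⟨
    Fin.cast (sym eq) (Fin.cast eq i)    ≡⟨ cong (Fin.cast (sym eq)) p ⟩
    Fin.cast (sym eq) (Fin.cast eq j)    ≡⟨ cast-involutive (sym eq) eq j ⟩
    j                                    ∎
    where open ≡-Reasoning

  modelCode-cong : ∀ {m m′} → m ~ m′ → modelCode m ≡ modelCode m′
  modelCode-cong {m} {m′} (k≡ , p≡) = cong₂ combine
    (cong₂ combine (cong (Fin.cast 2+n≡) k≡) (permCode-cong (Model.π m) (Model.π m′) (cong proj₁ ∘ p≡)))
    (funToFin-cong _ _ (cong (bit ∘ proj₂) ∘ p≡))

  modelCode-injective : ∀ m m′ → modelCode m ≡ modelCode m′ → m ~ m′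
  modelCode-injective m m′ eq =
    let tp , s = combine-injective (combine (typeCode m) (permCode (Model.π m))) (signCode m)
                   (combine (typeCode m′) (permCode (Model.π m′))) (signCode m′) eq
        t , p = combine-injective (typeCode m) (permCode (Model.π m)) (typeCode m′) (permCode (Model.π m′)) tp
        bits = funToFin-injective (bit ∘ Model.ε m) (bit ∘ Model.ε m′) s
    in cast-injective 2+n≡ t , λ c → cong₂ _,_ (permCode-injective (Model.π m) (Model.π m′) p c)
         (trans (sym (bit⁻¹-bit (Model.ε m c))) (trans (cong bit⁻¹ (bits c)) (bit⁻¹-bit (Model.ε m′ c))))

  modelCode-surjective : ∀ j → ∃[ m ] modelCode m ≡ j
  modelCode-surjective j =
    let tp , s , eq = combine-surjective {(suc n + 1) * n !} j
        t , p , eq′ = combine-surjective {suc n + 1} tp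
        π , eq″ = permCode-surjective p
    in model (Fin.cast (sym 2+n≡) t) π (bit⁻¹ ∘ finToFun {2} {n} s) , trans
         (cong₂ combine
           (trans (cong₂ combine (cast-involutive 2+n≡ (sym 2+n≡) t) eq″) eq′)
           (trans (funToFin-cong _ (finToFun {2} {n} s) (λ c → bit-bit⁻¹ (finToFun {2} {n} s c))) (funToFin-finToFin {n} s)))
         eq

  open Pyramid n
  open Faces P renaming (_≤_ to _≤ᶠ_; _≈_ to _≈ᶠᶜ_)
  open Flags P

  place⁻¹ : Model n → Place n → Vtx n
  place⁻¹ m (y , s) = base (Model.π m ⟨$⟩ˡ y) (Model.ε m (Model.π m ⟨$⟩ˡ y) xor s)

  -- The symmetry of the pyramid taking the flag modelled by m′ to that
  -- modelled by m, provided that they agree in k.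
  transfer : Model n → Model n → Vtx n → Vtx n
  transfer m m′ apex       = apex
  transfer m m′ (base c s) = place⁻¹ m (flip s (position m′ c))

  -- Antipodal pairs go to antipodal pairs, possibly with the signs exchanged; this makes preimages
  -- of closed sets closed.
  transfer-antipodal : ∀ m m′ c → ∃[ c′ ]
    ( ((transfer m m′ (base c false) ≡ base c′ false) × (transfer m m′ (base c true) ≡ base c′ true))
    ⊎ ((transfer m m′ (base c false) ≡ base c′ true) × (transfer m m′ (base c true) ≡ base c′ false)))
  transfer-antipodal m m′ c with Model.ε m (Model.π m ⟨$⟩ˡ (Model.π m′ ⟨$⟩ʳ c)) | Model.ε m′ c
  ... | false | false = _ , inj₁ (refl , refl)
  ... | false | true  = _ , inj₂ (refl , refl)
  ... | true  | false = _ , inj₂ (refl , refl)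
  ... | true  | true  = _ , inj₁ (refl , refl)

  transfer-inverse : ∀ m m′ x → transfer m m′ (transfer m′ m x) ≡ x
  transfer-inverse m m′ apex = refl
  transfer-inverse m m′ (base c s) = begin
    place⁻¹ m (flip (Model.ε m′ x′ xor (Model.ε m c xor s)) (position m′ x′))
      ≡⟨ cong₂ (λ y t → place⁻¹ m (y , t)) (inverseʳ (Model.π m′)) (xor-cancel (Model.ε m′ x′) (Model.ε m c xor s)) ⟩
    place⁻¹ m (Model.π m ⟨$⟩ʳ c , Model.ε m c xor s)
      ≡⟨ cong (λ x → base x (Model.ε m x xor (Model.ε m c xor s))) (inverseˡ (Model.π m)) ⟩
    base c (Model.ε m c xor (Model.ε m c xor s))
      ≡⟨ cong (base c) (xor-cancel (Model.ε m c) s) ⟩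
    base c s ∎
    where
    open ≡-Reasoning
    x′ = Model.π m′ ⟨$⟩ˡ (Model.π m ⟨$⟩ʳ c)

  transfer-rank : ∀ m m′ → Model.k m ≡ Model.k m′ → ∀ x → rank m (transfer m m′ x) ≡ rank m′ x
  transfer-rank m m′ k≡ apex = cong toℕ k≡
  transfer-rank m m′ k≡ (base c s) = cong₂ (λ k p → pin (toℕ k) (height p)) k≡
    (cong₂ _,_ (inverseʳ (Model.π m)) (xor-cancel (Model.ε m (Model.π m ⟨$⟩ˡ (Model.π m′ ⟨$⟩ʳ c))) (Model.ε m′ c xor s)))

  module Pull (m m′ : Model n) where

    -- The action on faces is by preimages and so runs backwards: if the models agree in k, levels
    -- of m become levels of m′. Its inverse is the preimage under `transfer m′ m`.
    preimage : VSet → VSet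
    preimage S = subset (λ x → idx (transfer m m′ x) ∈? S)

    ∈⁺ : ∀ {S x} → transfer m m′ x ∈ᵛ S → x ∈ᵛ preimage S
    ∈⁺ {S} = ∈-subset⁺ (λ x → idx (transfer m m′ x) ∈? S)

    ∈⁻ : ∀ {S} x → x ∈ᵛ preimage S → transfer m m′ x ∈ᵛ S
    ∈⁻ {S} x = ∈-subset⁻ (λ x → idx (transfer m m′ x) ∈? S) {x}

    preimage-closed : ∀ {S} → Closed S → Closed (preimage S)
    preimage-closed {S} closed c e∈ e′∈ c′ s = go (transfer-antipodal m m′ c)
      where
      all : ∀ {b} → base b false ∈ᵛ S → base b true ∈ᵛ S → base c′ s ∈ᵛ preimage S
      all e∈ e′∈ = ∈⁺ (closed _ e∈ e′∈ _ _)
      go : ∃[ b ]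
             ( ((transfer m m′ (base c false) ≡ base b false) × (transfer m m′ (base c true) ≡ base b true))
             ⊎ ((transfer m m′ (base c false) ≡ base b true) × (transfer m m′ (base c true) ≡ base b false))) →
           base c′ s ∈ᵛ preimage S
      go (b , inj₁ (p , q)) = all (subst (_∈ᵛ S) p (∈⁻ (base c false) e∈)) (subst (_∈ᵛ S) q (∈⁻ (base c true) e′∈))
      go (b , inj₂ (p , q)) = all (subst (_∈ᵛ S) q (∈⁻ (base c true) e′∈)) (subst (_∈ᵛ S) p (∈⁻ (base c false) e∈))

    pull : Face → Face
    pull (S , S-face) = preimage S , closed-face (preimage-closed (face-closed S-face))

    preimage-mono : ∀ {S S′} → S ⊆ S′ → preimage S ⊆ preimage S′
    preimage-mono S⊆S′ = ⊆ᵛ⇒⊆ λ x x∈ → ∈⁺ (S⊆S′ (∈⁻ x x∈))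

  open Pull

  preimage-inverse : ∀ m m′ S → preimage m m′ (preimage m′ m S) ≡ S
  preimage-inverse m m′ S = ⊆-antisym
    (⊆ᵛ⇒⊆ λ x x∈ → subst (_∈ᵛ S) (transfer-inverse m′ m x) (∈⁻ m′ m _ (∈⁻ m m′ x x∈)))
    (⊆ᵛ⇒⊆ λ x x∈ → ∈⁺ m m′ (∈⁺ m′ m (subst (_∈ᵛ S) (sym (transfer-inverse m′ m x)) x∈)))

  preimage-cancel : ∀ m m′ {S S′} → preimage m m′ S ⊆ preimage m m′ S′ → S ⊆ S′
  preimage-cancel m m′ {S} {S′} sub = subst₂ _⊆_ (preimage-inverse m′ m S) (preimage-inverse m′ m S′) (preimage-mono m′ m sub)

  pull-isomorphism : ∀ m m′ → IsOrderIsomorphism _≈ᶠᶜ_ _≈ᶠᶜ_ _≤ᶠ_ _≤ᶠ_ (pull m m′)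
  pull-isomorphism m m′ = record
    { isOrderMonomorphism = record
      { isOrderHomomorphism = record { cong = cong (preimage m m′) ; mono = preimage-mono m m′ }
      ; injective = λ {F} {G} eq → trans (sym (preimage-inverse m′ m (proj₁ F)))
                      (trans (cong (preimage m′ m) eq) (preimage-inverse m′ m (proj₁ G)))
      ; cancel = preimage-cancel m m′
      }
    ; surjective = λ F → pull m′ m F , λ { {G} eq → trans (cong (preimage m m′) eq) (preimage-inverse m m′ (proj₁ F)) }
    }

  same-type⇒same-orbit : ∀ {f g m m′} → f HasModel m → g HasModel m′ → Model.k m ≡ Model.k m′ → SameOrbit f g
  same-type⇒same-orbit {f} {g} {m} {m′} fm gm′ k≡ =
    record { ⟦_⟧ = pull m m′ ; isOrderIsomorphism = pull-isomorphism m m′ } , λ i → begin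
      preimage m m′ (proj₁ (face f i))        ≡⟨ cong (preimage m m′) (fm i) ⟩
      preimage m m′ (level m (suc (toℕ i)))   ≡⟨ preimage-level (suc (toℕ i)) ⟩
      level m′ (suc (toℕ i))                  ≡⟨ gm′ i ⟨
      proj₁ (face g i)                        ∎
    where
    open ≡-Reasoning
    preimage-level : ∀ j → preimage m m′ (level m j) ≡ level m′ j
    preimage-level j = ⊆-antisym
      (⊆ᵛ⇒⊆ λ x x∈ → ∈-level⁺ (subst (_< j) (transfer-rank m m′ k≡ x) (∈-level⁻ _ (∈⁻ m m′ x x∈))))
      (⊆ᵛ⇒⊆ λ x x∈ → ∈⁺ m m′ (∈-level⁺ (subst (_< j) (sym (transfer-rank m m′ k≡ x)) (∈-level⁻ x x∈))))

  module Classes (o : Fin n) (modelOf : (f : Flag) → Σ (Model n) λ m → f HasModel m) where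

    fits : ∀ m → flag-of o m HasModel m
    fits m i = refl

    flag-classes : HasClasses _≈ᶠ_ ((suc n + 1) * n ! * 2 ^ n)
    flag-classes = class , surjective , λ f g → mk⇔
        (λ eq → hasModel-cong {f = f} {g} (modelCode-injective _ _ eq) (proj₂ (modelOf f)) (proj₂ (modelOf g)))
        (λ f≈g → modelCode-cong (hasModel-unique {f = f} {g} f≈g (proj₂ (modelOf f)) (proj₂ (modelOf g))))
      where
      class : Flag → Fin ((suc n + 1) * n ! * 2 ^ n)
      class f = modelCode (proj₁ (modelOf f))
      surjective : Surjective _≡_ _≡_ class
      surjective j with modelCode-surjective j
      ... | m , eq = flag-of o m , λ { {f} refl → trans
              (modelCode-cong (hasModel-unique {f = f} {f} (λ _ → refl) (proj₂ (modelOf f)) (fits m))) eq }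

    type-classes : (∀ {f g m m′} → f HasModel m → g HasModel m′ → SameOrbit f g → Model.k m ≡ Model.k m′) →
                   HasClasses SameOrbit (suc n + 1)
    type-classes same-orbit⇒same-type = class , surjective , λ f g → mk⇔
        (λ eq → same-type⇒same-orbit {f = f} {g} (proj₂ (modelOf f)) (proj₂ (modelOf g)) (cast-injective 2+n≡ eq))
        (λ orb → cong (Fin.cast 2+n≡) (same-orbit⇒same-type {f} {g} (proj₂ (modelOf f)) (proj₂ (modelOf g)) orb))
      where
      class : Flag → Fin (suc n + 1)
      class f = typeCode (proj₁ (modelOf f))
      surjective : Surjective _≡_ _≡_ class
      surjective j = flag-of o m , λ { {f} refl → trans
          (cong (Fin.cast 2+n≡) (proj₁ (hasModel-unique {f = f} {f} (λ _ → refl) (proj₂ (modelOf f)) (fits m))))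
          (cast-involutive 2+n≡ (sym 2+n≡) j) }
        where
        m : Model n
        m = model (Fin.cast (sym 2+n≡) j) Perm.id (λ _ → false)

-- Automorphisms of the face lattice fix the apex

module _ {n″ : ℕ} where

  private
    n : ℕ
    n = suc (suc n″)

  open Pyramid n
  open Faces P renaming (_≤_ to _≤ᶠ_; _≈_ to _≈ᶠᶜ_)
  open Flags P

  another : (c : Fin n) → ∃[ c′ ] c′ ≢ c
  another zero    = suc zero , λ ()
  another (suc c) = zero , λ ()

  OneOf : Vtx n → Vtx n → Vtx n → Set
  OneOf x y z = (z ≡ x) ⊎ (z ≡ y)

  OneOf? : ∀ x y z → Dec (OneOf x y z)
  OneOf? x y z = (z ≟ᵛ x) ⊎-dec (z ≟ᵛ y)

  -- Two vertices that are not antipodal span an edge; the case x = y gives the vertices themselves,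
  -- so that one construction serves both.
  pairFace : ∀ x y → (∀ c s → x ≡ base c s → y ≢ base c (not s)) → Face
  pairFace x y ok = subset (OneOf? x y) , closed-face λ c e∈ e′∈ → ⊥-elim
    (antipodal c (∈-subset⁻ (OneOf? x y) {base c false} e∈) (∈-subset⁻ (OneOf? x y) {base c true} e′∈))
    where
    antipodal : ∀ c → OneOf x y (base c false) → OneOf x y (base c true) → ⊥
    antipodal c (inj₁ refl) (inj₁ ())
    antipodal c (inj₁ p) (inj₂ q) = ok c false (sym p) (sym q)
    antipodal c (inj₂ p) (inj₁ q) = ok c true (sym q) (sym p)
    antipodal c (inj₂ refl) (inj₂ ())

  singleton : Vtx n → Face
  singleton x = pairFace x x λ { c false refl () ; c true refl () }

  ∈-singleton : ∀ x → x ∈ᵛ proj₁ (singleton x)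
  ∈-singleton x = ∈-subset⁺ (OneOf? x x) (inj₁ refl)

  ∈-singleton⁻ : ∀ x y → y ∈ᵛ proj₁ (singleton x) → y ≡ x
  ∈-singleton⁻ x y y∈ = [ id , id ]′ (∈-subset⁻ (OneOf? x x) {y} y∈)

  singleton-≤ : ∀ x F → x ∈ᵛ proj₁ F → singleton x ≤ᶠ F
  singleton-≤ x F x∈ = ⊆ᵛ⇒⊆ λ y y∈ → subst (_∈ᵛ proj₁ F) (sym (∈-singleton⁻ x y y∈)) x∈

  apexEdge : Vtx n → Face
  apexEdge x = pairFace apex x λ _ _ ()

  emptyFace : Face
  emptyFace = subset {P = λ _ → ⊥} (λ _ → no id) , closed-face λ c e∈ → contradiction (∈-subset⁻ {P = λ _ → ⊥} (λ _ → no id) {base c false} e∈) id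

  module Invariance (φ : Automorphism) where

    open Automorphism φ
    open IsOrderIsomorphism isOrderIsomorphism using (mono; cancel; surjective)

    other : (y : Vtx n) → ∃[ y′ ] y ≢ y′
    other apex       = base zero false , λ ()
    other (base c s) = apex , λ ()

    abstract

      nonempty-image : ∀ F x → x ∈ᵛ proj₁ F → ∃[ y ] y ∈ᵛ proj₁ ⟦ F ⟧
      nonempty-image F x x∈ = go (nonempty? (proj₁ ⟦ F ⟧))
        where
        go : Dec (Nonempty (proj₁ ⟦ F ⟧)) → ∃[ y ] y ∈ᵛ proj₁ ⟦ F ⟧
        go (yes (v , v∈)) = vtx n v , ∈⇒∈ᵛ v v∈
        go (no  ¬∈) = contradiction (cancel {F} {emptyFace} (λ v∈ → contradiction (_ , v∈) ¬∈) x∈) (∈-subset⁻ {P = λ _ → ⊥} (λ _ → no id) {x})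

      atom-over : ∀ y → ∃[ F ] (proj₁ ⟦ F ⟧ ≡ proj₁ (singleton y))
      atom-over y = proj₁ (surjective (singleton y)) , proj₂ (surjective (singleton y)) refl

      -- An empty F would lie below a face sent to another vertex y′, and monotonicity would put y
      -- into the singleton of y′.
      preimage-nonempty : ∀ y F → proj₁ ⟦ F ⟧ ≡ proj₁ (singleton y) → Nonempty (proj₁ F)
      preimage-nonempty y F ⟦F⟧≡ = go (nonempty? (proj₁ F))
        where
        go : Dec (Nonempty (proj₁ F)) → Nonempty (proj₁ F)
        go (yes ne) = ne
        go (no ¬∈)  = contradiction
          (∈-singleton⁻ y′ y (subst (idx y ∈_) (proj₂ (atom-over y′)) (mono {F} {proj₁ (atom-over y′)}
            (λ v∈ → contradiction (_ , v∈) ¬∈) (subst (idx y ∈_) (sym ⟦F⟧≡) (∈-singleton y)))))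
          (proj₂ (other y))
          where
          y′ : Vtx n
          y′ = proj₁ (other y)

      -- Atoms come from atoms: take any vertex x of a face sent to y. The image of x is nonempty
      -- and contained in the singleton of y.
      preimage-atom : ∀ y → ∃[ x ] (∀ z → z ∈ᵛ proj₁ ⟦ singleton x ⟧ → z ≡ y) × y ∈ᵛ proj₁ ⟦ singleton x ⟧
      preimage-atom y = x , only , present
        where
        F : Face
        F = proj₁ (atom-over y)
        ⟦F⟧≡ : proj₁ ⟦ F ⟧ ≡ proj₁ (singleton y)
        ⟦F⟧≡ = proj₂ (atom-over y)
        ne : Nonempty (proj₁ F)
        ne = preimage-nonempty y F ⟦F⟧≡
        x : Vtx n
        x = vtx n (proj₁ ne)
        only : ∀ z → z ∈ᵛ proj₁ ⟦ singleton x ⟧ → z ≡ y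
        only z z∈ = ∈-singleton⁻ y z (subst (idx z ∈_) ⟦F⟧≡ (mono {singleton x} {F} (singleton-≤ x F (∈⇒∈ᵛ (proj₁ ne) (proj₂ ne))) z∈))
        some : ∃[ z ] z ∈ᵛ proj₁ ⟦ singleton x ⟧
        some = nonempty-image (singleton x) x (∈-singleton x)
        present : y ∈ᵛ proj₁ ⟦ singleton x ⟧
        present = subst (_∈ᵛ proj₁ ⟦ singleton x ⟧) (only (proj₁ some) (proj₂ some)) (proj₂ some)

    image-monotone : ∀ x F y → x ∈ᵛ proj₁ F → y ∈ᵛ proj₁ ⟦ singleton x ⟧ → y ∈ᵛ proj₁ ⟦ F ⟧
    image-monotone x F y x∈ = mono {singleton x} {F} (singleton-≤ x F x∈)

    image-reflects : ∀ x F → (∀ y → y ∈ᵛ proj₁ ⟦ singleton x ⟧ → y ∈ᵛ proj₁ ⟦ F ⟧) → x ∈ᵛ proj₁ F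
    image-reflects x F sub = cancel {singleton x} {F} (⊆ᵛ⇒⊆ sub) (∈-singleton x)

    -- The apex lies on a common edge with every other vertex, whereas a face
    -- containing two antipodal vertices of the base has at least four vertices.
    image-apex : ∀ z → z ∈ᵛ proj₁ ⟦ singleton apex ⟧ → z ≡ apex
    image-apex apex       _  = refl
    image-apex (base c s) z∈ = ⊥-elim ([ apex-case , opposite-case ]′ x″-in-edge)
      where
      d : Fin n
      d = proj₁ (another c)

      x x′ x″ : Vtx n
      x  = proj₁ (preimage-atom (base c s))
      x′ = proj₁ (preimage-atom (base c (not s)))
      x″ = proj₁ (preimage-atom (base d false))

      only : ∀ z → z ∈ᵛ proj₁ ⟦ singleton x ⟧ → z ≡ base c s
      only = proj₁ (proj₂ (preimage-atom (base c s)))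

      only′ : ∀ z → z ∈ᵛ proj₁ ⟦ singleton x′ ⟧ → z ≡ base c (not s)
      only′ = proj₁ (proj₂ (preimage-atom (base c (not s))))

      only″ : ∀ z → z ∈ᵛ proj₁ ⟦ singleton x″ ⟧ → z ≡ base d false
      only″ = proj₁ (proj₂ (preimage-atom (base d false)))

      present′ : base c (not s) ∈ᵛ proj₁ ⟦ singleton x′ ⟧
      present′ = proj₂ (proj₂ (preimage-atom (base c (not s))))

      present″ : base d false ∈ᵛ proj₁ ⟦ singleton x″ ⟧
      present″ = proj₂ (proj₂ (preimage-atom (base d false)))

      E : Face
      E = apexEdge x′

      x≡apex : x ≡ apex
      x≡apex = ∈-singleton⁻ apex x (image-reflects x (singleton apex) λ y y∈ → subst (_∈ᵛ proj₁ ⟦ singleton apex ⟧) (sym (only y y∈)) z∈)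

      apex↦ : ∀ y → y ∈ᵛ proj₁ ⟦ singleton apex ⟧ → y ≡ base c s
      apex↦ y y∈ = only y (subst (λ x → y ∈ᵛ proj₁ ⟦ singleton x ⟧) (sym x≡apex) y∈)

      e∈ : base c s ∈ᵛ proj₁ ⟦ E ⟧
      e∈ = image-monotone apex E (base c s) (∈-subset⁺ (OneOf? apex x′) (inj₁ refl)) z∈

      e′∈ : base c (not s) ∈ᵛ proj₁ ⟦ E ⟧
      e′∈ = image-monotone x′ E (base c (not s)) (∈-subset⁺ (OneOf? apex x′) (inj₂ refl)) present′

      spread : ∀ s → base c s ∈ᵛ proj₁ ⟦ E ⟧ → base c (not s) ∈ᵛ proj₁ ⟦ E ⟧ → base d false ∈ᵛ proj₁ ⟦ E ⟧
      spread false a b = face-closed (proj₂ ⟦ E ⟧) c a b d false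
      spread true  a b = face-closed (proj₂ ⟦ E ⟧) c b a d false

      -- The image of the edge between the apex and x′ contains the whole pair c, hence also
      -- `base d false`. So x″, which is sent there, would be an end of the edge, although both ends
      -- are sent elsewhere.
      x″-in-edge : OneOf apex x′ x″
      x″-in-edge = ∈-subset⁻ (OneOf? apex x′) {x″} (image-reflects x″ E λ y y∈ →
        subst (_∈ᵛ proj₁ ⟦ E ⟧) (sym (only″ y y∈)) (spread s e∈ e′∈))

      d≢c : ∀ {t} → base d false ≢ base c t
      d≢c {t} eq = proj₂ (another c) (proj₁ (base-injective {c = d} {c} {false} {t} eq))

      apex-case : x″ ≢ apex
      apex-case x″≡apex = d≢c (apex↦ (base d false) (subst (λ x → base d false ∈ᵛ proj₁ ⟦ singleton x ⟧) x″≡apex present″))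

      opposite-case : x″ ≢ x′
      opposite-case x″≡x′ = d≢c (only′ (base d false) (subst (λ x → base d false ∈ᵛ proj₁ ⟦ singleton x ⟧) x″≡x′ present″))

    apex∈⇒ : ∀ F → apex ∈ᵛ proj₁ F → apex ∈ᵛ proj₁ ⟦ F ⟧
    apex∈⇒ F apex∈ = image-monotone apex F apex apex∈
      (subst (_∈ᵛ proj₁ ⟦ singleton apex ⟧) (image-apex (proj₁ some) (proj₂ some)) (proj₂ some))
      where
      some : ∃[ z ] z ∈ᵛ proj₁ ⟦ singleton apex ⟧
      some = nonempty-image (singleton apex) apex (∈-singleton apex)

    apex∈⇐ : ∀ F → apex ∈ᵛ proj₁ ⟦ F ⟧ → apex ∈ᵛ proj₁ F
    apex∈⇐ F apex∈ = image-reflects apex F λ y y∈ → subst (_∈ᵛ proj₁ ⟦ F ⟧) (sym (image-apex y y∈)) apex∈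

  -- An automorphism preserves and reflects membership of the apex, so the apex enters both flags at
  -- the same index.
  same-orbit⇒same-type : ∀ {f g m m′} → f HasModel m → g HasModel m′ → SameOrbit f g → Model.k m ≡ Model.k m′
  same-orbit⇒same-type {f} {g} {m} {m′} fm gm′ (φ , φf≈g) = toℕ-injective (ℕ.≤-antisym (compare m′ m ⇐) (compare m m′ ⇒))
    where
    open Invariance φ
    ⇒ : ∀ i → apex ∈ᵛ level m (suc (toℕ i)) → apex ∈ᵛ level m′ (suc (toℕ i))
    ⇒ i apex∈ = subst (apex ∈ᵛ_) (trans (φf≈g i) (gm′ i)) (apex∈⇒ (face f i) (subst (apex ∈ᵛ_) (sym (fm i)) apex∈))
    ⇐ : ∀ i → apex ∈ᵛ level m′ (suc (toℕ i)) → apex ∈ᵛ level m (suc (toℕ i))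
    ⇐ i apex∈ = subst (apex ∈ᵛ_) (fm i) (apex∈⇐ (face f i) (subst (apex ∈ᵛ_) (sym (trans (φf≈g i) (gm′ i))) apex∈))
    compare : ∀ m m′ → (∀ (i : Fin (suc n)) → apex ∈ᵛ level m (suc (toℕ i)) → apex ∈ᵛ level m′ (suc (toℕ i))) →
              apexRank m′ ≤ apexRank m
    compare m m′ sub with apexRank m ℕ.<? suc n
    ... | no  k≮ = ℕ.≤-trans (apexRank≤ m′) (ℕ.≮⇒≥ k≮)
    ... | yes k< = subst (apexRank m′ ≤_) (toℕ-fromℕ< k<) (ℕ.≤-pred (∈-level⁻ apex
            (sub (fromℕ< k<) (∈-level⁺ (ℕ.≤-reflexive (cong suc (sym (toℕ-fromℕ< k<))))))))

  abstract

    flag-classes : HasClasses _≈ᶠ_ ((suc n + 1) * n ! * 2 ^ n)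
    flag-classes = Classes.flag-classes zero modelOf

    flag-orbits : HasClasses SameOrbit (suc n + 1)
    flag-orbits = Classes.type-classes zero modelOf (λ {f} {g} → same-orbit⇒same-type {f} {g})

-- Signed permutations acting on places and models

record Shuffle (n : ℕ) : Set where
  constructor shuffle
  field
    move     : Permutation′ n
    reversed : Fin n → Bool

apply : ∀ {n} → Shuffle n → Place n → Place n
apply (shuffle move reversed) (y , t) = move ⟨$⟩ʳ y , reversed y xor t

act : ∀ {n} → Shuffle n → Fin (2 + n) → Model n → Model n
act (shuffle move reversed) k m = model k (Model.π m ∘ₚ move) (λ c → reversed (Model.π m ⟨$⟩ʳ c) xor Model.ε m c)

-- Signed permutations commute with the antipodal map. Hence their effect on `position`, given for
-- positive vertices only, holds for all vertices.
flip-apply : ∀ {n} (τ : Shuffle n) s p → flip s (apply τ p) ≡ apply τ (flip s p)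
flip-apply (shuffle move reversed) s (y , t) = cong (move ⟨$⟩ʳ y ,_) (Bool.xor-assoc (reversed y) t s)

-- The operator T

pred′ : ∀ {n} → Fin n → Fin n
pred′ {suc n} zero    = fromℕ n
pred′ {suc n} (suc y) = inject₁ y

pred′-injective : ∀ {n} {x y : Fin n} → pred′ x ≡ pred′ y → x ≡ y
pred′-injective {suc n} {zero}  {zero}  eq = refl
pred′-injective {suc n} {zero}  {suc y} eq = contradiction eq Fin.fromℕ≢inject₁
pred′-injective {suc n} {suc x} {zero}  eq = contradiction (sym eq) Fin.fromℕ≢inject₁
pred′-injective {suc n} {suc x} {suc y} eq = cong suc (Fin.inject₁-injective eq)

first : ∀ {n} → Fin n → Bool
first zero    = true
first (suc _) = false

-- The place that is first in the order becomes the last one, with the antipodal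
-- vertex: a rotation of the 2n places (y , s) arranged in a circle.
rotate : ∀ {n} → Shuffle n
rotate = shuffle (permutation pred′ (proj₁ ∘ surj) (proj₂ ∘ surj) (λ y → pred′-injective (proj₂ (surj (pred′ y))))) first
  where
  surj : ∀ {n} (y : Fin n) → ∃[ x ] pred′ x ≡ y
  surj = injective⇒surjective pred′ pred′-injective

module _ {n : ℕ} where

  open Pyramid n
  open Faces P renaming (_≤_ to _≤ᶠ_; _≈_ to _≈ᶠᶜ_)
  open Flags P

  next : Model n → Model n
  next m@(model zero    π ε) = model (fromℕ (suc n)) π ε
  next m@(model (suc k) π ε) = act rotate (inject₁ k) m

  next-cong : ∀ {m m′} → m ~ m′ → next m ~ next m′
  next-cong {model zero    _ _} {model zero    _ _} (refl , p≡) = refl , p≡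
  next-cong {model (suc _) _ _} {model (suc _) _ _} (refl , p≡) = refl , cong (apply rotate) ∘ p≡

  -- Either x is the only vertex of rank j, or x has the common rank of the vertices that are not
  -- chosen. In the latter case its antipode is already in the level below, and closedness adds the
  -- whole base.
  fill : ∀ m {X j} → Closed X → level m j ⊆ X → ∀ x → x ∈ᵛ X → rank m x ≡ j → level m (suc j) ⊆ X
  fill m {X} {j} closed sub x x∈ x≡j = ⊆ᵛ⇒⊆ λ y y∈ → member y (ℕ.m≤n⇒m<n∨m≡n (ℕ.≤-pred (∈-level⁻ y y∈)))
    where
    whole : ∀ c s → base c s ∈ᵛ X → base c (not s) ∈ᵛ X → ∀ c′ s′ → base c′ s′ ∈ᵛ X
    whole c false e∈ e′∈ = closed c e∈ e′∈
    whole c true  e∈ e′∈ = closed c e′∈ e∈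

    base-case : ∀ x c s → x ∈ᵛ X → rank m x ≡ j → rank m (base c s) ≡ j → base c s ∈ᵛ X
    base-case apex c s x∈ x≡j y≡j = contradiction (trans y≡j (sym x≡j)) (pin≢ (apexRank m) _)
    base-case (base c₀ s₀) c s x∈ x≡j y≡j with ℕ.m≤n⇒m<n∨m≡n (rank-base≤ m c₀ s₀)
    ... | inj₁ below = subst (_∈ᵛ X) (rank-injective m below (trans x≡j (sym y≡j))) x∈
    ... | inj₂ top with ℕ.m≤n⇒m<n∨m≡n (rank-base≤ m c₀ (not s₀))
    ...   | inj₁ below = whole c₀ s₀ x∈ (sub (∈-level⁺ (subst (rank m (base c₀ (not s₀)) <_) (trans (sym top) x≡j) below))) c s
    ...   | inj₂ top′  = contradiction (trans top (sym top′)) (antipodal-ranks c₀ s₀)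
      where
      heights≢ : ∀ (p : Place n) s → height (flip s p) ≢ height (flip (not s) p)
      heights≢ (y , false) false = ℕ.<⇒≢ (toℕ<n y)
      heights≢ (y , false) true  = ℕ.<⇒≢ (toℕ<n y) ∘ sym
      heights≢ (y , true)  false = ℕ.<⇒≢ (toℕ<n y) ∘ sym
      heights≢ (y , true)  true  = ℕ.<⇒≢ (toℕ<n y)
      antipodal-ranks : ∀ c s → rank m (base c s) ≢ rank m (base c (not s))
      antipodal-ranks c s eq = heights≢ (position m c) s (pin-injective (apexRank m) eq)

    member : ∀ y → rank m y < j ⊎ rank m y ≡ j → y ∈ᵛ X
    member y (inj₁ y<j) = sub (∈-level⁺ y<j)
    member apex (inj₂ y≡j) = apex-case x x∈ x≡j
      where
      apex-case : ∀ x → x ∈ᵛ X → rank m x ≡ j → apex ∈ᵛ X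
      apex-case apex       x∈ _   = x∈
      apex-case (base c s) x∈ x≡j = contradiction (trans x≡j (sym y≡j)) (pin≢ (apexRank m) _)
    member (base c s) (inj₂ y≡j) = base-case x c s x∈ x≡j y≡j

module _ {n₁ : ℕ} where

  private
    n : ℕ
    n = suc n₁

  open Pyramid n
  open Faces P renaming (_≤_ to _≤ᶠ_; _≈_ to _≈ᶠᶜ_)
  open Flags P

  -- Passing to the next flag lowers the rank of all vertices by one, except for
  -- the vertex of rank 0 and for the vertices of the base that remain absent.
  data RankStep (m : Model n) : Vtx n → Set where
    first-place : ∀ {x} → rank m x ≡ 0 → n ≤ rank (next m) x → RankStep m x
    lowered     : ∀ {x} → rank m x ≡ suc (rank (next m) x) → RankStep m x
    opposite-lowered : ∀ {c s} c₀ s₀ → suc (suc (rank (next m) (base c (not s)))) ≤ rank m (base c s) →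
      rank m (base c₀ s₀) ≡ 0 → suc (rank (next m) (base c₀ (not s₀))) ≤ rank m (base c s) →
      rank m (base c s) ≢ 0 → rank m (base c s) ≤ suc (rank (next m) (base c s)) → RankStep m (base c s)

  rank-step : ∀ m x → RankStep m x
  rank-step (model zero π ε) apex = first-place refl (ℕ.≤-trans (ℕ.n≤1+n n) (ℕ.≤-reflexive (sym (toℕ-fromℕ (suc n)))))
  rank-step (model zero π ε) (base c s) = lowered (cong suc (sym (trans (cong (λ k → pin k h) (toℕ-fromℕ (suc n))) (pin-< (s≤s (height≤n p))))))
    where
    p : Place n
    p = flip s (position (model zero π ε) c)
    h : ℕ
    h = height p
  rank-step (model (suc k) π ε) apex = lowered (cong suc (sym (toℕ-inject₁ k)))
  rank-step m@(model (suc k) π ε) (base c s) = by-place (flip s (position m c)) refl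
    where
    r : Place n → ℕ
    r p = pin (suc (toℕ k)) (height p)
    r′ : Place n → ℕ
    r′ p = pin (toℕ (inject₁ k)) (height (apply rotate p))
    next-rank : ∀ c s {p} → flip s (position m c) ≡ p → rank (next m) (base c s) ≡ r′ p
    next-rank c s eq = cong (pin (toℕ (inject₁ k)) ∘ height) (trans (flip-apply rotate s (position m c)) (cong (apply rotate) eq))
    flip-not : ∀ s (p : Place n) {y t} → flip s p ≡ (y , t) → flip (not s) p ≡ (y , not t)
    flip-not false (y , false) refl = refl
    flip-not false (y , true)  refl = refl
    flip-not true  (y , false) refl = refl
    flip-not true  (y , true)  refl = refl
    by-place : ∀ p → flip s (position m c) ≡ p → RankStep m (base c s)
    by-place (zero , false) eq = first-place (cong r eq) (ℕ.≤-trans (≤-pin (toℕ (inject₁ k)) n) (ℕ.≤-reflexive (sym (next-rank c s eq))))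
    by-place (zero , true)  eq = lowered (begin
      rank m (base c s)                             ≡⟨ cong r eq ⟩
      suc (pin (toℕ k) n₁)                          ≡⟨ cong₂ (λ k h → suc (pin k h)) (toℕ-inject₁ k) (toℕ-fromℕ n₁) ⟨
      suc (r′ (zero , true))                        ≡⟨ cong suc (next-rank c s eq) ⟨
      suc (rank (next m) (base c s))                ∎)
      where open ≡-Reasoning
    by-place (suc y , false) eq = lowered (begin
      rank m (base c s)                             ≡⟨ cong r eq ⟩
      suc (pin (toℕ k) (toℕ y))                     ≡⟨ cong₂ (λ k h → suc (pin k h)) (toℕ-inject₁ k) (toℕ-inject₁ y) ⟨
      suc (r′ (suc y , false))                      ≡⟨ cong suc (next-rank c s eq) ⟨
      suc (rank (next m) (base c s))                ∎)
      where open ≡-Reasoning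
    -- The vertex opposite to a chosen one remains so unless its pair is in front. The pair in front
    -- supplies c₀ and s₀: its chosen vertex leaves, and the antipode is chosen instead, in the last
    -- place.
    by-place (suc y , true) eq = opposite-lowered c₀ s₀
      (ℕ.≤-trans (s≤s (s≤s (ℕ.≤-reflexive (trans (next-rank c (not s) (flip-not s (position m c) eq))
          (cong₂ pin (toℕ-inject₁ k) (toℕ-inject₁ y))))))
        (ℕ.≤-trans (s≤s (pin-mono-< (toℕ k) (toℕ<n y))) (ℕ.≤-reflexive (sym (cong r eq)))))
      (cong r at-first)
      (ℕ.≤-reflexive (trans (cong suc (trans (next-rank c₀ (not s₀) (flip-not s₀ (position m c₀) at-first))
          (cong₂ pin (toℕ-inject₁ k) (toℕ-fromℕ n₁)))) (sym (cong r eq))))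
      (λ r≡0 → ℕ.1+n≢0 (trans (sym top) r≡0))
      (ℕ.≤-trans (ℕ.≤-reflexive top) (s≤s (ℕ.≤-trans (pin-mono-≤ (toℕ k) (ℕ.n≤1+n n₁))
        (ℕ.≤-reflexive (sym (trans (next-rank c s eq) (cong (λ k → pin k n) (toℕ-inject₁ k))))))))
      where
      top : rank m (base c s) ≡ suc (pin (toℕ k) n₁)
      top = cong r eq
      c₀ : Fin n
      c₀ = proj₁ (rank-place m zero false)
      s₀ : Bool
      s₀ = proj₁ (proj₂ (rank-place m zero false))
      at-first : flip s₀ (position m c₀) ≡ (zero , false)
      at-first = proj₂ (proj₂ (proj₂ (rank-place m zero false)))

  module _ (m : Model n) {X : VSet} {i : ℕ} (closed : Closed X)
    (next⊆X : level (next m) i ⊆ X) (new : ∃[ x ] x ∈ᵛ X × x ∉ᵛ level (next m) i)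
    (X⊂ : X ⊂ level m (2 + i)) (X≢ : X ≢ level m (suc i)) where

    private
      start : ∃[ x ] rank m x ≡ 0
      start = rank-surjective zero m z≤n

      a : Vtx n
      a = proj₁ start

      first≡a : ∀ x → rank m x ≡ 0 → x ≡ a
      first≡a x x≡0 = rank-injective m (subst (_< pin (apexRank m) n) (sym x≡0) (ℕ.<-≤-trans (s≤s z≤n) (≤-pin (apexRank m) n)))
        (trans x≡0 (sym (proj₂ start)))

      whole : ∀ c s → base c s ∈ᵛ X → base c (not s) ∈ᵛ X → ∀ c′ s′ → base c′ s′ ∈ᵛ X
      whole c false e∈ e′∈ = closed c e∈ e′∈
      whole c true  e∈ e′∈ = closed c e′∈ e∈

      X-rank : ∀ x → x ∈ᵛ X → rank m x ≤ suc i
      X-rank x x∈ = ℕ.≤-pred (∈-level⁻ x (proj₁ X⊂ x∈))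

    -- If X contained the first vertex of m, it would contain all of `level m (suc i)`: lower ranks
    -- come from the next level, and the rest of the base from a together with its antipode. By
    -- `fill`, any further vertex would make X as large as `level m (2 + i)`, so X would be the old
    -- face.
    a∉X : a ∉ᵛ X
    a∉X a∈ = X≢ (⊆-antisym (⊆ᵛ⇒⊆ X⊆) level⊆X)
      where
      member : ∀ x → RankStep m x → rank m x ≤ i → x ∈ᵛ X
      member x (first-place x≡0 _) _ = subst (_∈ᵛ X) (sym (first≡a x x≡0)) a∈
      member x (lowered eq) x≤i = next⊆X (∈-level⁺ (subst (_≤ i) eq x≤i))
      member (base c s) (opposite-lowered c₀ s₀ _ first lower _ _) x≤i =
        whole c₀ s₀ (subst (_∈ᵛ X) (sym (first≡a _ first)) a∈) (next⊆X (∈-level⁺ (ℕ.≤-trans lower x≤i))) c s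

      level⊆X : level m (suc i) ⊆ X
      level⊆X = ⊆ᵛ⇒⊆ λ x x∈ → member x (rank-step m x) (ℕ.≤-pred (∈-level⁻ x x∈))

      X⊆ : ∀ x → x ∈ᵛ X → x ∈ᵛ level m (suc i)
      X⊆ x x∈ = go (ℕ.m≤n⇒m<n∨m≡n (X-rank x x∈))
        where
        go : rank m x < suc i ⊎ rank m x ≡ suc i → x ∈ᵛ level m (suc i)
        go (inj₁ x<) = ∈-level⁺ x<
        go (inj₂ x≡) = contradiction (fill m closed level⊆X x x∈ x≡ (proj₁ (proj₂ (proj₂ X⊂)))) (proj₂ (proj₂ (proj₂ X⊂)))

    -- The diamond property. As X avoids the first vertex of m, its members lose one rank in the
    -- next model; the vertex that is new in X then has rank exactly i there, and `fill` gives the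
    -- other inclusion.
    next-level : X ≡ level (next m) (suc i)
    next-level = ⊆-antisym (⊆ᵛ⇒⊆ λ x x∈ → member x (rank-step m x) x∈)
        (fill (next m) closed next⊆X (proj₁ new) (proj₁ (proj₂ new)) (ℕ.≤-antisym
          (ℕ.≤-pred (∈-level⁻ (proj₁ new) (member (proj₁ new) (rank-step m (proj₁ new)) (proj₁ (proj₂ new)))))
          (ℕ.≮⇒≥ λ x<i → proj₂ (proj₂ new) (∈-level⁺ x<i))))
      where
      member : ∀ x → RankStep m x → x ∈ᵛ X → x ∈ᵛ level (next m) (suc i)
      member x (first-place x≡0 _) x∈ = contradiction (subst (_∈ᵛ X) (first≡a x x≡0) x∈) a∉X
      member x (lowered eq) x∈ = ∈-level⁺ (subst (_≤ suc i) eq (X-rank x x∈))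
      member (base c s) (opposite-lowered c₀ s₀ lower first _ _ _) x∈ = contradiction
        (subst (_∈ᵛ X) (first≡a _ first) (whole c s x∈ (next⊆X (∈-level⁺ (ℕ.≤-pred (ℕ.≤-trans lower (X-rank _ x∈))))) c₀ s₀))
        a∉X

  rank-lowered : ∀ m {x} → RankStep m x → rank m x ≤ suc (rank (next m) x)
  rank-lowered m (first-place x≡0 _)              = ℕ.≤-trans (ℕ.≤-reflexive x≡0) z≤n
  rank-lowered m (lowered eq)                     = ℕ.≤-reflexive eq
  rank-lowered m (opposite-lowered _ _ _ _ _ _ r≤) = r≤

  -- The vertex that leaves the front: it distinguishes the next levels from the old ones in
  -- `next-below` and `next-≢`.
  last-place : ∀ m → ∃[ x ] rank m x ≡ 0 × n ≤ rank (next m) x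
  last-place m = x , x≡0 , go (rank-step m x) x≡0
    where
    x : Vtx n
    x = proj₁ (rank-surjective zero m z≤n)
    x≡0 : rank m x ≡ 0
    x≡0 = proj₂ (rank-surjective zero m z≤n)
    go : ∀ {x} → RankStep m x → rank m x ≡ 0 → n ≤ rank (next m) x
    go (first-place _ n≤)              _   = n≤
    go (lowered eq)                    x≡0 = contradiction (trans (sym eq) x≡0) λ ()
    go (opposite-lowered _ _ _ _ _ x≢0 _) x≡0 = contradiction x≡0 x≢0

  next-below : ∀ m {i} → i < n → level (next m) (suc i) ⊂ level m (2 + i)
  next-below m {i} i<n =
      ⊆ᵛ⇒⊆ (λ x x∈ → ∈-level⁺ (s≤s (ℕ.≤-trans (rank-lowered m (rank-step m x)) (∈-level⁻ x x∈))))
    , idx x , ∈-level⁺ (subst (_< 2 + i) (sym x≡0) (s≤s z≤n))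
    , λ x∈ → ℕ.<-irrefl refl (ℕ.<-≤-trans i<n (ℕ.≤-trans n≤ (ℕ.≤-pred (∈-level⁻ x x∈))))
    where
    x : Vtx n
    x = proj₁ (last-place m)
    x≡0 : rank m x ≡ 0
    x≡0 = proj₁ (proj₂ (last-place m))
    n≤ : n ≤ rank (next m) x
    n≤ = proj₂ (proj₂ (last-place m))

  next-≢ : ∀ m {i} → i < n → level (next m) (suc i) ≢ level m (suc i)
  next-≢ m {i} i<n eq = ℕ.<-irrefl refl (ℕ.<-≤-trans i<n (ℕ.≤-trans n≤ (ℕ.≤-pred
      (∈-level⁻ x (subst (x ∈ᵛ_) (sym eq) (∈-level⁺ (subst (_< suc i) (sym x≡0) (s≤s z≤n))))))))
    where
    x : Vtx n
    x = proj₁ (last-place m)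
    x≡0 : rank m x ≡ 0
    x≡0 = proj₁ (proj₂ (last-place m))
    n≤ : n ≤ rank (next m) x
    n≤ = proj₂ (proj₂ (last-place m))

module _ {n₁ : ℕ} where

  private
    n : ℕ
    n = suc n₁

  open Pyramid n
  open Faces P renaming (_≤_ to _≤ᶠ_; _≈_ to _≈ᶠᶜ_)
  open Flags P

  ∉-level₀ : ∀ (m : Model n) x → x ∉ᵛ level m 0
  ∉-level₀ m x x∈ with ∈-level⁻ {m = m} {0} x x∈
  ... | ()

  abstract

    -- The bound b allows three uses: b = n + 1 for the flag after `T`, b = n - j for a column of
    -- the reverse family, whose length shrinks, and b = 1 for the vertex exchanged by σ₁.
    next-levels : ∀ (m : Model n) (X : ℕ → VSet) {b} → (∀ i → i < b → Closed (X i)) → (0 < b → Nonempty (X 0)) →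
      (∀ i → suc i < b → X i ⊂ X (suc i)) → (∀ i → i < b → X i ⊂ level m (2 + i)) →
      (∀ i → i < b → X i ≢ level m (suc i)) → ∀ i → i < b → X i ≡ level (next m) (suc i)
    next-levels m X closed nonempty₀ chain X⊂ X≢ zero i<b = next-level m (closed 0 i<b)
      (⊆ᵛ⇒⊆ λ x x∈ → contradiction x∈ (∉-level₀ (next m) x))
      (vtx n (proj₁ ne) , ∈⇒∈ᵛ (proj₁ ne) (proj₂ ne) , ∉-level₀ (next m) (vtx n (proj₁ ne)))
      (X⊂ 0 i<b) (X≢ 0 i<b)
      where
      ne : Nonempty (X 0)
      ne = nonempty₀ i<b
    next-levels m X {b} closed nonempty₀ chain X⊂ X≢ (suc i) i<b = next-level m (closed (suc i) i<b)
      (λ {v} v∈ → proj₁ step (subst (v ∈_) (sym previous) v∈))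
      (vtx n v , ∈⇒∈ᵛ v (proj₁ (proj₂ (proj₂ step))) , λ x∈ → proj₂ (proj₂ (proj₂ step)) (∈ᵛ⇒∈ v (subst (vtx n v ∈ᵛ_) (sym previous) x∈)))
      (X⊂ (suc i) i<b) (X≢ (suc i) i<b)
      where
      step : X i ⊂ X (suc i)
      step = chain i i<b
      v : Fin (suc (n + n))
      v = proj₁ (proj₂ step)
      previous : X i ≡ level (next m) (suc i)
      previous = next-levels m X closed nonempty₀ chain X⊂ X≢ i (ℕ.<-trans (ℕ.n<1+n i) i<b)

  face-level : ∀ {f m} → f HasModel m → ∀ {i} (i< : i < suc n) → proj₁ (face f (fromℕ< i<)) ≡ level m (suc i)
  face-level {f} {m} fm i< = trans (fm (fromℕ< i<)) (cong (level m ∘ suc) (toℕ-fromℕ< i<))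

  model-by-levels : ∀ (m m′ : Model n) → (∀ i → i < suc n → level m (suc i) ≡ level m′ (suc i)) → m ~ m′
  model-by-levels m m′ eq = rank-faithful m m′ (rank-determined m m′ (λ j j≤n → eq j (s≤s j≤n)))

  Chain : List (Fin (suc n)) → Rel Flag _
  Chain = foldr (λ i R f g → ∃[ h ] σ i f h × R h g) _≈ᶠ_

  Replaced : List (Fin (suc n)) → Flag → Flag → Set
  Replaced is f g = (∀ j → ¬ (j List.∈ is) → face f j ≈ᶠᶜ face g j) ×
    (∀ j → j List.∈ is → face f j ≉ face g j × (∀ j′ → toℕ j′ ≡ suc (toℕ j) → face g j ⊏ face f j′))

  abstract

    -- The exchanges come in increasing order. When face j is exchanged, face j + 1 is still that of
    -- f, and no later exchange touches face j again; so the new face j lies below the old face j +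
    -- 1.
    chain-replaced : ∀ {is} → AllPairs Fin._<_ is → ∀ f g → Chain is f g → Replaced is f g
    chain-replaced {[]}     _ f g f≈g = (λ j _ → f≈g j) , λ j ()
    chain-replaced {i ∷ is} (i< ∷ sorted) f g (h , (f≉h , f≈h) , h⇝g) = outside , inside
      where
      rest : Replaced is h g
      rest = chain-replaced sorted h g h⇝g
      above : ∀ {j} → j List.∈ is → i Fin.< j
      above = All.lookup i<
      outside : ∀ j → ¬ (j List.∈ (i ∷ is)) → face f j ≈ᶠᶜ face g j
      outside j j∉ = trans (f≈h j (j∉ ∘ here)) (proj₁ rest j (j∉ ∘ there))
      inside : ∀ j → j List.∈ (i ∷ is) → face f j ≉ face g j × (∀ j′ → toℕ j′ ≡ suc (toℕ j) → face g j ⊏ face f j′)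
      inside j (here refl) = (λ f≈g → f≉h (trans f≈g (sym h≈g))) , λ j′ j′≡ →
        subst₂ _⊂_ h≈g (sym (f≈h j′ (λ { refl → ℕ.1+n≢n (sym j′≡) }))) (chain h j j′ (ℕ.≤-reflexive (sym j′≡)))
        where
        h≈g : face h j ≈ᶠᶜ face g j
        h≈g = proj₁ rest j λ j∈ → ℕ.<-irrefl refl (above j∈)
      inside j (there j∈) = (λ f≈g → proj₁ (proj₂ rest j j∈) (trans (sym (f≈h j j≢i)) f≈g)) , λ j′ j′≡ →
        subst (proj₁ (face g j) ⊂_) (sym (f≈h j′ (λ { refl → ℕ.<-asym (above j∈) (ℕ.≤-reflexive (sym j′≡)) })))
          (proj₂ (proj₂ rest j j∈) j′ j′≡)
        where
        j≢i : j ≢ i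
        j≢i refl = ℕ.<-irrefl refl (above j∈)

    T-replaced : ∀ f g → T f g → ∀ j → face f j ≉ face g j × (∀ j′ → toℕ j′ ≡ suc (toℕ j) → face g j ⊏ face f j′)
    T-replaced f g f⇝g j = proj₂ (chain-replaced {allFin (suc n)} (tabulate⁺-< id) f g f⇝g) j (∈-allFin j)

    T-next : ∀ {f g m m′} → f HasModel m → g HasModel m′ → T f g → m′ ~ next m
    T-next {f} {g} {m} {m′} fm gm′ f⇝g = model-by-levels m′ (next m) (next-levels m (λ i → level m′ (suc i))
      (λ i _ → level-closed m′ (suc i))
      (λ _ → let x , eq = rank-surjective zero m′ z≤n in idx x , ∈-level⁺ (s≤s (ℕ.≤-reflexive eq)))
      (λ i i<n → level-mono-< zero m′ ℕ.≤-refl (ℕ.≤-trans i<n (ℕ.n≤1+n _)))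
      (λ i i<b → below i i<b (suc i ℕ.<? suc n))
      (λ i i<b eq → proj₁ (T-replaced f g f⇝g (fromℕ< i<b)) (trans (face-level {f} fm i<b) (trans (sym eq) (sym (face-level {g} gm′ i<b))))))
      where
      below : ∀ i → i < suc n → Dec (suc i < suc n) → level m′ (suc i) ⊂ level m (2 + i)
      below i i<b (yes i<n) = subst₂ _⊂_ (face-level {g} gm′ i<b) (face-level {f} fm i<n)
        (proj₂ (T-replaced f g f⇝g (fromℕ< i<b)) (fromℕ< i<n) (trans (toℕ-fromℕ< i<n) (cong suc (sym (toℕ-fromℕ< i<b)))))
      -- Above the facet there is only the polytope itself, which is `level m (2 + n)`; a vertex of
      -- rank n + 1 in m′ makes the inclusion strict.
      below i i<b (no i≮n) = ⊆ᵛ⇒⊆ (λ x _ → ∈-level⁺ (s≤s (ℕ.≤-trans (rank≤ m x) (ℕ.≮⇒≥ i≮n))))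
        , idx (proj₁ last) , ∈-level⁺ (s≤s (ℕ.≤-trans (rank≤ m (proj₁ last)) (ℕ.≮⇒≥ i≮n)))
        , λ x∈ → ℕ.<-irrefl refl (ℕ.≤-trans (subst (_< suc i) (proj₂ last) (∈-level⁻ (proj₁ last) x∈)) i<b)
        where
        last : ∃[ x ] rank m′ x ≡ suc n
        last = rank-surjective zero m′ ℕ.≤-refl

-- Rotations of the circle of places and iterates of `next`

open import Data.Nat.Solver using (module +-*-Solver)
open +-*-Solver using (solve; _:+_; _:*_; con; _:=_)

residue-unique : ∀ N {x y} p q → x < N → y < N → x + p * N ≡ y + q * N → x ≡ y × p ≡ q
residue-unique N@(suc _) {x} {y} p q x<N y<N eq = x≡y , ℕ.*-cancelʳ-≡ p q N (ℕ.+-cancelˡ-≡ x (p * N) (q * N) (trans eq (cong (_+ q * N) (sym x≡y))))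
  where
  open ≡-Reasoning
  x≡y : x ≡ y
  x≡y = begin
    x                  ≡⟨ m<n⇒m%n≡m x<N ⟨
    x % N              ≡⟨ [m+kn]%n≡m%n x p N ⟨
    (x + p * N) % N    ≡⟨ cong (_% N) eq ⟩
    (y + q * N) % N    ≡⟨ [m+kn]%n≡m%n y q N ⟩
    y % N              ≡⟨ m<n⇒m%n≡m y<N ⟩
    y                  ∎

rotate^ : ∀ {n} → ℕ → Place n → Place n
rotate^ zero    p = p
rotate^ (suc a) p = rotate^ a (apply rotate p)

rotate^-suc : ∀ {n} a (p : Place n) → apply rotate (rotate^ a p) ≡ rotate^ (suc a) p
rotate^-suc zero    p = refl
rotate^-suc (suc a) p = rotate^-suc a (apply rotate p)

flip-rotate^ : ∀ {n} s a (p : Place n) → flip s (rotate^ a p) ≡ rotate^ a (flip s p)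
flip-rotate^ s zero    p = refl
flip-rotate^ s (suc a) p = trans (flip-rotate^ s a (apply rotate p)) (cong (rotate^ a) (flip-apply rotate s p))

rotate^-down : ∀ {n} a (y y′ : Fin n) s → toℕ y ≡ a + toℕ y′ → rotate^ a (y , s) ≡ (y′ , s)
rotate^-down zero    y       y′ s eq = cong (_, s) (toℕ-injective eq)
rotate^-down {suc n} (suc a) (suc y) y′ s eq = rotate^-down a (inject₁ y) y′ s (trans (toℕ-inject₁ y) (ℕ.suc-injective eq))

rotate^-wrap : ∀ {n} a (y y′ : Fin n) s → toℕ y + n ≡ a + toℕ y′ → a ≤ n → toℕ y < a → rotate^ a (y , s) ≡ (y′ , not s)
rotate^-wrap {suc n} (suc a) zero    y′ s eq _ _ = begin
  rotate^ a (fromℕ n , not s)  ≡⟨ rotate^-down a (fromℕ n) y′ (not s) (trans (toℕ-fromℕ n) (ℕ.suc-injective eq)) ⟩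
  (y′ , not s)                 ∎
  where open ≡-Reasoning
rotate^-wrap {suc n} (suc a) (suc y) y′ s eq (s≤s a≤n) (s≤s y<a) = rotate^-wrap a (inject₁ y) y′ s
  (trans (cong (_+ suc n) (toℕ-inject₁ y)) (ℕ.suc-injective eq)) (ℕ.≤-trans a≤n (ℕ.n≤1+n n)) (subst (_< a) (sym (toℕ-inject₁ y)) y<a)

-- Numbering of the places around the circle: antipodal places differ by n, and `rotate` lowers the
-- index by one modulo 2n.
index : ∀ {n} → Place n → ℕ
index     (y , false) = toℕ y
index {n} (y , true)  = n + toℕ y

index< : ∀ {n} (p : Place n) → index p < n + n
index< {n} (y , false) = ℕ.≤-trans (toℕ<n y) (ℕ.m≤m+n n n)
index< {n} (y , true)  = ℕ.+-monoʳ-< n (toℕ<n y)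

index-injective : ∀ {n} {p q : Place n} → index p ≡ index q → p ≡ q
index-injective {n} {y , false} {z , false} eq = cong (_, false) (toℕ-injective eq)
index-injective {n} {y , false} {z , true}  eq = contradiction eq (ℕ.<⇒≢ (ℕ.<-≤-trans (toℕ<n y) (ℕ.m≤m+n n (toℕ z))))
index-injective {n} {y , true}  {z , false} eq = contradiction (sym eq) (ℕ.<⇒≢ (ℕ.<-≤-trans (toℕ<n z) (ℕ.m≤m+n n (toℕ y))))
index-injective {n} {y , true}  {z , true}  eq = cong (_, true) (toℕ-injective (ℕ.+-cancelˡ-≡ n _ _ eq))

index-rotate : ∀ {n} (p : Place n) → ∃[ q ] suc (index (apply rotate p)) ≡ index p + q * (n + n)
index-rotate {suc n} (zero , false) = 1 , (begin
  suc (suc n + toℕ (fromℕ n))  ≡⟨ cong (λ y → suc (suc n + y)) (toℕ-fromℕ n) ⟩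
  suc (suc n + n)              ≡⟨ solve 1 (λ n → con 1 :+ (con 1 :+ n :+ n) := (con 1 :+ n) :+ (con 1 :+ n) :+ con 0) refl n ⟩
  1 * (suc n + suc n)          ∎)
  where open ≡-Reasoning
index-rotate {suc n} (zero , true)  = 0 , trans (cong suc (toℕ-fromℕ n)) (sym (trans (ℕ.+-identityʳ _) (ℕ.+-identityʳ (suc n))))
index-rotate {suc n} (suc y , false) = 0 , trans (cong suc (toℕ-inject₁ y)) (sym (ℕ.+-identityʳ _))
index-rotate {suc n} (suc y , true)  = 0 , trans (cong (λ y → suc (suc n + y)) (toℕ-inject₁ y))
  (sym (trans (ℕ.+-identityʳ _) (ℕ.+-suc (suc n) (toℕ y))))

index-rotate^ : ∀ {n} a (p : Place n) → ∃[ q ] index (rotate^ a p) + a ≡ index p + q * (n + n)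
index-rotate^ zero    p = 0 , refl
index-rotate^ {n} (suc a) p =
  let q , eq = index-rotate^ a (apply rotate p)
      q′ , eq′ = index-rotate p
  in q + q′ , (begin
    index (rotate^ a (apply rotate p)) + suc a    ≡⟨ ℕ.+-suc _ a ⟩
    suc (index (rotate^ a (apply rotate p)) + a)  ≡⟨ cong suc eq ⟩
    suc (index (apply rotate p)) + q * (n + n)    ≡⟨ cong (_+ q * (n + n)) eq′ ⟩
    index p + q′ * (n + n) + q * (n + n)          ≡⟨ solve 4 (λ i q q′ N → i :+ q′ :* N :+ q :* N := i :+ (q :+ q′) :* N) refl (index p) q q′ (n + n) ⟩
    index p + (q + q′) * (n + n)                  ∎)
  where open ≡-Reasoning

rotate^-period : ∀ {n} a (p : Place n) → rotate^ a p ≡ p → n + n ∣ a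
rotate^-period {n} a p eq =
  let q , eq′ = index-rotate^ a p
  in divides q (ℕ.+-cancelˡ-≡ (index p) a (q * (n + n)) (trans (cong (λ r → index r + a) (sym eq)) eq′))

rotate^-multiple : ∀ {n} a (p : Place n) → n + n ∣ a → rotate^ a p ≡ p
rotate^-multiple {n} a p (divides b a≡) =
  let q , eq = index-rotate^ a p
  in index-injective (proj₁ (residue-unique (n + n) b q (index< (rotate^ a p)) (index< p)
       (trans (cong (index (rotate^ a p) +_) (sym a≡)) eq)))

module _ {n : ℕ} where

  next^ : ℕ → Model n → Model n
  next^ zero    m = m
  next^ (suc t) m = next (next^ t m)

  next^-cong : ∀ t {m m′} → m ~ m′ → next^ t m ~ next^ t m′
  next^-cong zero    m~m′ = m~m′
  next^-cong (suc t) {m} {m′} m~m′ = next-cong {m = next^ t m} {next^ t m′} (next^-cong t m~m′)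

  ~-refl : ∀ {m : Model n} → m ~ m
  ~-refl = refl , λ _ → refl

  ~-sym : ∀ {m m′ : Model n} → m ~ m′ → m′ ~ m
  ~-sym (k≡ , p≡) = sym k≡ , sym ∘ p≡

  ~-trans : ∀ {m m′ m″ : Model n} → m ~ m′ → m′ ~ m″ → m ~ m″
  ~-trans (k≡ , p≡) (k≡′ , p≡′) = trans k≡ k≡′ , λ c → trans (p≡ c) (p≡′ c)

  -- After t steps the apex has been in front z times, and the other vertices
  -- have been rotated in the remaining a steps.
  record Elapsed (m : Model n) (t : ℕ) (m′ : Model n) : Set where
    constructor elapsed
    field
      z a       : ℕ
      apex-rank : apexRank m′ + t ≡ apexRank m + z * (2 + n)
      steps     : a + z ≡ t
      places    : ∀ c → position m′ c ≡ rotate^ a (position m c)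

  elapsed-suc : ∀ m {t} m′ → Elapsed m t m′ → Elapsed m (suc t) (next m′)
  elapsed-suc m {t} (model zero π ε) (elapsed z a apex-rank steps places) = elapsed (suc z) a
    (begin
      toℕ (fromℕ (suc n)) + suc t        ≡⟨ cong (_+ suc t) (toℕ-fromℕ (suc n)) ⟩
      suc n + suc t                      ≡⟨ solve 2 (λ n t → con 1 :+ n :+ (con 1 :+ t) := t :+ (con 2 :+ n)) refl n t ⟩
      t + (2 + n)                        ≡⟨ cong (_+ (2 + n)) apex-rank ⟩
      apexRank m + z * (2 + n) + (2 + n) ≡⟨ solve 3 (λ k z N → k :+ z :* N :+ N := k :+ (con 1 :+ z) :* N) refl (apexRank m) z (2 + n) ⟩
      apexRank m + suc z * (2 + n)       ∎)
    (trans (ℕ.+-suc a z) (cong suc steps)) places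
    where open ≡-Reasoning
  elapsed-suc m {t} (model (suc k) π ε) (elapsed z a apex-rank steps places) = elapsed z (suc a)
    (trans (cong (_+ suc t) (toℕ-inject₁ k)) (trans (ℕ.+-suc (toℕ k) t) apex-rank))
    (cong suc steps)
    λ c → trans (cong (apply rotate) (places c)) (rotate^-suc a (position m c))

  elapse : ∀ m t → Elapsed m t (next^ t m)
  elapse m zero    = elapsed 0 0 refl refl (λ _ → refl)
  elapse m (suc t) = elapsed-suc m (next^ t m) (elapse m t)

  apexRank< : ∀ (m : Model n) → apexRank m < 2 + n
  apexRank< m = toℕ<n (Model.k m)

  -- Division by n + 2 is unique, so the equation determines both the position of the apex after t
  -- steps and the number z of resets, hence the number a of rotations. If 2n divides a, all places
  -- return.
  reach : ∀ (m m′ : Model n) {t} z a → (∀ c → position m c ≡ position m′ c) →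
          apexRank m′ + t ≡ apexRank m + z * (2 + n) → a + z ≡ t → n + n ∣ a → next^ t m ~ m′
  reach m m′ {t} z a p≡ apex-rank steps 2n∣a = go (elapse m t)
    where
    go : Elapsed m t (next^ t m) → next^ t m ~ m′
    go (elapsed z′ a′ apex-rank′ steps′ places′) =
        toℕ-injective (proj₁ both)
      , λ c → trans (places′ c) (trans (cong (λ a → rotate^ a (position m c)) a′≡a)
                (trans (rotate^-multiple a (position m c) 2n∣a) (p≡ c)))
      where
      open ≡-Reasoning
      both : apexRank (next^ t m) ≡ apexRank m′ × z ≡ z′
      both = residue-unique (2 + n) z z′ (apexRank< (next^ t m)) (apexRank< m′) (ℕ.+-cancelʳ-≡ t _ _ (begin
        apexRank (next^ t m) + z * (2 + n) + t    ≡⟨ swap (apexRank (next^ t m)) (z * (2 + n)) t ⟩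
        apexRank (next^ t m) + t + z * (2 + n)    ≡⟨ cong (_+ z * (2 + n)) apex-rank′ ⟩
        apexRank m + z′ * (2 + n) + z * (2 + n)   ≡⟨ swap (apexRank m) (z′ * (2 + n)) (z * (2 + n)) ⟩
        apexRank m + z * (2 + n) + z′ * (2 + n)   ≡⟨ cong (_+ z′ * (2 + n)) apex-rank ⟨
        apexRank m′ + t + z′ * (2 + n)            ≡⟨ swap (apexRank m′) t (z′ * (2 + n)) ⟩
        apexRank m′ + z′ * (2 + n) + t            ∎))
        where
        swap : ∀ a b c → a + b + c ≡ a + c + b
        swap = solve 3 (λ a b c → a :+ b :+ c := a :+ c :+ b) refl
      a′≡a : a′ ≡ a
      a′≡a = ℕ.+-cancelʳ-≡ z a′ a (trans (cong (a′ +_) (proj₂ both)) (trans steps′ (sym steps)))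

-- Reversal

pin-≤-low : ∀ {k i h} → k ≤ i → pin k h ≤ i → h < i
pin-≤-low {k} {i} {h} k≤i p≤i with k ℕ.≤? h
... | yes k≤h = subst (_≤ i) (pin-≥ k≤h) p≤i
... | no  k≰h = ℕ.<-≤-trans (ℕ.≰⇒> k≰h) k≤i

-- An apex among the ranks up to i leaves i of these i + 1 ranks to the base; otherwise, in `high`,
-- all of them.
low : ∀ {k i h} → k ≤ i → pin k h ≤ i ⇔ h < i
low {k} k≤i = mk⇔ (pin-≤-low k≤i) (λ h<i → ℕ.≤-trans (pin-≤ k _) h<i)

high : ∀ {k i h} → i < k → pin k h ≤ i ⇔ h < suc i
high {k} {i} {h} i<k = mk⇔ (λ p≤i → s≤s (ℕ.≤-trans (≤-pin k h) p≤i))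
  (λ { (s≤s h≤i) → subst (_≤ i) (sym (pin-< (ℕ.≤-<-trans h≤i i<k))) h≤i })

both : ∀ {A B : Set} → A → B → A ⇔ B
both a b = mk⇔ (λ _ → b) (λ _ → a)

neither : ∀ {A B : Set} → ¬ A → ¬ B → A ⇔ B
neither ¬a ¬b = mk⇔ (λ a → contradiction a ¬a) (λ b → contradiction b ¬b)

reflect : ∀ {n} → Shuffle n
reflect = shuffle reverse (const false)

_≡⇔_ : ∀ {a b} → a ≡ b → ∀ i → a ≤ i ⇔ b ≤ i
refl ≡⇔ i = mk⇔ id id

opposite-sum : ∀ {n} (y : Fin n) → suc (toℕ (opposite y) + toℕ y) ≡ n
opposite-sum {n} y = trans (cong (λ z → suc (z + toℕ y)) (opposite-prop y)) (trans (sym (ℕ.+-suc _ (toℕ y))) (ℕ.m∸n+n≡m (toℕ<n y)))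

-- Both the rotation by a and the reflection bring the last b of the n places to the front.
height-reflect : ∀ {n} a b (p : Place n) → a + b ≡ n → (height (rotate^ a p) < b) ⇔ (height (apply reflect p) < b)
height-reflect {n} a b (y , s) a+b≡n = go s (a ℕ.≤? toℕ y)
  where
  b≤n : b ≤ n
  b≤n = subst (b ≤_) a+b≡n (ℕ.m≤n+m b a)
  a≤n : a ≤ n
  a≤n = subst (a ≤_) a+b≡n (ℕ.m≤m+n a b)
  n≮b : ¬ (n < b)
  n≮b = ℕ.≤⇒≯ b≤n
  module _ (a≤y : a ≤ toℕ y) where
    y′ : Fin n
    y′ = fromℕ< (ℕ.≤-<-trans (ℕ.m∸n≤m (toℕ y) a) (toℕ<n y))
    down : ∀ s → rotate^ a (y , s) ≡ (y′ , s)
    down s = rotate^-down a y y′ s (sym (trans (cong (a +_) (toℕ-fromℕ< _)) (ℕ.m+[n∸m]≡n a≤y)))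
    y′<b : toℕ y′ < b
    y′<b = ℕ.+-cancelˡ-< a (toℕ y′) b (subst₂ _<_ (sym (trans (cong (a +_) (toℕ-fromℕ< _)) (ℕ.m+[n∸m]≡n a≤y))) (sym a+b≡n) (toℕ<n y))
    opp<b : toℕ (opposite y) < b
    opp<b = ℕ.+-cancelʳ-≤ a _ b (ℕ.≤-trans (ℕ.+-monoʳ-≤ (suc (toℕ (opposite y))) a≤y)
              (ℕ.≤-reflexive (trans (opposite-sum y) (trans (sym a+b≡n) (ℕ.+-comm a b)))))
  module _ (y<a : toℕ y < a) where
    a≤y+n : a ≤ toℕ y + n
    a≤y+n = ℕ.≤-trans a≤n (ℕ.m≤n+m n (toℕ y))
    y+n∸a<n : toℕ y + n ∸ a < n
    y+n∸a<n = ℕ.+-cancelˡ-< a _ n (subst (_< a + n) (sym (ℕ.m+[n∸m]≡n a≤y+n)) (ℕ.+-monoˡ-< n y<a))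
    y″ : Fin n
    y″ = fromℕ< y+n∸a<n
    y″-sum : toℕ y + n ≡ a + toℕ y″
    y″-sum = sym (trans (cong (a +_) (toℕ-fromℕ< y+n∸a<n)) (ℕ.m+[n∸m]≡n a≤y+n))
    wrap : ∀ s → rotate^ a (y , s) ≡ (y″ , not s)
    wrap s = rotate^-wrap a y y″ s y″-sum a≤n y<a
    y″≮b : ¬ (toℕ y″ < b)
    y″≮b y″<b = ℕ.<-irrefl refl (ℕ.<-≤-trans (subst₂ _<_ (sym y″-sum) a+b≡n (ℕ.+-monoʳ-< a y″<b)) (ℕ.m≤n+m n (toℕ y)))
    opp≮b : ¬ (toℕ (opposite y) < b)
    opp≮b opp<b = ℕ.<-irrefl (trans (opposite-sum y) (sym (trans (ℕ.+-comm b a) a+b≡n)))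
      (subst (_< b + a) (ℕ.+-suc (toℕ (opposite y)) (toℕ y)) (ℕ.+-mono-<-≤ opp<b y<a))
  go : ∀ s → Dec (a ≤ toℕ y) → (height (rotate^ a (y , s)) < b) ⇔ (height (apply reflect (y , s)) < b)
  go false (yes a≤y) = both (subst (λ p → height p < b) (sym (down a≤y false)) (y′<b a≤y)) (opp<b a≤y)
  go false (no  a≰y) = neither (λ h< → n≮b (subst (λ p → height p < b) (wrap (ℕ.≰⇒> a≰y) false) h<)) (opp≮b (ℕ.≰⇒> a≰y))
  go true  (yes a≤y) = neither (λ h< → n≮b (subst (λ p → height p < b) (down a≤y true) h<)) n≮b
  go true  (no  a≰y) = neither (λ h< → y″≮b (ℕ.≰⇒> a≰y) (subst (λ p → height p < b) (wrap (ℕ.≰⇒> a≰y) true) h<)) n≮b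

rotate-reflect : ∀ {n} → Shuffle n
rotate-reflect = shuffle (Shuffle.move rotate ∘ₚ reverse) first

module _ {n : ℕ} where

  open Pyramid n
  open Faces P renaming (_≤_ to _≤ᶠ_; _≈_ to _≈ᶠᶜ_)
  open Flags P

  -- The simplices of a flag are reversed by reading the order of the vertices
  -- backwards; if the facet is the base, the first vertex is replaced by its
  -- antipode and stays in front.
  reverseBy : (m : Model n) → Dec (apexRank m < suc n) → Model n
  reverseBy m (yes k<) = act reflect (inject₁ (opposite (fromℕ< k<))) m
  reverseBy m (no  _)  = act rotate-reflect (fromℕ (suc n)) m

  reverseModel : Model n → Model n
  reverseModel m = reverseBy m (apexRank m ℕ.<? suc n)

  rank-next^ : ∀ (m : Model n) t (e : Elapsed m t (next^ t m)) c s →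
    rank (next^ t m) (base c s) ≡ pin (apexRank (next^ t m)) (height (rotate^ (Elapsed.a e) (flip s (position m c))))
  rank-next^ m t e c s = cong (pin (apexRank (next^ t m)) ∘ height)
    (trans (cong (flip s) (Elapsed.places e c)) (flip-rotate^ s (Elapsed.a e) (position m c)))

  SameBelow : ℕ → Model n → Model n → Set
  SameBelow i m m′ = ∀ x → (rank m x ≤ i) ⇔ (rank m′ x ≤ i)

  module _ (m : Model n) {i t : ℕ} (t+i≡n : t + i ≡ n) where

    private
      k κ : ℕ
      k = apexRank m
      κ = apexRank (next^ t m)

      i≤n : i ≤ n
      i≤n = subst (i ≤_) t+i≡n (ℕ.m≤n+m i t)

      t≤n : t ≤ n
      t≤n = subst (t ≤_) t+i≡n (ℕ.m≤m+n t i)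

      κ+t< : κ + t < (2 + n) + (2 + n)
      κ+t< = ℕ.+-mono-<-≤ (toℕ<n (Model.k (next^ t m))) (ℕ.≤-trans t≤n (ℕ.m≤n+m n 2))

      rank-act : ∀ τ j c s → rank (act τ j m) (base c s) ≡ pin (toℕ j) (height (apply τ (flip s (position m c))))
      rank-act τ j c s = cong (pin (toℕ j) ∘ height) (flip-apply τ s (position m c))

    -- Face i of the reverse is face i after t = n - i steps. Without a reset of the apex, it lies
    -- in both faces, and t rotations bring i vertices of the base to the front. With one reset it
    -- lies in neither, and t - 1 rotations match i + 1 vertices. A second reset does not fit into n
    -- steps.
    reverse-below-simplex : (k< : k < suc n) → SameBelow i (next^ t m) (reverseBy m (yes k<))
    reverse-below-simplex k< = cases (elapse m t)
      where
      k′ : ℕ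
      k′ = toℕ (inject₁ (opposite (fromℕ< k<)))

      k′+k≡n : k′ + k ≡ n
      k′+k≡n = ℕ.suc-injective (trans (cong₂ (λ a b → suc (a + b)) (toℕ-inject₁ (opposite (fromℕ< k<))) (sym (toℕ-fromℕ< k<)))
                 (opposite-sum (fromℕ< k<)))

      cases : Elapsed m t (next^ t m) → SameBelow i (next^ t m) (reverseBy m (yes k<))
      cases e@(elapsed 0 a apex-rank steps places) = below
        where
        κ+t≡k : κ + t ≡ k
        κ+t≡k = trans apex-rank (ℕ.+-identityʳ k)
        a≡t : a ≡ t
        a≡t = trans (sym (ℕ.+-identityʳ a)) steps
        κ≤i : κ ≤ i
        κ≤i = ℕ.+-cancelʳ-≤ t κ i (ℕ.≤-trans (ℕ.≤-reflexive κ+t≡k) (ℕ.≤-trans (ℕ.≤-pred k<) (ℕ.≤-reflexive (trans (sym t+i≡n) (ℕ.+-comm t i)))))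
        k′≤i : k′ ≤ i
        k′≤i = ℕ.+-cancelʳ-≤ k k′ i (ℕ.≤-trans (ℕ.≤-reflexive (trans k′+k≡n (trans (sym t+i≡n) (ℕ.+-comm t i))))
                 (ℕ.+-monoʳ-≤ i (ℕ.≤-trans (ℕ.m≤n+m t κ) (ℕ.≤-reflexive κ+t≡k))))
        below : SameBelow i (next^ t m) (reverseBy m (yes k<))
        below apex       = both κ≤i k′≤i
        below (base c s) = ⇔-sym (low k′≤i ⇔-∘ (rank-act reflect (inject₁ (opposite (fromℕ< k<))) c s ≡⇔ i)) ⇔-∘
          (height-reflect a i (flip s (position m c)) (trans (cong (_+ i) a≡t) t+i≡n) ⇔-∘
          (low κ≤i ⇔-∘ (rank-next^ m t e c s ≡⇔ i)))
      cases e@(elapsed 1 a apex-rank steps places) = below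
        where
        suc-a≡t : suc a ≡ t
        suc-a≡t = trans (ℕ.+-comm 1 a) steps
        κ≡ : κ ≡ suc (suc i) + k
        κ≡ = ℕ.+-cancelʳ-≡ t κ (suc (suc i) + k) (begin
          κ + t                  ≡⟨ apex-rank ⟩
          k + 1 * (2 + n)        ≡⟨ cong (λ n → k + 1 * (2 + n)) (sym t+i≡n) ⟩
          k + 1 * (2 + (t + i))  ≡⟨ solve 3 (λ k t i → k :+ con 1 :* (con 2 :+ (t :+ i)) := con 2 :+ i :+ k :+ t) refl k t i ⟩
          suc (suc i) + k + t    ∎)
          where open ≡-Reasoning
        i<κ : i < κ
        i<κ = ℕ.≤-trans (ℕ.≤-trans (ℕ.n≤1+n (suc i)) (ℕ.m≤m+n (suc (suc i)) k)) (ℕ.≤-reflexive (sym κ≡))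
        i<k′ : i < k′
        i<k′ = ℕ.+-cancelʳ-≤ k (suc i) k′ (ℕ.≤-pred (ℕ.≤-trans (ℕ.≤-reflexive (sym κ≡))
                 (ℕ.≤-trans (toℕ≤pred[n] (Model.k (next^ t m))) (ℕ.≤-reflexive (cong suc (sym k′+k≡n))))))
        below : SameBelow i (next^ t m) (reverseBy m (yes k<))
        below apex       = neither (ℕ.<⇒≱ i<κ) (ℕ.<⇒≱ i<k′)
        below (base c s) = ⇔-sym (high i<k′ ⇔-∘ (rank-act reflect (inject₁ (opposite (fromℕ< k<))) c s ≡⇔ i)) ⇔-∘
          (height-reflect a (suc i) (flip s (position m c)) (trans (ℕ.+-suc a i) (trans (cong (_+ i) suc-a≡t) t+i≡n)) ⇔-∘
          (high i<κ ⇔-∘ (rank-next^ m t e c s ≡⇔ i)))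
      cases (elapsed (suc (suc z)) a apex-rank steps places) = contradiction κ+t< (ℕ.≤⇒≯ (ℕ.≤-trans
        (ℕ.≤-trans (ℕ.≤-reflexive (cong ((2 + n) +_) (sym (ℕ.+-identityʳ (2 + n))))) (ℕ.+-monoʳ-≤ (2 + n) (ℕ.+-monoʳ-≤ (2 + n) z≤n)))
        (ℕ.≤-trans (ℕ.m≤n+m (suc (suc z) * (2 + n)) k) (ℕ.≤-reflexive (sym apex-rank)))))

    -- The apex moves from n + 1 to i + 1, without a reset and outside of both faces. The faces have
    -- room for i + 1 vertices of the base, while there are t = n - i rotations; the rotation in
    -- excess is the one contained in `rotate-reflect`.
    reverse-below-base : (k≮ : ¬ (k < suc n)) → SameBelow i (next^ t m) (reverseBy m (no k≮))
    reverse-below-base k≮ = cases (elapse m t)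
      where
      k≡ : k ≡ suc n
      k≡ = ℕ.≤-antisym (toℕ≤pred[n] (Model.k m)) (ℕ.≮⇒≥ k≮)
      i<k′ : i < toℕ (fromℕ (suc n))
      i<k′ = subst (i <_) (sym (toℕ-fromℕ (suc n))) (s≤s i≤n)

      cases : Elapsed m t (next^ t m) → SameBelow i (next^ t m) (reverseBy m (no k≮))
      cases e@(elapsed 0 a apex-rank steps places) = below
        where
        a≡t : a ≡ t
        a≡t = trans (sym (ℕ.+-identityʳ a)) steps
        i<κ : i < κ
        i<κ = ℕ.+-cancelʳ-≤ t (suc i) κ (ℕ.≤-reflexive (sym (trans apex-rank (trans (ℕ.+-identityʳ k)
                (trans k≡ (cong suc (trans (sym t+i≡n) (ℕ.+-comm t i))))))))
        turned : ∀ a p → a + i ≡ n → (height (rotate^ a p) < suc i) ⇔ (height (apply rotate-reflect p) < suc i)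
        turned zero    p eq = both (s≤s (ℕ.≤-trans (height≤n p) (ℕ.≤-reflexive (sym eq))))
                                   (s≤s (ℕ.≤-trans (height≤n (apply rotate-reflect p)) (ℕ.≤-reflexive (sym eq))))
        turned (suc a) p eq = height-reflect a (suc i) (apply rotate p) (trans (ℕ.+-suc a i) eq)
        below : SameBelow i (next^ t m) (reverseBy m (no k≮))
        below apex       = neither (ℕ.<⇒≱ i<κ) (ℕ.<⇒≱ i<k′)
        below (base c s) = ⇔-sym (high i<k′ ⇔-∘ (rank-act rotate-reflect (fromℕ (suc n)) c s ≡⇔ i)) ⇔-∘
          (turned a (flip s (position m c)) (trans (cong (_+ i) a≡t) t+i≡n) ⇔-∘
          (high i<κ ⇔-∘ (rank-next^ m t e c s ≡⇔ i)))
      cases (elapsed (suc z) a apex-rank steps places) = contradiction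
        (ℕ.+-mono-<-≤ (toℕ<n (Model.k (next^ t m))) t≤n)
        (ℕ.≤⇒≯ (ℕ.≤-trans (ℕ.≤-reflexive (ℕ.+-comm (2 + n) n)) (ℕ.≤-trans
          (ℕ.+-mono-≤ (ℕ.≤-trans (ℕ.n≤1+n n) (ℕ.≤-reflexive (sym k≡))) (ℕ.m≤m+n (2 + n) (z * (2 + n))))
          (ℕ.≤-reflexive (sym apex-rank)))))

    reverse-below : SameBelow i (next^ t m) (reverseModel m)
    reverse-below = go (k ℕ.<? suc n)
      where
      go : (k<? : Dec (k < suc n)) → SameBelow i (next^ t m) (reverseBy m k<?)
      go (yes k<) = reverse-below-simplex k<
      go (no k≮)  = reverse-below-base k≮

    abstract

      reverse-level : level (next^ t m) (suc i) ≡ level (reverseModel m) (suc i)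
      reverse-level = ⊆-antisym
        (⊆ᵛ⇒⊆ λ x x∈ → ∈-level⁺ (s≤s (Equivalence.to (reverse-below x) (ℕ.≤-pred (∈-level⁻ x x∈)))))
        (⊆ᵛ⇒⊆ λ x x∈ → ∈-level⁺ (s≤s (Equivalence.from (reverse-below x) (ℕ.≤-pred (∈-level⁻ x x∈)))))

module _ {n₁ : ℕ} where

  private
    n : ℕ
    n = suc n₁

  open Pyramid n
  open Faces P renaming (_≤_ to _≤ᶠ_; _≈_ to _≈ᶠᶜ_)
  open Flags P

  abstract

    -- Column j of the family is the lower part of the flag after j steps: `up`, `diag` and `new`
    -- are exactly the chain, the upper bound and the difference that `next-levels` asks for.
    family-level : ∀ {f m x} → f HasModel m → ReverseFamily f x →
      ∀ j i → i + j < suc n → proj₁ (x i j) ≡ level (next^ j m) (suc i)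
    family-level {f} {m} {x} fm family zero i i+0< = trans (cong (λ i → proj₁ (x i 0)) (sym (toℕ-fromℕ< i<)))
      (trans (ReverseFamily.first family (fromℕ< i<)) (face-level {f = f} fm i<))
      where
      i< : i < suc n
      i< = subst (_< suc n) (ℕ.+-identityʳ i) i+0<
    family-level {f} {m} {x} fm family (suc j) i i+j< = next-levels (next^ j m) (λ i → proj₁ (x i (suc j))) {n ∸ j}
      (λ i _ → face-closed (proj₂ (x i (suc j))))
      (λ 0< → let p , p∈ , _ = ReverseFamily.dim family 0 (suc j) (inside 0<) in p zero , p∈ zero)
      (λ i i< → ReverseFamily.up family i (suc j) (inside i<))
      (λ i i< → subst (proj₁ (x i (suc j)) ⊂_) (family-level {f} fm family j (suc i) (subst (_< suc n) (ℕ.+-suc i j) (inside i<)))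
                  (ReverseFamily.diag family i j (inside i<)))
      (λ i i< eq → ReverseFamily.new family i j (inside i<)
        (trans eq (sym (family-level {f} fm family j i (ℕ.<-trans (ℕ.+-monoʳ-< i (ℕ.n<1+n j)) (inside i<))))))
      i (outside i+j<)
      where
      inside : ∀ {i} → i < n ∸ j → i + suc j < suc n
      inside {i} i< = subst (_< suc n) (sym (ℕ.+-suc i j)) (s≤s (ℕ.m≤o∸n⇒m+n≤o (suc i) j≤n i<))
        where
        j≤n : j ≤ n
        j≤n = ℕ.<⇒≤ (ℕ.m∸n≢0⇒n<m (λ eq → ℕ.n≮0 (subst (i <_) eq i<)))
      outside : i + suc j < suc n → i < n ∸ j
      outside i+j< = ℕ.m+n≤o⇒m≤o∸n (suc i) (ℕ.≤-pred (subst (_< suc n) (ℕ.+-suc i j) i+j<))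

    opposite+ : ∀ (i : Fin (suc n)) → toℕ (opposite i) + toℕ i ≡ n
    opposite+ i = ℕ.suc-injective (opposite-sum i)

    Reverse-model : ∀ {f g m m′} → f HasModel m → g HasModel m′ → Reverse f g → m′ ~ reverseModel m
    Reverse-model {f} {g} {m} {m′} fm gm′ (x , family , g≈x) = model-by-levels m′ (reverseModel m) λ i i< →
      trans (sym (face-level {f = g} gm′ i<)) (trans (g≈x (fromℕ< i<))
        (trans (family-level {f} fm family (toℕ (opposite (fromℕ< i<))) (toℕ (fromℕ< i<))
                  (s≤s (ℕ.≤-reflexive (trans (ℕ.+-comm (toℕ (fromℕ< i<)) _) (opposite+ (fromℕ< i<))))))
        (trans (cong (λ i′ → level (next^ (toℕ (opposite (fromℕ< i<))) m) (suc i′)) (toℕ-fromℕ< i<))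
               (reverse-level m (trans (cong (toℕ (opposite (fromℕ< i<)) +_) (sym (toℕ-fromℕ< i<))) (opposite+ (fromℕ< i<)))))))

    -- The levels of the iterates of m form a reverse family, and `reverse-level` identifies its
    -- antidiagonal.
    model-Reverse : ∀ {f g m} → f HasModel m → g HasModel (reverseModel m) → Reverse f g
    model-Reverse {f} {g} {m} fm gm = (λ i j → levelFace (next^ j m) (suc i)) , record
      { first = λ i → sym (fm i)
      ; dim   = λ i j i+j< → level-dim zero (next^ j m) i (ℕ.≤-trans (ℕ.m≤m+n i j) (ℕ.≤-pred i+j<))
      ; up    = λ i j i+j< → level-mono-< zero (next^ j m) ℕ.≤-refl (ℕ.≤-trans (s≤s (ℕ.m≤m+n (suc i) j)) (ℕ.≤-trans i+j< (ℕ.n≤1+n _)))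
      ; diag  = λ i j i+j< → next-below (next^ j m) (below i j i+j<)
      ; new   = λ i j i+j< → next-≢ (next^ j m) (below i j i+j<)
      } , λ i → trans (gm i) (sym (reverse-level m (opposite+ i)))
      where
      below : ∀ i j → i + suc j < suc n → i < n
      below i j i+j< = ℕ.≤-trans (s≤s (ℕ.m≤m+n i j)) (ℕ.≤-pred (subst (_< suc n) (ℕ.+-suc i j) i+j<))

-- The exchange σ₁ of the vertex of a flag

swap₀₁ : ℕ → ℕ
swap₀₁ 0             = 1
swap₀₁ 1             = 0
swap₀₁ (suc (suc r)) = suc (suc r)

swap₀₁-involutive : ∀ r → swap₀₁ (swap₀₁ r) ≡ r
swap₀₁-involutive 0             = refl
swap₀₁-involutive 1             = refl
swap₀₁-involutive (suc (suc r)) = refl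

swap₀₁-< : ∀ {r j} → swap₀₁ r < 2 + j → r < 2 + j
swap₀₁-< {0}           _  = s≤s z≤n
swap₀₁-< {1}           _  = s≤s (s≤s z≤n)
swap₀₁-< {suc (suc r)} r< = r<

exchange : ∀ {n} → Shuffle (2 + n)
exchange = shuffle (transpose zero (suc zero)) (const false)

module _ {n₂ : ℕ} where

  private
    n : ℕ
    n = suc (suc n₂)

  open Pyramid n
  open Faces P renaming (_≤_ to _≤ᶠ_; _≈_ to _≈ᶠᶜ_)
  open Flags P

  swapFront : Model n → Model n
  swapFront   (model zero          π ε) = model (suc zero) π ε
  swapFront   (model (suc zero)    π ε) = model zero π ε
  swapFront m@(model (suc (suc k)) π ε) = act exchange (suc (suc k)) m

  -- If the apex has one of the ranks 0 and 1, moving it to the other suffices, since `pin` lets the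
  -- first place of the base fill the free slot. Otherwise both ranks belong to the first two
  -- places.
  swapFront-rank : ∀ m x → rank (swapFront m) x ≡ swap₀₁ (rank m x)
  swapFront-rank (model zero          π ε) apex = refl
  swapFront-rank (model (suc zero)    π ε) apex = refl
  swapFront-rank (model (suc (suc k)) π ε) apex = refl
  swapFront-rank m@(model zero π ε) (base c s) = go (height (flip s (position m c)))
    where
    go : ∀ h → pin 1 h ≡ swap₀₁ (pin 0 h)
    go zero    = refl
    go (suc h) = refl
  swapFront-rank m@(model (suc zero) π ε) (base c s) = go (height (flip s (position m c)))
    where
    go : ∀ h → pin 0 h ≡ swap₀₁ (pin 1 h)
    go zero    = refl
    go (suc h) = refl
  swapFront-rank m@(model (suc (suc k)) π ε) (base c s) = trans
    (cong (pin (2 + toℕ k) ∘ height) (flip-apply exchange s (position m c))) (go (flip s (position m c)))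
    where
    go : ∀ p → pin (2 + toℕ k) (height (apply exchange p)) ≡ swap₀₁ (pin (2 + toℕ k) (height p))
    go (zero          , false) = refl
    go (suc zero      , false) = refl
    go (suc (suc y)   , false) = refl
    go (y             , true)  = refl

  swapFront-above : ∀ m j → level (swapFront m) (2 + j) ≡ level m (2 + j)
  swapFront-above m j = ⊆-antisym
    (⊆ᵛ⇒⊆ λ x x∈ → ∈-level⁺ (swap₀₁-< (subst (_< 2 + j) (swapFront-rank m x) (∈-level⁻ x x∈))))
    (⊆ᵛ⇒⊆ λ x x∈ → ∈-level⁺ (swap₀₁-< (subst (_< 2 + j)
      (sym (trans (cong swap₀₁ (swapFront-rank m x)) (swap₀₁-involutive (rank m x)))) (∈-level⁻ x x∈))))

  swapFront-first : ∀ m → level (swapFront m) 1 ≢ level m 1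
  swapFront-first m eq = contradiction
    (subst (_< 1) (trans (swapFront-rank m x) (cong swap₀₁ x≡0)) (∈-level⁻ x (subst (x ∈ᵛ_) (sym eq) (∈-level⁺ (subst (_< 1) (sym x≡0) (s≤s z≤n))))))
    (ℕ.<-irrefl refl)
    where
    x : Vtx n
    x = proj₁ (rank-surjective zero m z≤n)
    x≡0 : rank m x ≡ 0
    x≡0 = proj₂ (rank-surjective zero m z≤n)

  abstract

    model-σ₀ : ∀ {f g m} → f HasModel m → g HasModel (swapFront m) → σ zero f g
    model-σ₀ {f} {g} {m} fm gm = (λ f≈g → swapFront-first m (trans (sym (gm zero)) (trans (sym f≈g) (fm zero))))
      , λ { zero 0≢0 → contradiction refl 0≢0
          ; (suc j) _ → trans (fm (suc j)) (trans (sym (swapFront-above m (toℕ j))) (sym (gm (suc j)))) }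

    -- `T` begins with σ₁ and leaves the vertex alone afterwards, so the new vertex is that of the
    -- next flag.
    σ₀-vertex : ∀ {f g m m′} → f HasModel m → g HasModel m′ → σ zero f g → level m′ 1 ≡ level (next m) 1
    σ₀-vertex {f} {g} {m} {m′} fm gm′ (f≉g , f≈g) = next-levels m (λ i → level m′ (suc i)) {1}
      (λ i _ → level-closed m′ (suc i))
      (λ _ → let x , eq = rank-surjective zero m′ z≤n in idx x , ∈-level⁺ (s≤s (ℕ.≤-reflexive eq)))
      (λ { i (s≤s ()) })
      (λ { zero _ → subst (level m′ 1 ⊂_) (trans (sym (gm′ (suc zero))) (trans (sym (f≈g (suc zero) λ ())) (fm (suc zero))))
                      (level-mono-< zero m′ (s≤s (s≤s z≤n)) (s≤s (s≤s z≤n)))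
         ; (suc i) (s≤s ()) })
      (λ { zero _ eq → f≉g (trans (fm zero) (trans (sym eq) (sym (gm′ zero)))) ; (suc i) (s≤s ()) })
      zero (s≤s z≤n)

    σ₀-model : ∀ {f g m m′} → f HasModel m → g HasModel m′ → σ zero f g → m′ ~ swapFront m
    σ₀-model {f} {g} {m} {m′} fm gm′ f⇝g = model-by-levels m′ (swapFront m) λ
      -- Both candidates for the new vertex are the first level of `next m`.
      { zero _ → trans (σ₀-vertex {f} {g} fm gm′ f⇝g)
          (sym (σ₀-vertex {f} {flag-of zero (swapFront m)} fm (λ _ → refl) (model-σ₀ {f} {flag-of zero (swapFront m)} fm (λ _ → refl))))
      ; (suc i) (s≤s i<) → above i i< }
      where
      above : ∀ i → i < n → level m′ (2 + i) ≡ level (swapFront m) (2 + i)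
      above i i<n = begin
        level m′ (2 + i)                 ≡⟨ cong (λ i → level m′ (2 + i)) (toℕ-fromℕ< i<n) ⟨
        level m′ (2 + toℕ j)             ≡⟨ gm′ (suc j) ⟨
        proj₁ (face g (suc j))           ≡⟨ proj₂ f⇝g (suc j) (λ ()) ⟨
        proj₁ (face f (suc j))           ≡⟨ fm (suc j) ⟩
        level m (2 + toℕ j)              ≡⟨ cong (λ i → level m (2 + i)) (toℕ-fromℕ< i<n) ⟩
        level m (2 + i)                  ≡⟨ swapFront-above m i ⟨
        level (swapFront m) (2 + i)      ∎
        where
        open ≡-Reasoning
        j : Fin n
        j = fromℕ< i<n

-- Signatures

data Parity (n : ℕ) : Set where
  even : ∀ h → n ≡ h * 2 → Parity n
  odd  : ∀ h → n ≡ 1 + h * 2 → Parity n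

parity : ∀ n → Parity n
parity zero    = even 0 refl
parity (suc n) with parity n
... | even h refl = odd h refl
... | odd h refl  = even (suc h) refl

2∤1 : ¬ (2 ∣ 1)
2∤1 2∣1 with ∣1⇒≡1 2∣1
... | ()

2∣n+n : ∀ n → 2 ∣ n + n
2∣n+n n = divides n (solve 1 (λ n → n :+ n := n :* con 2) refl n)

module _ {n : ℕ} where

  rotate-back : ∀ a (p : Place n) → rotate^ a (apply rotate p) ≡ apply rotate (rotate^ a p)
  rotate-back a p = sym (rotate^-suc a p)

-- Reflections of the circle of places reverse its orientation.
rotate-reflect-rotate : ∀ {n} (p : Place n) → apply rotate (apply reflect (apply rotate p)) ≡ apply reflect p
rotate-reflect-rotate {suc n} (zero , s) = trans
  (cong (λ y → apply rotate (y , not s)) (toℕ-injective {i = opposite (fromℕ n)} {zero} (ℕ.+-cancelʳ-≡ n _ _ (begin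
    toℕ (opposite (fromℕ n)) + n              ≡⟨ cong (toℕ (opposite (fromℕ n)) +_) (toℕ-fromℕ n) ⟨
    toℕ (opposite (fromℕ n)) + toℕ (fromℕ n)  ≡⟨ ℕ.suc-injective (opposite-sum (fromℕ n)) ⟩
    n                                         ∎))))
  (cong (fromℕ n ,_) (Bool.not-involutive s))
  where open ≡-Reasoning
rotate-reflect-rotate {suc n} (suc y , s) = cong (λ z → apply rotate (z , s))
  (toℕ-injective {i = opposite (inject₁ y)} {suc (opposite y)} (ℕ.+-cancelʳ-≡ (toℕ y) _ _ (ℕ.suc-injective (begin
    suc (toℕ (opposite (inject₁ y)) + toℕ y)            ≡⟨ cong (λ z → suc (toℕ (opposite (inject₁ y)) + z)) (toℕ-inject₁ y) ⟨
    suc (toℕ (opposite (inject₁ y)) + toℕ (inject₁ y))  ≡⟨ opposite-sum (inject₁ y) ⟩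
    suc n                                               ≡⟨ cong suc (opposite-sum y) ⟨
    suc (suc (toℕ (opposite y) + toℕ y))                ∎))))
  where open ≡-Reasoning

rotate-reflect-rotate^ : ∀ {n} b (p : Place n) →
  apply rotate (apply reflect (rotate^ b (apply rotate p))) ≡ apply reflect (rotate^ b p)
rotate-reflect-rotate^ b p = trans (cong (apply rotate ∘ apply reflect) (rotate-back b p)) (rotate-reflect-rotate (rotate^ b p))

-- The positions in m contain one place of each antipodal pair, and maps commuting with `flip` are
-- determined by their values there.
everywhere : ∀ {n} (m : Model n) {f g : Place n → Place n} →
  (∀ s p → flip s (f p) ≡ f (flip s p)) → (∀ s p → flip s (g p) ≡ g (flip s p)) →
  (∀ c → f (position m c) ≡ g (position m c)) → ∀ p → f p ≡ g p
everywhere m {f} {g} f-flip g-flip eq (y , t) =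
  let c , s , _ , at = rank-place m y t
  in subst (λ p → f p ≡ g p) at (trans (sym (f-flip s (position m c))) (trans (cong (flip s) (eq c)) (g-flip s (position m c))))

module _ {n₂ : ℕ} where

  private
    n : ℕ
    n = suc (suc n₂)

  front : Place n
  front = zero , false

  second : Place n
  second = suc zero , false

  same-order : ∀ (m : Model n) a → (∀ c → position m c ≡ rotate^ a (position m c)) → n + n ∣ a
  same-order m a eq = rotate^-period a (position m zero) (sym (eq zero))

  -- Rotations commute with `rotate`. But `second`, rotated and then exchanged, is `second` again,
  -- whereas exchanged and then rotated it becomes the last place with the opposite sign.
  exchange-not-rotation : ∀ a → ¬ (∀ p → apply (exchange {n₂}) p ≡ rotate^ a p)
  exchange-not-rotation a eq = absurd (begin
    (suc zero , false)                ≡⟨ eq front ⟩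
    rotate^ a (apply rotate second)   ≡⟨ rotate-back a second ⟩
    apply rotate (rotate^ a second)   ≡⟨ cong (apply rotate) (eq second) ⟨
    apply rotate front                ∎)
    where
    open ≡-Reasoning
    absurd : (suc zero , false) ≢ apply rotate front
    absurd ()

  -- A reflection is unchanged when composed with `rotate` on both sides. For the identity this
  -- would make `rotate` an involution, yet two rotations reverse the sign of `second`.
  identity-not-reflection : ∀ b → ¬ (∀ (p : Place n) → p ≡ apply reflect (rotate^ b p))
  identity-not-reflection b eq = absurd (begin
    apply rotate (apply rotate second)                              ≡⟨ cong (apply rotate) (eq (apply rotate second)) ⟩
    apply rotate (apply reflect (rotate^ b (apply rotate second)))  ≡⟨ rotate-reflect-rotate^ b second ⟩
    apply reflect (rotate^ b second)                                ≡⟨ eq second ⟨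
    second                                                          ∎)
    where
    open ≡-Reasoning
    absurd : apply rotate (apply rotate second) ≢ second
    absurd ()

  front-reached : ∀ (m : Model n) h → n ≡ h * 2 → apexRank m ≤ 1 → ∃[ t ] next^ t m ~ swapFront m
  -- From k = 0 to k = 1, z resets come with z (n + 1) - 1 rotations; z = n + 1 makes this n (n +
  -- 2), a multiple of 2n for even n.
  front-reached m@(model zero π ε) h n≡ _ = suc n + n * (2 + n) ,
    reach m (swapFront m) (suc n) (n * (2 + n)) (λ _ → refl) refl (ℕ.+-comm (n * (2 + n)) (suc n))
      (divides (suc h) (trans (cong (λ n′ → n * (2 + n′)) n≡)
        (solve 2 (λ h n → n :* (con 2 :+ h :* con 2) := (con 1 :+ h) :* (n :+ n)) refl h n)))
  -- From k = 1 to k = 0 there are z (n + 1) + 1 rotations; z = n - 1 makes this n * n.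
  front-reached m@(model (suc zero) π ε) h n≡ _ = 1 + suc n₂ * (2 + n) ,
    reach m (swapFront m) (suc n₂) (n * n) (λ _ → refl) refl
      (solve 1 (λ k → (con 2 :+ k) :* (con 2 :+ k) :+ (con 1 :+ k) := con 1 :+ (con 1 :+ k) :* (con 4 :+ k)) refl n₂)
      (divides h (trans (cong (n *_) n≡) (solve 2 (λ h n → n :* (h :* con 2) := h :* (n :+ n)) refl h n)))
  front-reached (model (suc (suc k)) π ε) h n≡ (s≤s ())

  -- Eliminates t from the two equations of `Elapsed`, leaving the number of rotations to be tested
  -- for divisibility.
  2∣steps : ∀ z a {b} → a + z ≡ b + z * (2 + n) → a ≡ b + z * (1 + n)
  2∣steps z a {b} eq = ℕ.+-cancelʳ-≡ z a (b + z * (1 + n)) (trans eq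
    (solve 3 (λ b z n → b :+ z :* (con 2 :+ n) := b :+ z :* (con 1 :+ n) :+ z) refl b z n))

  2∣2n : ∀ {a} → n + n ∣ a → 2 ∣ a
  2∣2n = ∣-trans (2∣n+n n)

  2∣1+n : ∀ h → n ≡ 1 + h * 2 → ∀ z → 2 ∣ z * (1 + n)
  2∣1+n h n≡ z = divides (z * (1 + h)) (trans (cong (λ n′ → z * (1 + n′)) n≡)
    (solve 2 (λ z h → z :* (con 2 :+ h :* con 2) := z :* (con 1 :+ h) :* con 2) refl z h))

  same-model-step : ∀ {m m′ : Model n} {t} → (e : Elapsed m t m′) → ∀ {m″} → m′ ~ m″ →
    apexRank m″ + t ≡ apexRank m + Elapsed.z e * (2 + n) × (∀ c → position m″ c ≡ rotate^ (Elapsed.a e) (position m c))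
  same-model-step {t = t} (elapsed z a apex-rank steps places) (k≡ , p≡) =
    trans (cong (λ k → toℕ k + t) (sym k≡)) apex-rank , λ c → trans (sym (p≡ c)) (places c)

  -- For k ≤ 1 the number of rotations is z (n + 1) - 1 or z (n + 1) + 1; if n is odd, this is odd
  -- and no multiple of 2n. For k ≥ 2 the transposition of the places would be a rotation.
  front-not-reached : ∀ (m : Model n) {t} → next^ t m ~ swapFront m → apexRank m ≤ 1 × (∀ h → n ≢ 1 + h * 2)
  front-not-reached m@(model zero π ε) {t} reached = z≤n , λ h n≡ → go h n≡ (elapse m t)
    where
    go : ∀ h → n ≡ 1 + h * 2 → Elapsed m t (next^ t m) → ⊥
    go h n≡ e@(elapsed z a _ steps _) = 2∤1 (∣m+n∣m⇒∣n {m = a} (subst (2 ∣_) (sym a≡) (2∣1+n h n≡ z)) (2∣2n (same-order m a (proj₂ same))))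
      where
      same : apexRank (swapFront m) + t ≡ 0 + z * (2 + n) × (∀ c → position (swapFront m) c ≡ rotate^ a (position m c))
      same = same-model-step e {swapFront m} reached
      a≡ : a + 1 ≡ z * (1 + n)
      a≡ = 2∣steps z (a + 1) {0} (trans (trans (cong (_+ z) (ℕ.+-comm a 1)) (cong suc steps)) (proj₁ same))
  front-not-reached m@(model (suc zero) π ε) {t} reached = s≤s z≤n , λ h n≡ → go h n≡ (elapse m t)
    where
    go : ∀ h → n ≡ 1 + h * 2 → Elapsed m t (next^ t m) → ⊥
    go h n≡ e@(elapsed z a _ steps _) = 2∤1 (∣m+n∣m⇒∣n {m = z * (1 + n)} (subst (2 ∣_) a≡ (2∣2n (same-order m a (proj₂ same)))) (2∣1+n h n≡ z))
      where
      same : apexRank (swapFront m) + t ≡ 1 + z * (2 + n) × (∀ c → position (swapFront m) c ≡ rotate^ a (position m c))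
      same = same-model-step e {swapFront m} reached
      a≡ : a ≡ z * (1 + n) + 1
      a≡ = trans (2∣steps z a {1} (trans steps (proj₁ same))) (ℕ.+-comm 1 (z * (1 + n)))
  front-not-reached m@(model (suc (suc k)) π ε) {t} reached = ⊥-elim (go (elapse m t))
    where
    go : Elapsed m t (next^ t m) → ⊥
    go e = exchange-not-rotation (Elapsed.a e) (everywhere m (flip-apply exchange) (λ s p → flip-rotate^ s (Elapsed.a e) p)
             (proj₂ (same-model-step e {swapFront m} reached)))

  reverse-places : ∀ (m : Model n) t → ∃[ b ] (∀ c → position (reverseModel (next^ t m)) c ≡ apply reflect (rotate^ b (position m c)))
  reverse-places m t = go (elapse m t) (apexRank (next^ t m) ℕ.<? suc n)
    where
    go : Elapsed m t (next^ t m) → (k<? : Dec (apexRank (next^ t m) < suc n)) →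
         ∃[ b ] (∀ c → position (reverseBy (next^ t m) k<?) c ≡ apply reflect (rotate^ b (position m c)))
    go e (yes k<) = Elapsed.a e , λ c → cong (apply reflect) (Elapsed.places e c)
    go e (no  k≮) = suc (Elapsed.a e) , λ c → cong (apply reflect)
      (trans (cong (apply rotate) (Elapsed.places e c)) (rotate^-suc (Elapsed.a e) (position m c)))

  flip-reflect-rotate^ : ∀ b s (p : Place n) → flip s (apply reflect (rotate^ b p)) ≡ apply reflect (rotate^ b (flip s p))
  flip-reflect-rotate^ b s p = trans (flip-apply reflect s (rotate^ b p)) (cong (apply reflect) (flip-rotate^ s b p))

  -- The transposition fixes the third place, available from n = 3 on. Composed with `rotate` on
  -- both sides, it sends that place to the last one with the opposite sign, so it is no reflection.
  exchange-not-reflection : 0 < n₂ → ∀ b → ¬ (∀ p → apply (exchange {n₂}) p ≡ apply reflect (rotate^ b p))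
  exchange-not-reflection 0<n₂ b eq = absurd (begin
    apply rotate (apply exchange (apply rotate third))              ≡⟨ cong (apply rotate) (eq (apply rotate third)) ⟩
    apply rotate (apply reflect (rotate^ b (apply rotate third)))   ≡⟨ rotate-reflect-rotate^ b third ⟩
    apply reflect (rotate^ b third)                                 ≡⟨ eq third ⟨
    apply exchange third                                            ∎)
    where
    open ≡-Reasoning
    third : Place n
    third = suc (suc (fromℕ< 0<n₂)) , false
    absurd : apply rotate (apply (exchange {n₂}) (apply rotate third)) ≢ apply (exchange {n₂}) third
    absurd = go 0<n₂
      where
      go : ∀ {k} (0<k : 0 < k) → apply rotate (apply (exchange {k}) (apply rotate (suc (suc (fromℕ< 0<k)) , false)))
           ≢ apply (exchange {k}) (suc (suc (fromℕ< 0<k)) , false)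
      go {suc k} 0<k ()

  -- For k ≤ 1 the places stay put, and the identity would be a reflection; for k ≥ 2 the
  -- transposition would be one, which only n = 2 permits.
  reverse-not-reached : ∀ (m : Model n) {t} → swapFront m ~ reverseModel (next^ t m) → n₂ ≡ 0 × 2 ≤ apexRank m
  reverse-not-reached (model zero π ε) {t} (_ , p≡) =
    let m = model zero π ε ; b , places = reverse-places m t in
    ⊥-elim (identity-not-reflection b (everywhere m (λ _ _ → refl) (flip-reflect-rotate^ b) (λ c → trans (p≡ c) (places c))))
  reverse-not-reached (model (suc zero) π ε) {t} (_ , p≡) =
    let m = model (suc zero) π ε ; b , places = reverse-places m t in
    ⊥-elim (identity-not-reflection b (everywhere m (λ _ _ → refl) (flip-reflect-rotate^ b) (λ c → trans (p≡ c) (places c))))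
  reverse-not-reached (model (suc (suc k)) π ε) {t} (_ , p≡) =
    let m = model (suc (suc k)) π ε ; b , places = reverse-places m t in
    ℕ.n≤0⇒n≡0 (ℕ.≮⇒≥ λ 0<n₂ → exchange-not-reflection 0<n₂ b
      (everywhere m (flip-apply exchange) (flip-reflect-rotate^ b) (λ c → trans (p≡ c) (places c))))
    , s≤s (s≤s z≤n)

-- In the pyramid over the square, the exchange of the first two places is a
-- reflection.
exchange≡reflect : ∀ (p : Place 2) → apply exchange p ≡ apply reflect (rotate^ 8 p)
exchange≡reflect (zero     , false) = refl
exchange≡reflect (zero     , true)  = refl
exchange≡reflect (suc zero , false) = refl
exchange≡reflect (suc zero , true)  = refl

exchange≡rotate-reflect : ∀ (p : Place 2) → apply exchange p ≡ apply rotate-reflect (rotate^ 3 p)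
exchange≡rotate-reflect (zero     , false) = refl
exchange≡rotate-reflect (zero     , true)  = refl
exchange≡rotate-reflect (suc zero , false) = refl
exchange≡rotate-reflect (suc zero , true)  = refl

reverse-reached : ∀ (m : Model 2) → 2 ≤ apexRank m → ∃[ t ] swapFront m ~ reverseModel (next^ t m)
-- Reversal takes k ≤ 2 to 2 - k, so the apex must first go from 2 to 0: 2 + 4 z steps, of which 2 +
-- 3 z are rotations. The first multiple of 4 among these is 8, for z = 2.
reverse-reached m@(model (suc (suc zero)) π ε)       _ = 10 , refl , exchange≡reflect ∘ position m
-- Reversal keeps k = 3. One round of 4 steps has 3 rotations, and the one in `rotate-reflect`
-- completes the circle.
reverse-reached m@(model (suc (suc (suc zero))) π ε) _ = 4 , refl , exchange≡rotate-reflect ∘ position m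
reverse-reached (model (suc zero) π ε) (s≤s ())

-- Counting along periodic sequences

count : (ℕ → Bool) → ℕ → ℕ
count f zero    = 0
count f (suc t) = (if f 0 then 1 else 0) + count (f ∘ suc) t

count-snoc : ∀ f t → count f (suc t) ≡ count f t + (if f t then 1 else 0)
count-snoc f zero    = ℕ.+-identityʳ _
count-snoc f (suc t) = trans (cong ((if f 0 then 1 else 0) +_) (count-snoc (f ∘ suc) t)) (sym (ℕ.+-assoc (if f 0 then 1 else 0) _ _))

count-+ : ∀ f s t → count f (s + t) ≡ count f s + count (λ i → f (s + i)) t
count-+ f zero    t = refl
count-+ f (suc s) t = trans (cong ((if f 0 then 1 else 0) +_) (count-+ (f ∘ suc) s t)) (sym (ℕ.+-assoc (if f 0 then 1 else 0) _ _))

count-cong : ∀ {f g} → (∀ i → f i ≡ g i) → ∀ t → count f t ≡ count g t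
count-cong eq zero    = refl
count-cong eq (suc t) = cong₂ (λ b k → (if b then 1 else 0) + k) (eq 0) (count-cong (eq ∘ suc) t)

count-false : ∀ f t → (∀ i → i < t → f i ≡ false) → count f t ≡ 0
count-false f zero    eq = refl
count-false f (suc t) eq rewrite eq 0 (s≤s z≤n) = count-false (f ∘ suc) t (λ i i<t → eq (suc i) (s≤s i<t))

-- Sliding the window by one drops the value at s and gains the equal value at s + N.
count-shift : ∀ f N → (∀ i → f (i + N) ≡ f i) → ∀ s → count (λ i → f (s + i)) N ≡ count f N
count-shift f N periodic zero    = refl
count-shift f N periodic (suc s) = trans (ℕ.+-cancelˡ-≡ b _ _ (begin
  b + count (λ i → f (suc s + i)) N                       ≡⟨ cong (b +_) (count-cong (λ i → cong f (ℕ.+-suc s i)) N) ⟨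
  b + count (λ i → f (s + suc i)) N                       ≡⟨ count-snoc (λ i → f (s + i)) N ⟩
  count (λ i → f (s + i)) N + (if f (s + N) then 1 else 0) ≡⟨ cong (λ x → count (λ i → f (s + i)) N + (if x then 1 else 0)) (trans (periodic s) (cong f (sym (ℕ.+-identityʳ s)))) ⟩
  count (λ i → f (s + i)) N + b                           ≡⟨ ℕ.+-comm _ b ⟩
  b + count (λ i → f (s + i)) N                           ∎)) (count-shift f N periodic s)
  where
  open ≡-Reasoning
  b : ℕ
  b = if f (s + 0) then 1 else 0

count-periods : ∀ f N → (∀ i → f (i + N) ≡ f i) → ∀ q → count f (q * N) ≡ q * count f N
count-periods f N periodic zero    = refl
count-periods f N periodic (suc q) = trans (count-+ f N (q * N)) (cong (count f N +_)
  (trans (count-cong (λ i → trans (cong f (ℕ.+-comm N i)) (periodic i)) (q * N)) (count-periods f N periodic q)))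

∣tabulate∣ : ∀ l (f : ℕ → Bool) → ∣ tabulate {n = l} (f ∘ toℕ) ∣ ≡ count f l
∣tabulate∣ zero    f = refl
∣tabulate∣ (suc l) f with f 0
... | true  = cong suc (∣tabulate∣ l (f ∘ suc))
... | false = ∣tabulate∣ l (f ∘ suc)

count-cong-< : ∀ {f g} t → (∀ i → i < t → f i ≡ g i) → count f t ≡ count g t
count-cong-< zero    eq = refl
count-cong-< (suc t) eq = cong₂ (λ b k → (if b then 1 else 0) + k) (eq 0 (s≤s z≤n)) (count-cong-< t (λ i i<t → eq (suc i) (s≤s i<t)))

∈-tabulate⇔ : ∀ {l} (f : Fin l → Bool) j → j ∈ tabulate f ⇔ f j ≡ true
∈-tabulate⇔ f j = mk⇔ (λ j∈ → trans (sym (lookup∘tabulate f j)) ([]=⇒lookup j∈))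
                      (λ fj → lookup⇒[]= j (tabulate f) (trans (lookup∘tabulate f j) fj))

does-true : ∀ {A : Set} (A? : Dec A) → does A? ≡ true → A
does-true (yes a) _ = a

module _ {n : ℕ} where

  apexRank-at : ∀ (m : Model n) t k z → k < 2 + n → k + t ≡ apexRank m + z * (2 + n) → apexRank (next^ t m) ≡ k
  apexRank-at m t k z k< eq = go (elapse m t)
    where
    open ≡-Reasoning
    swap : ∀ a b c → a + b + c ≡ a + c + b
    swap = solve 3 (λ a b c → a :+ b :+ c := a :+ c :+ b) refl
    go : Elapsed m t (next^ t m) → apexRank (next^ t m) ≡ k
    go (elapsed z′ _ apex-rank _ _) = proj₁ (residue-unique (2 + n) z z′ (apexRank< (next^ t m)) k< (ℕ.+-cancelʳ-≡ t _ _ (begin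
      apexRank (next^ t m) + z * (2 + n) + t    ≡⟨ swap (apexRank (next^ t m)) (z * (2 + n)) t ⟩
      apexRank (next^ t m) + t + z * (2 + n)    ≡⟨ cong (_+ z * (2 + n)) apex-rank ⟩
      apexRank m + z′ * (2 + n) + z * (2 + n)   ≡⟨ swap (apexRank m) (z′ * (2 + n)) (z * (2 + n)) ⟩
      apexRank m + z * (2 + n) + z′ * (2 + n)   ≡⟨ cong (_+ z′ * (2 + n)) eq ⟨
      k + t + z′ * (2 + n)                      ≡⟨ swap k t (z′ * (2 + n)) ⟩
      k + z′ * (2 + n) + t                      ∎)))

  -- The positions of the apex, beginning with a flag where it is 1.
  descent : ℕ → ℕ
  descent 0             = 1
  descent 1             = 0
  descent (suc (suc j)) = suc n ∸ j

  -- The offset k + (n + 1) consists of k steps down to 0, one reset to n + 1 and n steps down to 1.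
  -- Starting at 1 places the two values at most 1 at the beginning of the round.
  descent-from : ∀ (m : Model n) i → i < 2 + n → apexRank (next^ (apexRank m + suc n + i) m) ≡ descent i
  descent-from m 0 _ = apexRank-at m (apexRank m + suc n + 0) 1 1 (s≤s (s≤s z≤n))
    (solve 2 (λ k n → con 1 :+ (k :+ (con 1 :+ n) :+ con 0) := k :+ con 1 :* (con 2 :+ n)) refl (apexRank m) n)
  descent-from m 1 _ = apexRank-at m (apexRank m + suc n + 1) 0 1 (s≤s z≤n)
    (solve 2 (λ k n → k :+ (con 1 :+ n) :+ con 1 := k :+ con 1 :* (con 2 :+ n)) refl (apexRank m) n)
  descent-from m (suc (suc j)) (s≤s (s≤s j<n)) = apexRank-at m (apexRank m + suc n + (2 + j)) (suc n ∸ j) 2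
    (s≤s (ℕ.m∸n≤m (suc n) j)) (begin
      (suc n ∸ j) + (apexRank m + suc n + (2 + j))
        ≡⟨ solve 4 (λ d k n j → d :+ (k :+ n :+ (con 2 :+ j)) := d :+ j :+ (k :+ n :+ con 2)) refl (suc n ∸ j) (apexRank m) (suc n) j ⟩
      (suc n ∸ j) + j + (apexRank m + suc n + 2)
        ≡⟨ cong (_+ (apexRank m + suc n + 2)) (ℕ.m∸n+n≡m (ℕ.≤-trans (ℕ.<⇒≤ j<n) (ℕ.n≤1+n n))) ⟩
      suc n + (apexRank m + suc n + 2)
        ≡⟨ solve 2 (λ k n → (con 1 :+ n) :+ (k :+ (con 1 :+ n) :+ con 2) := k :+ con 2 :* (con 2 :+ n)) refl (apexRank m) n ⟩
      apexRank m + 2 * (2 + n) ∎)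
    where open ≡-Reasoning

  count-apex : ∀ (m : Model n) (b : ℕ → Bool) q →
    count (λ t → b (apexRank (next^ t m))) (q * (2 + n)) ≡ q * count (b ∘ descent) (2 + n)
  count-apex m b q = trans (count-periods f (2 + n) (cong b ∘ periodic) q) (cong (q *_) (begin
    count f (2 + n)                                        ≡⟨ count-shift f (2 + n) (cong b ∘ periodic) (apexRank m + suc n) ⟨
    count (λ i → f (apexRank m + suc n + i)) (2 + n)       ≡⟨ count-cong-< (2 + n) (λ i i< → cong b (descent-from m i i<)) ⟩
    count (b ∘ descent) (2 + n)                            ∎))
    where
    open ≡-Reasoning
    f : ℕ → Bool
    f t = b (apexRank (next^ t m))
    periodic : ∀ t → apexRank (next^ (t + (2 + n)) m) ≡ apexRank (next^ t m)
    periodic t = go (elapse m t)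
      where
      go : Elapsed m t (next^ t m) → apexRank (next^ (t + (2 + n)) m) ≡ apexRank (next^ t m)
      go (elapsed z _ apex-rank _ _) = apexRank-at m (t + (2 + n)) (apexRank (next^ t m)) (suc z) (apexRank< (next^ t m)) (begin
        apexRank (next^ t m) + (t + (2 + n))   ≡⟨ ℕ.+-assoc (apexRank (next^ t m)) t (2 + n) ⟨
        apexRank (next^ t m) + t + (2 + n)     ≡⟨ cong (_+ (2 + n)) apex-rank ⟩
        apexRank m + z * (2 + n) + (2 + n)     ≡⟨ solve 3 (λ k z N → k :+ z :* N :+ N := k :+ (con 1 :+ z) :* N) refl (apexRank m) z (2 + n) ⟩
        apexRank m + suc z * (2 + n)           ∎)

atMost1 atLeast2 : ℕ → Bool
atMost1  k = does (k ≤? 1)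
atLeast2 k = does (2 ≤? k)

count-atMost1 : ∀ n → count (atMost1 ∘ descent {n}) (2 + n) ≡ 2
count-atMost1 n = cong (2 +_) (count-false (λ j → atMost1 (suc n ∸ j)) n λ j j<n →
  dec-false (suc n ∸ j ≤? 1) (ℕ.<⇒≱ (ℕ.m+n≤o⇒m≤o∸n 2 (s≤s j<n))))

-- The number of rounds in a zigzag: the least z > 0 such that 2n divides z (n + 1).
turns : ∀ n → Parity n → ℕ
turns n (even _ _) = n + n
turns n (odd _ _)  = n

turns-period : ∀ n (par : Parity n) → n + n ∣ turns n par * (1 + n)
turns-period n (even h _)  = m∣m*n (1 + n)
turns-period n (odd h n≡)  = divides (suc h) (trans (cong (λ n′ → n * (1 + n′)) n≡)
  (solve 2 (λ h n → n :* (con 2 :+ h :* con 2) := (con 1 :+ h) :* (n :+ n)) refl h n))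

-- Since z (n + 1) = z n + z, n divides z. For even n write z = w n and cancel n: then 2 divides w n
-- + w, hence w.
∣-turns : ∀ n₁ (par : Parity (suc n₁)) {z} → suc n₁ + suc n₁ ∣ z * (1 + suc n₁) → turns (suc n₁) par ∣ z
∣-turns n₁ par {z} 2n∣ = go par
  where
  n : ℕ
  n = suc n₁
  n∣z : n ∣ z
  n∣z = ∣m+n∣m⇒∣n (subst (n ∣_) (trans (ℕ.*-suc z n) (ℕ.+-comm z (z * n))) (∣-trans (divides 2 (solve 1 (λ n → n :+ n := con 2 :* n) refl n)) 2n∣)) (n∣m*n z)
  go : (par : Parity n) → turns n par ∣ z
  go (odd h n≡)  = n∣z
  go (even h n≡) = double n∣z
    where
    double : n ∣ z → n + n ∣ z
    double (divides w z≡) = ∣-trans (∣-reflexive (solve 1 (λ n → n :+ n := con 2 :* n) refl n)) (subst (2 * n ∣_) (sym z≡) (*-monoˡ-∣ n 2∣w))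
      where
      2∣w+wn : 2 ∣ w * n + w
      2∣w+wn = *-cancelˡ-∣ n (subst₂ _∣_ (solve 1 (λ n → n :+ n := n :* con 2) refl n)
        (trans (cong (_* (1 + n)) z≡) (solve 2 (λ w n → w :* n :* (con 1 :+ n) := n :* (w :* n :+ w)) refl w n)) 2n∣)
      2∣w : 2 ∣ w
      2∣w = ∣m+n∣m⇒∣n 2∣w+wn (∣-trans (divides h n≡) (n∣m*n w))

-- Length and signature of the zigzags

module _ {n₂ : ℕ} where

  private
    n : ℕ
    n = suc (suc n₂)

  open Pyramid n
  open Faces P renaming (_≤_ to _≤ᶠ_; _≈_ to _≈ᶠᶜ_)
  open Flags P

  next^-period : ∀ (par : Parity n) (m : Model n) → next^ (turns n par * (2 + n)) m ~ m
  next^-period par m = reach m m (turns n par) (turns n par * (1 + n)) (λ _ → refl) refl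
    (solve 2 (λ z n → z :* (con 1 :+ n) :+ z := z :* (con 2 :+ n)) refl (turns n par) n) (turns-period n par)

  period-divides : ∀ (par : Parity n) (m : Model n) t → next^ t m ~ m → turns n par * (2 + n) ∣ t
  period-divides par m t returned = go (elapse m t)
    where
    go : Elapsed m t (next^ t m) → turns n par * (2 + n) ∣ t
    go e@(elapsed z a _ steps _) = subst (turns n par * (2 + n) ∣_) (sym t≡) (*-monoˡ-∣ (2 + n) turns∣z)
      where
      same : apexRank m + t ≡ apexRank m + z * (2 + n) × (∀ c → position m c ≡ rotate^ a (position m c))
      same = same-model-step e {m} returned
      t≡ : t ≡ z * (2 + n)
      t≡ = ℕ.+-cancelˡ-≡ (apexRank m) t (z * (2 + n)) (proj₁ same)
      a≡ : a ≡ z * (1 + n)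
      a≡ = 2∣steps z a {0} (trans steps t≡)
      turns∣z : turns n par ∣ z
      turns∣z = ∣-turns (suc n₂) par {z} (subst (n + n ∣_) a≡ (same-order m a (proj₂ same)))

  transport : ∀ {f m m′} → f HasModel m → m ~ m′ → f HasModel m′
  transport {f} {m} {m′} fm m~m′ i = trans (fm i) (level-cong {n} {m} {m′} (rank-cong {n} {m} {m′} m~m′) (suc (toℕ i)))

  module Walk (l : ℕ) .{{_ : NonZero l}} (fl : Fin l → Flag)
    (distinct : ∀ j k → fl j ≈ᶠ fl k → j ≡ k) (step : ∀ j → T (fl j) (fl (suc (toℕ j) mod l))) where

    M : Fin l → Model n
    M j = proj₁ (modelOf (fl j))

    fits : ∀ j → fl j HasModel M j
    fits j = proj₂ (modelOf (fl j))

    toℕ-mod : ∀ x → toℕ (x mod l) ≡ x % l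
    toℕ-mod x = toℕ-fromℕ< (m%n<n x l)

    mod-cong : ∀ {x y} → x % l ≡ y % l → x mod l ≡ y mod l
    mod-cong {x} {y} eq = toℕ-injective (trans (toℕ-mod x) (trans eq (sym (toℕ-mod y))))

    toℕ-mod-id : ∀ (j : Fin l) → toℕ j mod l ≡ j
    toℕ-mod-id j = toℕ-injective (trans (toℕ-mod (toℕ j)) (m<n⇒m%n≡m (toℕ<n j)))

    suc-mod : ∀ x → suc (toℕ (x mod l)) mod l ≡ suc x mod l
    suc-mod x = mod-cong (begin
      suc (toℕ (x mod l)) % l          ≡⟨ cong (λ y → suc y % l) (toℕ-mod x) ⟩
      (1 + x % l) % l                  ≡⟨ %-distribˡ-+ 1 (x % l) l ⟩
      (1 % l + x % l % l) % l          ≡⟨ cong (λ y → (1 % l + y) % l) (m%n%n≡m%n x l) ⟩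
      (1 % l + x % l) % l              ≡⟨ %-distribˡ-+ 1 x l ⟨
      suc x % l                        ∎)
      where open ≡-Reasoning

    abstract

      walk : ∀ j t → M ((toℕ j + t) mod l) ~ next^ t (M j)
      walk j zero    = subst (λ i → M i ~ M j) (sym (trans (cong (_mod l) (ℕ.+-identityʳ (toℕ j))) (toℕ-mod-id j))) (~-refl {m = M j})
      walk j (suc t) = ~-trans {m = M ((toℕ j + suc t) mod l)} {next (M x)} {next^ (suc t) (M j)}
          (subst (λ i → M i ~ next (M x)) (trans (suc-mod (toℕ j + t)) (cong (_mod l) (sym (ℕ.+-suc (toℕ j) t))))
            (T-next {f = fl x} {fl (suc (toℕ x) mod l)} (fits x) (fits (suc (toℕ x) mod l)) (step x)))
          (next-cong {m = M x} {next^ t (M j)} (walk j t))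
        where
        x : Fin l
        x = (toℕ j + t) mod l

      start : Fin l
      start = 0 mod l

      toℕ-start : toℕ start ≡ 0
      toℕ-start = trans (toℕ-mod 0) (m<n⇒m%n≡m (ℕ.>-nonZero⁻¹ l))

      walk-start : ∀ j → M j ~ next^ (toℕ j) (M start)
      walk-start j = subst (λ i → M i ~ next^ (toℕ j) (M start))
        (trans (cong (λ s → (s + toℕ j) mod l) toℕ-start) (toℕ-mod-id j)) (walk start (toℕ j))

      apart : ∀ j k → Σ ℕ λ t → M k ~ next^ t (M j)
      apart j k = t , subst (λ i → M i ~ next^ t (M j)) (trans (mod-cong (begin
          (toℕ j + (toℕ k + (l ∸ toℕ j))) % l  ≡⟨ cong (_% l) (solve 3 (λ j k d → j :+ (k :+ d) := k :+ (j :+ d)) refl (toℕ j) (toℕ k) (l ∸ toℕ j)) ⟩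
          (toℕ k + (toℕ j + (l ∸ toℕ j))) % l  ≡⟨ cong (λ x → (toℕ k + x) % l) (ℕ.m+[n∸m]≡n (ℕ.<⇒≤ (toℕ<n j))) ⟩
          (toℕ k + l) % l                      ≡⟨ [m+n]%n≡m%n (toℕ k) l ⟩
          toℕ k % l                            ∎)) (toℕ-mod-id k)) (walk j t)
        where
        open ≡-Reasoning
        t : ℕ
        -- This is k - j modulo l, with l added to stay nonnegative.
        t = toℕ k + (l ∸ toℕ j)

      length-divides : ∀ t → next^ t (M start) ~ M start → l ∣ t
      length-divides t returned = m%n≡0⇒n∣m t l (begin
          t % l                       ≡⟨ cong (λ s → (s + t) % l) toℕ-start ⟨
          (toℕ start + t) % l         ≡⟨ toℕ-mod (toℕ start + t) ⟨
          toℕ ((toℕ start + t) mod l) ≡⟨ cong toℕ (distinct ((toℕ start + t) mod l) start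
                                          (hasModel-cong {f = fl ((toℕ start + t) mod l)} {fl start} {m = M ((toℕ start + t) mod l)} {M start}
                                            (~-trans {m = M ((toℕ start + t) mod l)} {next^ t (M start)} {M start} (walk start t) returned)
                                            (fits ((toℕ start + t) mod l)) (fits start))) ⟩
          toℕ start                   ≡⟨ toℕ-start ⟩
          0                           ∎)
        where open ≡-Reasoning

      full-turn : next^ l (M start) ~ M start
      full-turn = subst (λ i → next^ l (M start) ~ M i) (trans (mod-cong (trans (cong (λ s → (s + l) % l) toℕ-start) ([m+n]%n≡m%n 0 l)))
          refl) (~-sym {m = M ((toℕ start + l) mod l)} {next^ l (M start)} (walk start l))

      -- As the flags are distinct, l divides every return time; as the circuit closes after l
      -- steps, the period divides l.
      length≡ : ∀ (par : Parity n) → l ≡ turns n par * (2 + n)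
      length≡ par = ∣-antisym (length-divides _ (next^-period par (M start))) (period-divides par (M start) l full-turn)

    SameZigzag OppositeZigzag : Fin l → Set
    SameZigzag     j = ∃[ g ] σ zero (fl j) g × ∃[ k ] fl k ≈ᶠ g
    OppositeZigzag j = ∃[ g ] σ zero (fl j) g × ∃[ k ] Reverse (fl k) g

    abstract

      -- Any flag of the circuit arises from flag j by some number of steps, so its index can be
      -- traded for a time t. This and the next three lemmas reduce the signature to statements
      -- about models.
      same⇒reached : ∀ j → SameZigzag j → ∃[ t ] next^ t (M j) ~ swapFront (M j)
      same⇒reached j (g , f⇝g , k , fk≈g) = t , ~-trans {m = next^ t (M j)} {M k} {swapFront (M j)}
          (~-sym {m = M k} {next^ t (M j)} at) (~-trans {m = M k} {m} {swapFront (M j)}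
            (hasModel-unique {f = fl k} {g} {M k} {m} fk≈g (fits k) gm) (σ₀-model {f = fl j} {g} {M j} {m} (fits j) gm f⇝g))
        where
        m : Model n
        m = proj₁ (modelOf g)
        gm : g HasModel m
        gm = proj₂ (modelOf g)
        t : ℕ
        t = proj₁ (apart j k)
        at : M k ~ next^ t (M j)
        at = proj₂ (apart j k)

      reached⇒same : ∀ j → ∃[ t ] next^ t (M j) ~ swapFront (M j) → SameZigzag j
      reached⇒same j (t , reached) = g , model-σ₀ {f = fl j} {g} {M j} (fits j) (λ _ → refl) , k ,
          hasModel-cong {f = fl k} {g} {M k} {swapFront (M j)}
            (~-trans {m = M k} {next^ t (M j)} {swapFront (M j)} (walk j t) reached) (fits k) (λ _ → refl)
        where
        g : Flag
        g = flag-of zero (swapFront (M j))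
        k : Fin l
        k = (toℕ j + t) mod l

      opposite⇒reached : ∀ j → OppositeZigzag j → ∃[ t ] swapFront (M j) ~ reverseModel (next^ t (M j))
      opposite⇒reached j (g , f⇝g , k , reversed) = t , ~-trans {m = swapFront (M j)} {m} {reverseModel (next^ t (M j))}
          (~-sym {m = m} {swapFront (M j)} (σ₀-model {f = fl j} {g} {M j} {m} (fits j) gm f⇝g))
          (Reverse-model {f = fl k} {g} {next^ t (M j)} {m} (transport {fl k} {M k} {next^ t (M j)} (fits k) at) gm reversed)
        where
        m : Model n
        m = proj₁ (modelOf g)
        gm : g HasModel m
        gm = proj₂ (modelOf g)
        t : ℕ
        t = proj₁ (apart j k)
        at : M k ~ next^ t (M j)
        at = proj₂ (apart j k)

      reached⇒opposite : ∀ j → ∃[ t ] swapFront (M j) ~ reverseModel (next^ t (M j)) → OppositeZigzag j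
      reached⇒opposite j (t , reached) = g
          , model-σ₀ {f = fl j} {g} {M j} (fits j) (λ _ → refl)
          , k , model-Reverse {f = fl k} {g} {next^ t (M j)} (transport {fl k} {M k} {next^ t (M j)} (fits k) (walk j t))
              (transport {g} {swapFront (M j)} {reverseModel (next^ t (M j))} (λ _ → refl) reached)
        where
        g : Flag
        g = flag-of zero (swapFront (M j))
        k : Fin l
        k = (toℕ j + t) mod l

    count-by-apex : ∀ (par : Parity n) (b : ℕ → Bool) →
      ∣ tabulate (b ∘ apexRank ∘ M) ∣ ≡ turns n par * count (b ∘ descent {n}) (2 + n)
    count-by-apex par b = begin
      ∣ tabulate (b ∘ apexRank ∘ M) ∣                     ≡⟨ cong ∣_∣ (tabulate-cong (λ j → cong (b ∘ toℕ) (proj₁ (walk-start j)))) ⟩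
      ∣ tabulate {n = l} (f ∘ toℕ) ∣                              ≡⟨ ∣tabulate∣ l f ⟩
      count f l                                           ≡⟨ cong (count f) (length≡ par) ⟩
      count f (turns n par * (2 + n))                     ≡⟨ count-apex (M start) b (turns n par) ⟩
      turns n par * count (b ∘ descent {n}) (2 + n)       ∎
      where
      open ≡-Reasoning
      f : ℕ → Bool
      f t = b (apexRank (next^ t (M start)))

    none : ∀ {Q : Fin l → Set} → (∀ j → ¬ Q j) → HasCount Q 0
    none ¬Q = ∅ , (λ j → mk⇔ (λ j∈ → contradiction j∈ ∉⊥) (λ q → contradiction q (¬Q j))) , ∣⊥∣≡0 l

    counted : ∀ (par : Parity n) (b : ℕ → Bool) {Q : Fin l → Set} →
      (∀ j → b (apexRank (M j)) ≡ true → Q j) → (∀ j → Q j → b (apexRank (M j)) ≡ true) →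
      HasCount Q (turns n par * count (b ∘ descent {n}) (2 + n))
    counted par b {Q} to from = tabulate (b ∘ apexRank ∘ M) , (λ j → mk⇔
        (λ j∈ → to j (Equivalence.to (∈-tabulate⇔ (b ∘ apexRank ∘ M) j) j∈))
        (λ q → Equivalence.from (∈-tabulate⇔ (b ∘ apexRank ∘ M) j) (from j q)))
      , count-by-apex par b

    same-odd : ∀ h → n ≡ 1 + h * 2 → HasCount SameZigzag 0
    same-odd h n≡ = none λ j same → proj₂ (front-not-reached (M j) {proj₁ (same⇒reached j same)} (proj₂ (same⇒reached j same))) h n≡

    same-even : ∀ h (n≡ : n ≡ h * 2) → HasCount SameZigzag (2 * (n + n))
    same-even h n≡ = subst (HasCount SameZigzag) (trans (cong ((n + n) *_) (count-atMost1 n)) (ℕ.*-comm (n + n) 2))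
      (counted (even h n≡) atMost1
        (λ j k≤1 → reached⇒same j (front-reached (M j) h n≡ (does-true (apexRank (M j) ≤? 1) k≤1)))
        (λ j same → dec-true (apexRank (M j) ≤? 1) (proj₁ (front-not-reached (M j) {proj₁ (same⇒reached j same)} (proj₂ (same⇒reached j same))))))

    opposite-none : n₂ ≢ 0 → HasCount OppositeZigzag 0
    opposite-none n₂≢0 = none λ j opp → n₂≢0 (proj₁ (reverse-not-reached (M j) {proj₁ (opposite⇒reached j opp)} (proj₂ (opposite⇒reached j opp))))

-- The number 8 arises from 2n = 4 rounds, each passing once through k = 2 and once through k = 3.
opposite-square : let open Flags (Pyramid.P 2) in ∀ (l : ℕ) .{{_ : NonZero l}} (fl : Fin l → Flag)
  (distinct : ∀ j k → fl j ≈ᶠ fl k → j ≡ k) (step : ∀ j → T (fl j) (fl (suc (toℕ j) mod l))) →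
  HasCount (Walk.OppositeZigzag {0} l fl distinct step) 8
opposite-square l fl distinct step = counted (even 1 refl) atLeast2
    (λ j 2≤k → reached⇒opposite j (reverse-reached (M j) (does-true (2 ≤? apexRank (M j)) 2≤k)))
    (λ j opp → dec-true (2 ≤? apexRank (M j)) (proj₂ (reverse-not-reached (M j) {proj₁ (opposite⇒reached j opp)} (proj₂ (opposite⇒reached j opp)))))
  where open Walk {0} l fl distinct step

zUniform : ∀ n₂ → Flags.ZUniform (Pyramid.P (2 + n₂))
zUniform zero = 16 , 4 , 4 , λ
  { record { length = l ; length≢0 = l≢0 ; flag = fl ; distinct = distinct ; step = step } →
    Walk.length≡ {0} l {{l≢0}} fl distinct step (even 1 refl)
    , Walk.same-even {0} l {{l≢0}} fl distinct step 1 refl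
    , opposite-square l {{l≢0}} fl distinct step }
zUniform n₂@(suc _) = go (parity (2 + n₂))
  where
  go : Parity (2 + n₂) → Flags.ZUniform (Pyramid.P (2 + n₂))
  go par@(even h n≡) = _ , (2 + n₂) + (2 + n₂) , 0 , λ
    { record { length = l ; length≢0 = l≢0 ; flag = fl ; distinct = distinct ; step = step } →
      Walk.length≡ {n₂} l {{l≢0}} fl distinct step par
      , Walk.same-even {n₂} l {{l≢0}} fl distinct step h n≡
      , Walk.opposite-none {n₂} l {{l≢0}} fl distinct step (λ ()) }
  go par@(odd h n≡) = _ , 0 , 0 , λ
    { record { length = l ; length≢0 = l≢0 ; flag = fl ; distinct = distinct ; step = step } →
      Walk.length≡ {n₂} l {{l≢0}} fl distinct step par
      , Walk.same-odd {n₂} l {{l≢0}} fl distinct step h n≡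
      , Walk.opposite-none {n₂} l {{l≢0}} fl distinct step (λ ()) }

proposition4p3 : (d : ℕ) → 3 ≤ d →
    let open Flags (pyramid (crossPolytope (d ∸ 1))) in
    ( HasClasses _≈ᶠ_ ((d + 1) * (d ∸ 1) ! * 2 ^ (d ∸ 1))
    × HasClasses SameOrbit (d + 1) )
    × ZUniform
proposition4p3 (suc (suc (suc n₂))) (s≤s (s≤s (s≤s _))) = (flag-classes , flag-orbits) , zUniform n₂
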